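{- The coproduct $\Delta$ on $\mathbf{FQSym}^{(l)}$ is an algebra homomorphism $\mathbf{FQSym}^{(l)}\to \mathbf{FQSym}^{(l)}\otimes\mathbf{FQSym}^{(l)}$, so that $\mathbf{FQSym}^{(l)}$ is a graded bialgebra. Moreover, it is a Hopf algebra.
   Context: Fix an integer $l\ge1$ and a set of colors $C$ with $l$ elements. A colored permutation of size $n\ge0$ is a pair $(\sigma,u)$ with $\sigma\in\mathfrak S_n$, $u\in C^n$ (permutations are written as words $\sigma(1)\cdots\sigma(n)$; color words are indexed by positions). The standardization $\mathrm{Std}(v)$ of a word $v$ over the positive integers is the permutation obtained by numbering $1,2,\dots$ the occurrences of the smallest letter of $v$ from left to right, then the occurrences of the next smallest letter, and so on. $\mathbf{FQSym}^{(l)}$ is the $\mathbb C$-vector space with basis $(\mathbf G_{\sigma,u})$ indexed by all colored permutations, graded by size. It is realized as a subalgebra of noncommutative formal series of bounded degree over the alphabet $A=\{1,2,3,\dots\}\times C$ by $$\mathbf G_{\sigma,u}=\sum_{(v,u):\ v\in\{1,2,\dots\}^n,\ \mathrm{Std}(v)=\sigma}(v,u),$$ where the word $(v_1,u_1)\cdots(v_n,u_n)$ over $A$ is written $(v,u)$. Its product is $$\mathbf G_{\sigma',u'}\mathbf G_{\sigma'',u''}=\sum_{\sigma\in\sigma'*\sigma''}\mathbf G_{\sigma,u'\cdot u''},$$ where $u'\cdot u''$ is concatenation and $\sigma'*\sigma''$ is the set of permutations $\tau$ of size $|\sigma'|+|\sigma''|$ such that the first $|\sigma'|$ letters of $\tau$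 standardize to $\sigma'$ and the remaining letters standardize to $\sigma''$. The unit is $1=\mathbf G_{\emptyset,\emptyset}$. The coproduct is the linear map defined by $$\Delta\mathbf G_{\sigma,u}=\sum_{i=0}^n\mathbf G_{(\sigma,u)_{[1,i]}}\otimes\mathbf G_{(\sigma,u)_{[i+1,n]}},$$ where $n$ is the size of $\sigma$ and $(\sigma,u)_{[a,b]}=(\mathrm{Std}(\sigma'),u')$ with $\sigma'$ the subword of $\sigma$ consisting of the letters (values) belonging to the interval $[a,b]$ and $u'$ the subword of $u$ at the same positions. The counit is the projection onto the degree $0$ component. -}

module Defs where

open import Algebra.Bundles using (CommutativeRing)
open import Algebra.Module.Bundles.Raw using (RawLeftModule)
open import Algebra.Module.Structures using (IsLeftModule)
open import Algebra.Module.Morphism.Structures using (module LeftModuleMorphisms)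
open import Algebra.Structures using (IsRing)
import Algebra.Module.Construct.TensorUnit as TensorUnit
open import Data.Bool.Base using (if_then_else_)
open import Data.Empty using (⊥)
open import Data.Fin.Base using (Fin; toℕ)
import Data.Fin.Properties as Fin
open import Data.List.Base as List using (List; []; _∷_; _++_)
open import Data.List.Relation.Unary.All as ListAll using ()
open import Data.Maybe.Base as Maybe using ()
open import Data.Nat.Base as ℕ using (ℕ; zero; suc; _≤_; _<_; z≤n; s≤s)
import Data.Nat.Properties as ℕ
open import Data.Product.Base using (Σ; ∃; ∃₂; _×_; _,_; proj₁; proj₂)
import Data.Product.Properties as Product
open import Data.Sum.Base using (_⊎_; inj₁; inj₂)
open import Data.Vec.Base as Vec using (Vec; []; _∷_)
import Data.Vec.Properties as Vec
open import Data.Vec.Relation.Unary.All as VecAll using (All)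
import Data.Vec.Relation.Unary.All.Properties as VecAll
import Data.Vec.Relation.Unary.AllPairs as AllPairs
open import Data.Vec.Relation.Unary.Unique.Propositional using (Unique)
import Data.Vec.Relation.Unary.Unique.Propositional.Properties as Unique
open import Function.Base using (_∘_)
open import Function.Bundles using (_↔_)
open import Function.Properties.Inverse using (Inverse⇒Injection)
open import Level using (Level; _⊔_) renaming (suc to lsuc)
open import Relation.Binary.Definitions using (DecidableEquality; tri<; tri≈; tri>)
open import Relation.Binary.PropositionalEquality
  using (_≡_; _≢_; refl; sym; trans; cong; subst)
open import Relation.Nullary.Decidable
  using (Dec; yes; no; does; map′; ¬?; dec⇒maybe; via-injection; _×-dec_; _⊎-dec_)
open import Relation.Nullary.Negation using (¬_; contradiction)
open import Relation.Unary using (Pred; Decidable)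

-- As in the standard library, the operations are collected in raw
-- bundles and the laws in separate "Is..." records.

module HopfAlgebras {c ℓ : Level} (K : CommutativeRing c ℓ) where

  private
    module K = CommutativeRing K

  RawModule : (m ℓm : Level) → Set (c ⊔ lsuc (m ⊔ ℓm))
  RawModule m ℓm = RawLeftModule K.Carrier m ℓm

  module _ {m ℓm : Level} (M : RawModule m ℓm) where
    open RawLeftModule M

    sum : List Carrierᴹ → Carrierᴹ
    sum = List.foldr _+ᴹ_ 0ᴹ

  -- The tensor product over K: finite sums of simple tensors, modulo
  -- the congruence generated by the relations of bilinearity.

  module _ {m ℓm n ℓn : Level} (M : RawModule m ℓm) (N : RawModule n ℓn) where
    private
      module M = RawLeftModule M
      module N = RawLeftModule N

    Tensors : Set (m ⊔ n)
    Tensors = List (M.Carrierᴹ × N.Carrierᴹ)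

    infix 4 _≈⊗_

    data _≈⊗_ : Tensors → Tensors → Set (c ⊔ m ⊔ ℓm ⊔ n ⊔ ℓn) where
      ≈⊗-refl  : ∀ {s} → s ≈⊗ s
      ≈⊗-sym   : ∀ {s t} → s ≈⊗ t → t ≈⊗ s
      ≈⊗-trans : ∀ {s t u} → s ≈⊗ t → t ≈⊗ u → s ≈⊗ u
      ++-cong  : ∀ {s s′ t t′} → s ≈⊗ s′ → t ≈⊗ t′ → (s ++ t) ≈⊗ (s′ ++ t′)
      ++-comm  : ∀ s t → (s ++ t) ≈⊗ (t ++ s)
      ⊗-cong   : ∀ {x x′ y y′} → x M.≈ᴹ x′ → y N.≈ᴹ y′ →
                 ((x , y) ∷ []) ≈⊗ ((x′ , y′) ∷ [])
      ⊗-addˡ   : ∀ x x′ y →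
                 ((x M.+ᴹ x′ , y) ∷ []) ≈⊗ ((x , y) ∷ (x′ , y) ∷ [])
      ⊗-addʳ   : ∀ x y y′ →
                 ((x , y N.+ᴹ y′) ∷ []) ≈⊗ ((x , y) ∷ (x , y′) ∷ [])
      ⊗-zero   : ∀ y → ((M.0ᴹ , y) ∷ []) ≈⊗ []
      ⊗-scale  : ∀ k x y → ((k M.*ₗ x , y) ∷ []) ≈⊗ ((x , k N.*ₗ y) ∷ [])

    infixr 7 _⊗_

    _⊗_ : RawModule (m ⊔ n) (c ⊔ m ⊔ ℓm ⊔ n ⊔ ℓn)
    _⊗_ = record
      { Carrierᴹ = Tensors
      ; _≈ᴹ_     = _≈⊗_
      ; _+ᴹ_     = _++_
      ; _*ₗ_     = λ k → List.map λ (x , y) → k M.*ₗ x , y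
      ; 0ᴹ       = []
      ; -ᴹ_      = List.map λ (x , y) → M.-ᴹ x , y
      }

  -- The map M ⊗ N → P induced by a map M × N → P; it respects ≈⊗ when
  -- the latter is bilinear.

  lift : ∀ {m n p ℓp} {A : Set m} {B : Set n} (P : RawModule p ℓp) →
         (A → B → RawLeftModule.Carrierᴹ P) →
         List (A × B) → RawLeftModule.Carrierᴹ P
  lift P f t = sum P (List.map (λ (x , y) → f x y) t)

  record RawAlgebra (a ℓa : Level) : Set (c ⊔ lsuc (a ⊔ ℓa)) where
    infixl 7 _·_
    field
      rawModule : RawModule a ℓa
    open RawLeftModule rawModule public
    field
      _·_ : Carrierᴹ → Carrierᴹ → Carrierᴹ
      1ᴬ  : Carrierᴹ

  groundAlgebra : RawAlgebra c ℓ
  groundAlgebra = record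
    { rawModule = TensorUnit.rawLeftModule {R = K.rawRing}
    ; _·_       = K._*_
    ; 1ᴬ        = K.1#
    }

  _⊗ᴬ_ : ∀ {a ℓa b ℓb} → RawAlgebra a ℓa → RawAlgebra b ℓb →
         RawAlgebra (a ⊔ b) (c ⊔ a ⊔ ℓa ⊔ b ⊔ ℓb)
  A ⊗ᴬ B = record
    { rawModule = A.rawModule ⊗ B.rawModule
    ; _·_       = List.cartesianProductWith λ (x , y) (x′ , y′) → x A.· x′ , y B.· y′
    ; 1ᴬ        = (A.1ᴬ , B.1ᴬ) ∷ []
    }
    where
      module A = RawAlgebra A
      module B = RawAlgebra B

  IsLinear : ∀ {m ℓm n ℓn} (M : RawModule m ℓm) (N : RawModule n ℓn) →
             (RawLeftModule.Carrierᴹ M → RawLeftModule.Carrierᴹ N) →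
             Set (c ⊔ m ⊔ ℓm ⊔ ℓn)
  IsLinear = LeftModuleMorphisms.IsLeftModuleHomomorphism

  record IsAlgebra {a ℓa} (A : RawAlgebra a ℓa) : Set (c ⊔ ℓ ⊔ a ⊔ ℓa) where
    open RawAlgebra A
    field
      isLeftModule : IsLeftModule K.ring _≈ᴹ_ _+ᴹ_ 0ᴹ -ᴹ_ _*ₗ_
      isRing       : IsRing _≈ᴹ_ _+ᴹ_ _·_ -ᴹ_ 0ᴹ 1ᴬ
      ·-scaleˡ     : ∀ k x y → ((k *ₗ x) · y) ≈ᴹ (k *ₗ (x · y))
      ·-scaleʳ     : ∀ k x y → (x · (k *ₗ y)) ≈ᴹ (k *ₗ (x · y))

  record IsAlgebraHomomorphism
    {a ℓa b ℓb} (A : RawAlgebra a ℓa) (B : RawAlgebra b ℓb)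
    (f : RawAlgebra.Carrierᴹ A → RawAlgebra.Carrierᴹ B)
    : Set (c ⊔ a ⊔ ℓa ⊔ ℓb) where
    private
      module A = RawAlgebra A
      module B = RawAlgebra B
    field
      isLinear : IsLinear A.rawModule B.rawModule f
      ·-homo   : ∀ x y → f (x A.· y) B.≈ᴹ (f x B.· f y)
      1-homo   : f A.1ᴬ B.≈ᴹ B.1ᴬ

  module _ {m ℓm} (M : RawModule m ℓm) where
    open RawLeftModule M

    record IsCoalgebra (Δ : Carrierᴹ → Tensors M M) (ε : Carrierᴹ → K.Carrier)
      : Set (c ⊔ ℓ ⊔ m ⊔ ℓm) where
      field
        Δ-linear  : IsLinear M (M ⊗ M) Δ
        ε-linear  : IsLinear M (RawAlgebra.rawModule groundAlgebra) ε
        -- (Δ ⊗ id) ∘ Δ = (id ⊗ Δ) ∘ Δ, both sides read in M ⊗ (M ⊗ M)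
        coassoc   : ∀ x →
          _≈⊗_ M (M ⊗ M)
            (lift (M ⊗ (M ⊗ M))
              (λ y z → lift (M ⊗ (M ⊗ M)) (λ y₁ y₂ → (y₁ , (y₂ , z) ∷ []) ∷ []) (Δ y))
              (Δ x))
            (lift (M ⊗ (M ⊗ M)) (λ y z → (y , Δ z) ∷ []) (Δ x))
        counitˡ   : ∀ x → lift M (λ y z → ε y *ₗ z) (Δ x) ≈ᴹ x
        counitʳ   : ∀ x → lift M (λ y z → ε z *ₗ y) (Δ x) ≈ᴹ x

    record IsGrading {h} (H : ℕ → Pred Carrierᴹ h) : Set (c ⊔ m ⊔ ℓm ⊔ h) where
      field
        resp        : ∀ {n x y} → x ≈ᴹ y → H n x → H n y
        0-closed    : ∀ {n} → H n 0ᴹ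
        +-closed    : ∀ {n x y} → H n x → H n y → H n (x +ᴹ y)
        *ₗ-closed   : ∀ {n} k {x} → H n x → H n (k *ₗ x)
        spanning    : ∀ x → ∃₂ λ (N : ℕ) (f : ℕ → Carrierᴹ) →
                      (∀ n → H n (f n)) × x ≈ᴹ sum M (List.map f (List.upTo N))
        independent : ∀ N (f : ℕ → Carrierᴹ) → (∀ n → H n (f n)) →
                      sum M (List.map f (List.upTo N)) ≈ᴹ 0ᴹ →
                      ∀ n → n < N → f n ≈ᴹ 0ᴹ

    -- The degree n component of M ⊗ M: the span of the tensors x ⊗ y
    -- with x in H i, y in H j and i + j = n.

    TensorDegree : ∀ {h} → (ℕ → Pred Carrierᴹ h) → ℕ → Pred (Tensors M M) (c ⊔ m ⊔ ℓm ⊔ h)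
    TensorDegree H n t = ∃ λ s → _≈⊗_ M M t s ×
      ListAll.All (λ (x , y) → ∃₂ λ i j → (i ℕ.+ j ≡ n) × H i x × H j y) s

  module _ {a ℓa} (A : RawAlgebra a ℓa)
    (Δ : RawAlgebra.Carrierᴹ A → RawAlgebra.Carrierᴹ (A ⊗ᴬ A))
    (ε : RawAlgebra.Carrierᴹ A → K.Carrier)
    where
    open RawAlgebra A

    record IsBialgebra : Set (c ⊔ ℓ ⊔ a ⊔ ℓa) where
      field
        isAlgebra      : IsAlgebra A
        isCoalgebra    : IsCoalgebra rawModule Δ ε
        Δ-homomorphism : IsAlgebraHomomorphism A (A ⊗ᴬ A) Δ
        ε-homomorphism : IsAlgebraHomomorphism A groundAlgebra ε

    record IsGradedBialgebra {h} (H : ℕ → Pred Carrierᴹ h) : Set (c ⊔ ℓ ⊔ a ⊔ ℓa ⊔ h) where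
      field
        isBialgebra : IsBialgebra
        isGrading   : IsGrading rawModule H
        1-degree    : H 0 1ᴬ
        ·-degree    : ∀ {m n x y} → H m x → H n y → H (m ℕ.+ n) (x · y)
        Δ-degree    : ∀ {n x} → H n x → TensorDegree rawModule H n (Δ x)
        ε-degree    : ∀ {n x} → n ≢ 0 → H n x → ε x K.≈ K.0#

    record IsAntipode (S : Carrierᴹ → Carrierᴹ) : Set (c ⊔ a ⊔ ℓa) where
      field
        S-linear  : IsLinear rawModule rawModule S
        antipodeˡ : ∀ x → lift rawModule (λ y z → S y · z) (Δ x) ≈ᴹ (ε x *ₗ 1ᴬ)
        antipodeʳ : ∀ x → lift rawModule (λ y z → y · S z) (Δ x) ≈ᴹ (ε x *ₗ 1ᴬ)

    record IsHopfAlgebra : Set (c ⊔ ℓ ⊔ a ⊔ ℓa) where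
      field
        isBialgebra : IsBialgebra
        antipode    : Carrierᴹ → Carrierᴹ
        isAntipode  : IsAntipode antipode

-- A permutation σ is the word σ(1)⋯σ(n), with letters 1, …, n.

IsPermutation : ∀ {n} → Vec ℕ n → Set
IsPermutation {n} w = All (λ a → 1 ≤ a × a ≤ n) w × Unique w

isPermutation? : ∀ {n} (w : Vec ℕ n) → Dec (IsPermutation w)
isPermutation? {n} w =
  VecAll.all? (λ a → (1 ℕ.≤? a) ×-dec (a ℕ.≤? n)) w
  ×-dec AllPairs.allPairs? (λ a b → ¬? (a ℕ.≟ b)) w

-- The proof field is irrelevant, so permutations with the same word are
-- propositionally equal.

record 𝔖 (n : ℕ) : Set where
  constructor perm
  field
    word           : Vec ℕ n
    .isPermutation : IsPermutation word

open 𝔖 public using (word)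

infix 4 _≟ˢ_

_≟ˢ_ : ∀ {n} → DecidableEquality (𝔖 n)
σ ≟ˢ τ = map′ (λ { refl → refl }) (cong word) (Vec.≡-dec ℕ._≟_ (word σ) (word τ))

wordsOver : List ℕ → (n : ℕ) → List (Vec ℕ n)
wordsOver as zero    = [] ∷ []
wordsOver as (suc n) = List.cartesianProductWith _∷_ as (wordsOver as n)

allPermutations : (n : ℕ) → List (𝔖 n)
allPermutations n =
  List.mapMaybe (λ w → Maybe.map (λ p → perm w p) (dec⇒maybe (isPermutation? w)))
                (wordsOver (List.map suc (List.upTo n)) n)

module _ {n : ℕ} (v : Vec ℕ n) where

  -- In the numbering of the positions of v by increasing letter, and
  -- from left to right among equal letters, j is numbered no later
  -- than i.

  NoLater : Fin n → Fin n → Set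
  NoLater i j = Vec.lookup v j < Vec.lookup v i
              ⊎ (Vec.lookup v j ≡ Vec.lookup v i × toℕ j ≤ toℕ i)

  noLater? : ∀ i → Decidable (NoLater i)
  noLater? i j = (Vec.lookup v j ℕ.<? Vec.lookup v i)
           ⊎-dec ((Vec.lookup v j ℕ.≟ Vec.lookup v i) ×-dec (toℕ j ℕ.≤? toℕ i))

  -- The number given to position i, counting from 1.

  rank : Fin n → ℕ
  rank i = Vec.count (noLater? i) (Vec.allFin n)

stdWord : ∀ {n} → Vec ℕ n → Vec ℕ n
stdWord v = Vec.tabulate (rank v)

module _ {p q} {A : Set} {P : Pred A p} {Q : Pred A q}
         (P? : Decidable P) (Q? : Decidable Q) (P⊆Q : ∀ {x} → P x → Q x) where

  count-mono : ∀ {n} (xs : Vec A n) → Vec.count P? xs ≤ Vec.count Q? xs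
  count-mono []       = z≤n
  count-mono (x ∷ xs) with P? x | Q? x
  ... | yes _  | yes _  = s≤s (count-mono xs)
  ... | yes px | no ¬qx = contradiction (P⊆Q px) ¬qx
  ... | no _   | yes _  = ℕ.m≤n⇒m≤1+n (count-mono xs)
  ... | no _   | no _   = count-mono xs

  count-strict : ∀ {n} (xs : Vec A n) i →
                 ¬ P (Vec.lookup xs i) →
                 Q (Vec.lookup xs i) → Vec.count P? xs < Vec.count Q? xs
  count-strict (x ∷ xs) Fin.zero ¬p q with P? x | Q? x
  ... | yes px | _      = contradiction px ¬p
  ... | no _   | yes _  = s≤s (count-mono xs)
  ... | no _   | no ¬qx = contradiction q ¬qx
  count-strict (x ∷ xs) (Fin.suc i) ¬p q with P? x | Q? x
  ... | yes _  | yes _  = s≤s (count-strict xs i ¬p q)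
  ... | yes px | no ¬qx = contradiction (P⊆Q px) ¬qx
  ... | no _   | yes _  = ℕ.m≤n⇒m≤1+n (count-strict xs i ¬p q)
  ... | no _   | no _   = count-strict xs i ¬p q

module _ {n : ℕ} (v : Vec ℕ n) where

  noLater-trans : ∀ {i j k} → NoLater v j i → NoLater v k j → NoLater v k i
  noLater-trans (inj₁ i<j) (inj₁ j<k) = inj₁ (ℕ.<-trans i<j j<k)
  noLater-trans (inj₁ i<j) (inj₂ (j≡k , _)) = inj₁ (subst (_ <_) j≡k i<j)
  noLater-trans (inj₂ (i≡j , _)) (inj₁ j<k) = inj₁ (subst (_< _) (sym i≡j) j<k)
  noLater-trans (inj₂ (i≡j , p)) (inj₂ (j≡k , q)) = inj₂ (trans i≡j j≡k , ℕ.≤-trans p q)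

  noLater-refl : ∀ i → NoLater v i i
  noLater-refl i = inj₂ (refl , ℕ.≤-refl)

  noLater-total : ∀ i j → i ≢ j →
                  (NoLater v j i × ¬ NoLater v i j) ⊎ (NoLater v i j × ¬ NoLater v j i)
  noLater-total i j i≢j with ℕ.<-cmp (Vec.lookup v i) (Vec.lookup v j)
  ... | tri< lt ne _ = inj₁ (inj₁ lt , λ { (inj₁ gt) → ℕ.<-asym lt gt ; (inj₂ (eq , _)) → ne (sym eq) })
  ... | tri> _ ne gt = inj₂ (inj₁ gt , λ { (inj₁ lt) → ℕ.<-asym lt gt ; (inj₂ (eq , _)) → ne eq })
  ... | tri≈ ≮ eq ≯ with ℕ.≤-total (toℕ i) (toℕ j)
  ...   | inj₁ i≤j = inj₁ (inj₂ (eq , i≤j) , λ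
            { (inj₁ gt) → ≯ gt
            ; (inj₂ (_ , j≤i)) → i≢j (Fin.toℕ-injective (ℕ.≤-antisym i≤j j≤i)) })
  ...   | inj₂ j≤i = inj₂ (inj₂ (sym eq , j≤i) , λ
            { (inj₁ lt) → ≮ lt
            ; (inj₂ (_ , i≤j)) → i≢j (Fin.toℕ-injective (ℕ.≤-antisym i≤j j≤i)) })

  rank-strict : ∀ i j → NoLater v j i → ¬ NoLater v i j → rank v i < rank v j
  rank-strict i j i≼j ¬j≼i =
    count-strict (noLater? v i) (noLater? v j) (λ k≼i → noLater-trans k≼i i≼j)
      (Vec.allFin n) j
      (¬j≼i ∘ subst (NoLater v i) (Vec.lookup-allFin j))
      (subst (NoLater v j) (sym (Vec.lookup-allFin j)) (noLater-refl j))

  rank-positive : ∀ i → 1 ≤ rank v i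
  rank-positive i = ℕ.≤-trans (s≤s z≤n)
    (count-strict {P = λ _ → ⊥} (λ _ → no λ ()) (noLater? v i) (λ ())
      (Vec.allFin n) i (λ ())
      (subst (NoLater v i) (sym (Vec.lookup-allFin i)) (noLater-refl i)))

  rank-injective : ∀ {i j} → rank v i ≡ rank v j → i ≡ j
  rank-injective {i} {j} eq with i Fin.≟ j
  ... | yes i≡j = i≡j
  ... | no i≢j with noLater-total i j i≢j
  ...   | inj₁ (p , ¬q) = contradiction eq (ℕ.<⇒≢ (rank-strict i j p ¬q))
  ...   | inj₂ (p , ¬q) = contradiction (sym eq) (ℕ.<⇒≢ (rank-strict j i p ¬q))

stdWord-isPermutation : ∀ {n} (v : Vec ℕ n) → IsPermutation (stdWord v)
stdWord-isPermutation {n} v =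
  VecAll.tabulate⁺ (λ i → rank-positive v i , Vec.count≤n (noLater? v i) (Vec.allFin n)) ,
  Unique.tabulate⁺ (rank-injective v)

std : ∀ {n} → Vec ℕ n → 𝔖 n
std v = perm (stdWord v) (stdWord-isPermutation v)

-- Membership of τ in the set σ′ * σ″.

InConvolution : ∀ {m n} → 𝔖 m → 𝔖 n → 𝔖 (m ℕ.+ n) → Set
InConvolution {m} σ′ σ″ τ =
  std (Vec.take m (word τ)) ≡ σ′ × std (Vec.drop m (word τ)) ≡ σ″

inConvolution? : ∀ {m n} (σ′ : 𝔖 m) (σ″ : 𝔖 n) → Decidable (InConvolution σ′ σ″)
inConvolution? {m} σ′ σ″ τ =
  (std (Vec.take m (word τ)) ≟ˢ σ′) ×-dec (std (Vec.drop m (word τ)) ≟ˢ σ″)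

-- The coefficient ring K is an arbitrary commutative ring; the field ℂ
-- is not available in the standard library, and is an instance.

module ColoredFQSym
  {c ℓ : Level} (K : CommutativeRing c ℓ)
  {l : ℕ} {C : Set} (C↔Fin : C ↔ Fin l)
  where

  open HopfAlgebras K

  private
    module K = CommutativeRing K

  ColoredPermutation : Set
  ColoredPermutation = Σ ℕ λ n → 𝔖 n × Vec C n

  size : ColoredPermutation → ℕ
  size = proj₁

  _≟ᶜ_ : DecidableEquality C
  _≟ᶜ_ = via-injection (Inverse⇒Injection C↔Fin) Fin._≟_

  _≟_ : DecidableEquality ColoredPermutation
  _≟_ = Product.≡-dec ℕ._≟_ (Product.≡-dec _≟ˢ_ (Vec.≡-dec _≟ᶜ_))

  -- (σ , u) restricted to the letters of σ in the interval [a , b].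

  restrict : ℕ → ℕ → ColoredPermutation → ColoredPermutation
  restrict a b (n , σ , u) =
    List.length w ,
    std (Vec.map proj₁ (Vec.fromList w)) ,
    Vec.map proj₂ (Vec.fromList w)
    where
      w : List (ℕ × C)
      w = List.filter (λ (x , _) → (a ℕ.≤? x) ×-dec (x ℕ.≤? b))
                      (Vec.toList (Vec.zip (word σ) u))

  -- Elements of the free module on the colored permutations are formal
  -- linear combinations, equal when all their coefficients agree.

  Combination : Set c
  Combination = List (K.Carrier × ColoredPermutation)

  coeff : Combination → ColoredPermutation → K.Carrier
  coeff []            b = K.0#
  coeff ((k , a) ∷ x) b = if does (a ≟ b) then k K.+ coeff x b else coeff x b

  fqsymModule : RawModule c ℓ
  fqsymModule = record
    { Carrierᴹ = Combination
    ; _≈ᴹ_     = λ x y → ∀ b → coeff x b K.≈ coeff y b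
    ; _+ᴹ_     = _++_
    ; _*ₗ_     = λ k → List.map λ (k′ , a) → k K.* k′ , a
    ; 0ᴹ       = []
    ; -ᴹ_      = List.map λ (k , a) → K.- k , a
    }

  G : ColoredPermutation → Combination
  G a = (K.1# , a) ∷ []

  linear : ∀ {m ℓm} (M : RawModule m ℓm) →
           (ColoredPermutation → RawLeftModule.Carrierᴹ M) →
           Combination → RawLeftModule.Carrierᴹ M
  linear M f x = sum M (List.map (λ (k , a) → RawLeftModule._*ₗ_ M k (f a)) x)

  productG : ColoredPermutation → ColoredPermutation → Combination
  productG (m , σ′ , u′) (n , σ″ , u″) =
    sum fqsymModule
      (List.map (λ τ → G (m ℕ.+ n , τ , u′ Vec.++ u″))
        (List.filter (inConvolution? σ′ σ″) (allPermutations (m ℕ.+ n))))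

  FQSym : RawAlgebra c ℓ
  FQSym = record
    { rawModule = fqsymModule
    ; _·_       = λ x y → linear fqsymModule (λ a → linear fqsymModule (productG a) y) x
    ; 1ᴬ        = G (0 , std [] , [])
    }

  Δ : Combination → Tensors fqsymModule fqsymModule
  Δ = linear (fqsymModule ⊗ fqsymModule) λ a →
    sum (fqsymModule ⊗ fqsymModule)
      (List.map (λ i → (G (restrict 1 i a) , G (restrict (suc i) (size a) a)) ∷ [])
        (List.upTo (suc (size a))))

  -- The degree 0 component is K · 1, identified with K.

  ε : Combination → K.Carrier
  ε = linear (RawAlgebra.rawModule groundAlgebra) λ a →
    if does (size a ℕ.≟ 0) then K.1# else K.0#

  Degree : ℕ → Pred Combination ℓ
  Degree n x = ∀ a → size a ≢ n → coeff x a K.≈ K.0#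

{-# OPTIONS --safe #-}

-- Evaluate the coefficients of an element x on the standardizations of arbitrary
-- colored words w, writing x(w). Then the product is dual to deconcatenation,
-- (xy)(w) = Σ_{w = uv} x(u) y(v), and the coproduct is dual to shuffling:
-- (Δx)(u, v) = Σ_{w ∈ u ⧢ v} x(w) whenever every letter of u is smaller than
-- every letter of v. So Δ is multiplicative because deconcatenation and shuffles
-- of words are compatible, associativity of the product is coassociativity of
-- deconcatenation, and coassociativity of Δ is that of cutting [1, n] into
-- intervals. The antipode exists because the bialgebra is graded and connected:
-- a map sending the empty permutation to 1 has a left inverse for convolution,
-- defined by recursion on the size, which is also a right inverse.

module Submission where

open import Defs
open import Algebra.Bundles using (CommutativeMonoid; Ring; CommutativeRing)
open import Algebra.Module.Bundles using (LeftModule)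
open import Algebra.Module.Bundles.Raw using (RawLeftModule)
import Algebra.Module.Construct.TensorUnit as TensorUnit
open import Algebra.Module.Morphism.Structures using (module LeftModuleMorphisms)
open import Algebra.Module.Structures using (IsLeftModule)
open import Data.Bool.Base using (true; false; if_then_else_)
open import Data.Fin.Base as Fin using (Fin; toℕ; _↑ˡ_; _↑ʳ_)
import Data.Fin.Properties as Fin
open import Data.List.Base as List
  using (List; []; _∷_; _++_; map; length; filter; upTo; applyUpTo; concatMap; cartesianProductWith)
import Data.List.Properties as List
open import Data.List.Membership.Propositional using (_∈_)
import Data.List.Membership.Propositional.Properties as Mem
open import Data.List.Relation.Unary.All as All using (All; []; _∷_)
import Data.List.Relation.Unary.All.Properties as All
open import Data.List.Relation.Unary.AllPairs as AllPairs using (AllPairs; []; _∷_)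
import Data.List.Relation.Unary.AllPairs.Properties as AllPairs
open import Data.List.Relation.Unary.Any using (here; there)
open import Data.List.Relation.Unary.Unique.Propositional using (Unique)
import Data.List.Relation.Unary.Unique.Propositional.Properties as Unique
open import Data.List.Relation.Binary.Permutation.Propositional as Perm
  using (_↭_; ↭-refl; ↭-sym; ↭-trans; prep)
import Data.List.Relation.Binary.Permutation.Propositional.Properties as Perm
open import Data.Maybe.Base as Maybe using ()
open import Data.Nat.Base as ℕ using (ℕ; zero; suc; _≤_; _<_; z≤n; s≤s)
open import Data.Nat.Properties as ℕ using (_≤?_)
open import Data.Product.Base using (Σ; ∃; _×_; _,_; proj₁; proj₂; uncurry)
import Data.Product.Properties as Product
open import Data.Sum.Base using (_⊎_; inj₁; inj₂)
open import Data.Vec.Base as Vec using (Vec; []; _∷_; lookup; toList; fromList)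
import Data.Vec.Properties as Vec
import Data.Vec.Relation.Unary.All as VecAll
import Data.Vec.Relation.Unary.AllPairs as VecAllPairs
import Data.Vec.Relation.Unary.Unique.Propositional as Vec using (Unique)
open import Function.Base using (_∘_; id)
open import Function.Bundles using (_↔_)
open import Level using (Level; _⊔_)
open import Relation.Binary.Definitions using (DecidableEquality; tri<; tri≈; tri>)
open import Relation.Binary.PropositionalEquality as ≡
  using (_≡_; _≢_; refl; sym; trans; cong; cong₂; subst; subst₂)
import Relation.Binary.Reasoning.Setoid as SetoidReasoning
open import Relation.Nullary.Decidable using (Dec; yes; no; does; ¬?; _×-dec_; dec⇒maybe; recompute)
open import Relation.Nullary.Negation using (¬_; contradiction)
open import Relation.Unary using (Pred; Decidable)

-- Evaluating on arbitrary words, and not only on permutations, keeps restandardization out of the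
-- computation: cutting a permutation word leaves words that are no longer permutations, and the
-- formulas still apply to them. Shuffles meet standardization in one statement,
-- `map-pack-shuffles`: if all letters of `u` lie below those of `v`, the standardizations of their
-- shuffles depend only on those of `u` and `v`.
--
-- Elements are unnormalized lists of terms, and equality of tensors is a congruence generated by
-- rules. Two facts carry the passage between coefficients and elements: linear extension respects
-- equality of coefficients (`extend-cong`), and tensors with the same coefficients are equal
-- (`tensor-ext`). Coassociativity instead is obtained inside the threefold tensor product, from the
-- same reindexing of double cuts (`∑-restrict-assoc`) that makes convolution associative.
-- Convolution takes values in an arbitrary ring: in the base ring it yields the counit laws, in the
-- algebra itself the antipode, as the inverse of `G`.

private
  variable
    a b p q r μ ℓμ ν ℓν : Level
    A : Set a
    B : Set b
    m n : ℕ

-- Deconcatenations and shuffles of lists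

-- The pigeonhole principle: the first element of `xs` is deleted from `ys` at one occurrence, and
-- uniqueness keeps the rest of `xs` inside what remains.
unique-⊆-length : {xs ys : List A} → Unique xs → (∀ {x} → x ∈ xs → x ∈ ys) → length xs ≤ length ys
unique-⊆-length {xs = []}     _          _   = z≤n
unique-⊆-length {xs = x ∷ xs} (x∉ ∷ xs!) inc with Mem.∈-∃++ (inc (here refl))
... | us , vs , refl = ℕ.≤-trans (s≤s (unique-⊆-length xs! inc′)) (ℕ.≤-reflexive len)
  where
  shift : us ++ x ∷ vs ↭ x ∷ us ++ vs
  shift = Perm.shift x us vs
  len : length (x ∷ us ++ vs) ≡ length (us ++ x ∷ vs)
  len = sym (Perm.↭-length shift)
  inc′ : ∀ {y} → y ∈ xs → y ∈ us ++ vs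
  inc′ y∈ with Perm.∈-resp-↭ shift (inc (there y∈))
  ... | here refl = contradiction refl (All.lookup x∉ y∈)
  ... | there y∈′ = y∈′

splits : List A → List (List A × List A)
splits []       = ([] , []) ∷ []
splits (x ∷ xs) = ([] , x ∷ xs) ∷ map (λ (u , v) → x ∷ u , v) (splits xs)

splits-++ : ∀ (xs : List A) {u v} → (u , v) ∈ splits xs → u ++ v ≡ xs
splits-++ []       (here refl) = refl
splits-++ (x ∷ xs) (here refl) = refl
splits-++ (x ∷ xs) (there uv∈) with Mem.∈-map⁻ (λ (u , v) → x ∷ u , v) uv∈
... | _ , uv∈′ , refl = cong (x ∷_) (splits-++ xs uv∈′)

-- The terms of the shuffle product, kept with their multiplicities, so that sums over this list are
-- evaluations on the product.
shuffles : List A → List A → List (List A)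
shuffles []       ys       = ys ∷ []
shuffles (x ∷ xs) []       = (x ∷ xs) ∷ []
shuffles (x ∷ xs) (y ∷ ys) = map (x ∷_) (shuffles xs (y ∷ ys)) ++ map (y ∷_) (shuffles (x ∷ xs) ys)

shuffles-[]ʳ : (xs : List A) → shuffles xs [] ≡ xs ∷ []
shuffles-[]ʳ []       = refl
shuffles-[]ʳ (x ∷ xs) = refl

shuffles-map : ∀ (f : A → B) xs ys → shuffles (map f xs) (map f ys) ≡ map (map f) (shuffles xs ys)
shuffles-map f []       ys       = refl
shuffles-map f (x ∷ xs) []       = refl
shuffles-map f (x ∷ xs) (y ∷ ys) = begin
  map (f x ∷_) (shuffles (map f xs) (f y ∷ map f ys)) ++ map (f y ∷_) (shuffles (f x ∷ map f xs) (map f ys))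
    ≡⟨ cong₂ (λ s t → map (f x ∷_) s ++ map (f y ∷_) t) (shuffles-map f xs (y ∷ ys)) (shuffles-map f (x ∷ xs) ys) ⟩
  map (f x ∷_) (map (map f) s) ++ map (f y ∷_) (map (map f) t)
    ≡⟨ cong₂ _++_ (trans (sym (List.map-∘ s)) (List.map-∘ s)) (trans (sym (List.map-∘ t)) (List.map-∘ t)) ⟩
  map (map f) (map (x ∷_) s) ++ map (map f) (map (y ∷_) t)
    ≡⟨ List.map-++ (map f) (map (x ∷_) s) _ ⟨
  map (map f) (map (x ∷_) s ++ map (y ∷_) t) ∎
  where
  open ≡.≡-Reasoning
  s = shuffles xs (y ∷ ys)
  t = shuffles (x ∷ xs) ys

∈-shuffles-∷⁻ : ∀ {x y : A} {xs ys w} → w ∈ shuffles (x ∷ xs) (y ∷ ys) →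
                (∃ λ w′ → w′ ∈ shuffles xs (y ∷ ys) × w ≡ x ∷ w′) ⊎
                (∃ λ w′ → w′ ∈ shuffles (x ∷ xs) ys × w ≡ y ∷ w′)
∈-shuffles-∷⁻ {x = x} {y} {xs} {ys} w∈ with Mem.∈-++⁻ (map (x ∷_) (shuffles xs (y ∷ ys))) w∈
... | inj₁ w∈ˡ = inj₁ (Mem.∈-map⁻ (x ∷_) w∈ˡ)
... | inj₂ w∈ʳ = inj₂ (Mem.∈-map⁻ (y ∷_) w∈ʳ)

shuffles-↭ : ∀ (xs ys : List A) {w} → w ∈ shuffles xs ys → w ↭ xs ++ ys
shuffles-↭ []       ys       (here refl) = ↭-refl
shuffles-↭ (x ∷ xs) []       (here refl) = Perm.↭-reflexive (sym (List.++-identityʳ (x ∷ xs)))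
shuffles-↭ (x ∷ xs) (y ∷ ys) w∈ with ∈-shuffles-∷⁻ {xs = xs} {ys} w∈
... | inj₁ (w , w∈ˡ , refl) = prep x (shuffles-↭ xs (y ∷ ys) w∈ˡ)
... | inj₂ (w , w∈ʳ , refl) =
  ↭-trans (prep y (shuffles-↭ (x ∷ xs) ys w∈ʳ)) (↭-sym (Perm.shift y (x ∷ xs) ys))

module _ {R : A → A → Set r} where

  -- A shuffle keeps the order inside `xs` and inside `ys` but may put a letter of either list
  -- before one of the other, so the relation is required both ways across.
  shuffles-AllPairs : ∀ xs ys {w} → w ∈ shuffles xs ys → AllPairs R xs → AllPairs R ys →
                      (∀ {x y} → x ∈ xs → y ∈ ys → R x y × R y x) → AllPairs R w
  shuffles-AllPairs []       ys       (here refl) _   Rys _ = Rys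
  shuffles-AllPairs (x ∷ xs) []       (here refl) Rxs _   _ = Rxs
  shuffles-AllPairs (x ∷ xs) (y ∷ ys) w∈ (Rx ∷ Rxs) (Ry ∷ Rys) Rxy with ∈-shuffles-∷⁻ {xs = xs} {ys} w∈
  ... | inj₁ (w , w∈ˡ , refl) =
    Perm.All-resp-↭ (↭-sym (shuffles-↭ xs (y ∷ ys) w∈ˡ))
      (All.++⁺ Rx (All.tabulate λ y∈ → proj₁ (Rxy (here refl) y∈)))
    ∷ shuffles-AllPairs xs (y ∷ ys) w∈ˡ Rxs (Ry ∷ Rys) (Rxy ∘ there)
  ... | inj₂ (w , w∈ʳ , refl) =
    Perm.All-resp-↭ (↭-sym (shuffles-↭ (x ∷ xs) ys w∈ʳ))
      (All.++⁺ (All.tabulate λ x∈ → proj₂ (Rxy x∈ (here refl))) Ry)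
    ∷ shuffles-AllPairs (x ∷ xs) ys w∈ʳ (Rx ∷ Rxs) Rys (λ x∈ → Rxy x∈ ∘ there)

shuffles-∷ˡ : ∀ {x : A} {xs} ys {w} → w ∈ shuffles xs ys → x ∷ w ∈ shuffles (x ∷ xs) ys
shuffles-∷ˡ {xs = xs} [] w∈ rewrite shuffles-[]ʳ xs with w∈
... | here refl = here refl
shuffles-∷ˡ {x = x} (y ∷ ys) w∈ = Mem.∈-++⁺ˡ (Mem.∈-map⁺ (x ∷_) w∈)

shuffles-∷ʳ : ∀ xs {y : A} {ys} {w} → w ∈ shuffles xs ys → y ∷ w ∈ shuffles xs (y ∷ ys)
shuffles-∷ʳ [] (here refl) = here refl
shuffles-∷ʳ (x ∷ xs) {y = y} {ys = ys} w∈ = Mem.∈-++⁺ʳ (map (x ∷_) (shuffles xs (y ∷ ys))) (Mem.∈-map⁺ (y ∷_) w∈)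

module _ {P : Pred A p} (P? : Decidable P) where

  private
    ∁P? : Decidable (λ x → ¬ P x)
    ∁P? = ¬? ∘ P?

  -- When `P` holds on one word and fails on the other, a shuffle is undone by filtering; this lemma
  -- and `filter-shuffles` are the two directions.
  ∈-shuffles-filter : ∀ w → w ∈ shuffles (filter P? w) (filter ∁P? w)
  ∈-shuffles-filter [] = here refl
  ∈-shuffles-filter (x ∷ w) with P? x
  ... | yes _ = shuffles-∷ˡ (filter ∁P? w) (∈-shuffles-filter w)
  ... | no  _ = shuffles-∷ʳ (filter P? w) (∈-shuffles-filter w)

  filter-shuffles : ∀ xs ys {w} → w ∈ shuffles xs ys → All P xs → All (λ y → ¬ P y) ys →
                    filter P? w ≡ xs × filter ∁P? w ≡ ys
  filter-shuffles []       ys       (here refl) _   ¬Pys = List.filter-none P? ¬Pys , List.filter-all ∁P? ¬Pys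
  filter-shuffles (x ∷ xs) []       (here refl) Pxs _    =
    List.filter-all P? Pxs , List.filter-none ∁P? (All.map (λ Px ¬Px → ¬Px Px) Pxs)
  filter-shuffles (x ∷ xs) (y ∷ ys) w∈ (Px ∷ Pxs) (¬Py ∷ ¬Pys) with ∈-shuffles-∷⁻ {xs = xs} {ys} w∈
  ... | inj₁ (w , w∈ˡ , refl) with filter-shuffles xs (y ∷ ys) w∈ˡ Pxs (¬Py ∷ ¬Pys)
  ...   | eq₁ , eq₂ = trans (List.filter-accept P? Px) (cong (x ∷_) eq₁) ,
                      trans (List.filter-reject ∁P? (λ ¬Px → ¬Px Px)) eq₂
  filter-shuffles (x ∷ xs) (y ∷ ys) w∈ (Px ∷ Pxs) (¬Py ∷ ¬Pys) | inj₂ (w , w∈ʳ , refl)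
    with filter-shuffles (x ∷ xs) ys w∈ʳ (Px ∷ Pxs) ¬Pys
  ...   | eq₁ , eq₂ = trans (List.filter-reject P? ¬Py) eq₁ ,
                      trans (List.filter-accept ∁P? ¬Py) (cong (y ∷_) eq₂)

  -- Since `P` separates the two words, the first letter of a shuffle tells where it came from, so
  -- the two branches of the recursion are disjoint.
  shuffles-unique : ∀ xs ys → All P xs → All (λ y → ¬ P y) ys → Unique (shuffles xs ys)
  shuffles-unique []       ys       _ _ = [] ∷ []
  shuffles-unique (x ∷ xs) []       _ _ = [] ∷ []
  shuffles-unique (x ∷ xs) (y ∷ ys) (Px ∷ Pxs) (¬Py ∷ ¬Pys) =
    Unique.++⁺ (Unique.map⁺ List.∷-injectiveʳ (shuffles-unique xs (y ∷ ys) Pxs (¬Py ∷ ¬Pys)))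
               (Unique.map⁺ List.∷-injectiveʳ (shuffles-unique (x ∷ xs) ys (Px ∷ Pxs) ¬Pys))
               disjoint
    where
    disjoint : ∀ {w} → ¬ (w ∈ map (x ∷_) (shuffles xs (y ∷ ys)) × w ∈ map (y ∷_) (shuffles (x ∷ xs) ys))
    disjoint (w∈ˡ , w∈ʳ) with Mem.∈-map⁻ (x ∷_) w∈ˡ | Mem.∈-map⁻ (y ∷_) w∈ʳ
    ... | _ , _ , refl | _ , _ , eq = ¬Py (subst P (List.∷-injectiveˡ eq) Px)

-- Finite sums in a commutative monoid

module Summation {c ℓ} (M : CommutativeMonoid c ℓ) where
  open CommutativeMonoid M renaming (Carrier to X; refl to ≈-refl; sym to ≈-sym; trans to ≈-trans)
  open SetoidReasoning setoid
  import Algebra.Properties.CommutativeSemigroup commutativeSemigroup as CS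

  -- The same fold as in `sum` and `lift`, so that the sums of the definitions are instances of it
  -- by computation.
  ∑ : List A → (A → X) → X
  ∑ xs f = List.foldr _∙_ ε (map f xs)

  ∑-cong-∈ : ∀ (xs : List A) {f g : A → X} → (∀ {x} → x ∈ xs → f x ≈ g x) → ∑ xs f ≈ ∑ xs g
  ∑-cong-∈ []       eq = ≈-refl
  ∑-cong-∈ (x ∷ xs) eq = ∙-cong (eq (here refl)) (∑-cong-∈ xs (eq ∘ there))

  ∑-cong : ∀ (xs : List A) {f g : A → X} → (∀ x → f x ≈ g x) → ∑ xs f ≈ ∑ xs g
  ∑-cong xs eq = ∑-cong-∈ xs (λ {x} _ → eq x)

  ∑-congᵘ : ∀ n {f g : ℕ → X} → (∀ i → i < n → f i ≈ g i) → ∑ (upTo n) f ≈ ∑ (upTo n) g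
  ∑-congᵘ n eq = ∑-cong-∈ (upTo n) (λ i∈ → eq _ (Mem.∈-upTo⁻ i∈))

  ∑-ε : ∀ (xs : List A) {f : A → X} → (∀ {x} → x ∈ xs → f x ≈ ε) → ∑ xs f ≈ ε
  ∑-ε []       eq = ≈-refl
  ∑-ε (x ∷ xs) eq = ≈-trans (∙-cong (eq (here refl)) (∑-ε xs (eq ∘ there))) (identityˡ ε)

  ∑-++ : ∀ (xs ys : List A) (f : A → X) → ∑ (xs ++ ys) f ≈ ∑ xs f ∙ ∑ ys f
  ∑-++ []       ys f = ≈-sym (identityˡ _)
  ∑-++ (x ∷ xs) ys f = ≈-trans (∙-congˡ (∑-++ xs ys f)) (≈-sym (assoc _ _ _))

  ∑-map : ∀ (h : A → B) (xs : List A) (f : B → X) → ∑ (map h xs) f ≡ ∑ xs (f ∘ h)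
  ∑-map h xs f = cong (List.foldr _∙_ ε) (sym (List.map-∘ xs))

  ∑-concatMap : ∀ (g : A → List B) xs (f : B → X) → ∑ (List.concatMap g xs) f ≈ ∑ xs (λ x → ∑ (g x) f)
  ∑-concatMap g []       f = ≈-refl
  ∑-concatMap g (x ∷ xs) f = ≈-trans (∑-++ (g x) (List.concatMap g xs) f) (∙-congˡ (∑-concatMap g xs f))

  ∑-cartesianProductWith : ∀ {d} {D : Set d} (g : A → B → D) xs ys (f : D → X) →
    ∑ (List.cartesianProductWith g xs ys) f ≈ ∑ xs (λ x → ∑ ys (λ y → f (g x y)))
  ∑-cartesianProductWith g []       ys f = ≈-refl
  ∑-cartesianProductWith g (x ∷ xs) ys f = ≈-trans (∑-++ (map (g x) ys) (List.cartesianProductWith g xs ys) f)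
    (∙-cong (reflexive (∑-map (g x) ys f)) (∑-cartesianProductWith g xs ys f))

  ∑-∙ : ∀ (xs : List A) (f g : A → X) → ∑ xs (λ x → f x ∙ g x) ≈ ∑ xs f ∙ ∑ xs g
  ∑-∙ []       f g = ≈-sym (identityˡ ε)
  ∑-∙ (x ∷ xs) f g = ≈-trans (∙-congˡ (∑-∙ xs f g)) (CS.interchange _ _ _ _)

  ∑-swap : ∀ (xs : List A) (ys : List B) (f : A → B → X) →
           ∑ xs (λ x → ∑ ys (f x)) ≈ ∑ ys (λ y → ∑ xs (λ x → f x y))
  ∑-swap []       ys f = ≈-sym (∑-ε ys (λ _ → ≈-refl))
  ∑-swap (x ∷ xs) ys f = ≈-trans (∙-congˡ (∑-swap xs ys f)) (≈-sym (∑-∙ ys _ _))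

  ∑-unique : ∀ {xs : List A} {f : A → X} {y} → Unique xs → y ∈ xs →
             (∀ {x} → x ∈ xs → x ≢ y → f x ≈ ε) → ∑ xs f ≈ f y
  ∑-unique {xs = x ∷ xs} (x∉ ∷ _) (here refl) z =
    ≈-trans (∙-congˡ (∑-ε xs (λ y∈ → z (there y∈) (λ eq → All.lookup x∉ y∈ (sym eq))))) (identityʳ _)
  ∑-unique {xs = x ∷ xs} (x∉ ∷ xs!) (there y∈) z =
    ≈-trans (∙-cong (z (here refl) (All.lookup x∉ y∈)) (∑-unique xs! y∈ (z ∘ there))) (identityˡ _)

  ∑-upTo-suc : ∀ n (f : ℕ → X) → ∑ (upTo (suc n)) f ≡ f 0 ∙ ∑ (upTo n) (f ∘ suc)
  ∑-upTo-suc n f = cong (λ xs → f 0 ∙ List.foldr _∙_ ε xs)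
    (trans (List.map-applyUpTo suc f n) (sym (List.map-upTo (f ∘ suc) n)))

  ∑-upTo-last : ∀ n (f : ℕ → X) → ∑ (upTo (suc n)) f ≈ ∑ (upTo n) f ∙ f n
  ∑-upTo-last zero    f = comm _ _
  ∑-upTo-last (suc n) f = begin
    ∑ (upTo (suc (suc n))) f                   ≡⟨ ∑-upTo-suc (suc n) f ⟩
    f 0 ∙ ∑ (upTo (suc n)) (f ∘ suc)           ≈⟨ ∙-congˡ (∑-upTo-last n (f ∘ suc)) ⟩
    f 0 ∙ (∑ (upTo n) (f ∘ suc) ∙ f (suc n))   ≈⟨ assoc _ _ _ ⟨
    f 0 ∙ ∑ (upTo n) (f ∘ suc) ∙ f (suc n)     ≡⟨ cong (_∙ f (suc n)) (∑-upTo-suc n f) ⟨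
    ∑ (upTo (suc n)) f ∙ f (suc n)             ∎

  -- Both sides run over `j ≤ i ≤ n`, with `i = j + k` on the right. The induction on `n` peels off
  -- the terms with `j = 0`.
  ∑-triangle : ∀ n (f : ℕ → ℕ → X) →
    ∑ (upTo (suc n)) (λ i → ∑ (upTo (suc i)) (λ j → f j i)) ≈
    ∑ (upTo (suc n)) (λ j → ∑ (upTo (suc (n ℕ.∸ j))) (λ k → f j (j ℕ.+ k)))
  ∑-triangle zero    f = ≈-refl
  ∑-triangle (suc n) f = begin
    ∑ (upTo (suc (suc n))) (λ i → ∑ (upTo (suc i)) (λ j → f j i))
      ≈⟨ ∑-cong (upTo (suc (suc n))) (λ i → reflexive (∑-upTo-suc i (λ j → f j i))) ⟩
    ∑ (upTo (suc (suc n))) (λ i → f 0 i ∙ ∑ (upTo i) (λ j → f (suc j) i))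
      ≈⟨ ∑-∙ (upTo (suc (suc n))) _ _ ⟩
    ∑ (upTo (suc (suc n))) (f 0) ∙ ∑ (upTo (suc (suc n))) (λ i → ∑ (upTo i) (λ j → f (suc j) i))
      -- For `i = 0` the inner sum is empty and contributes the `ε`.
      ≡⟨ cong (∑ (upTo (suc (suc n))) (f 0) ∙_) (∑-upTo-suc (suc n) _) ⟩
    ∑ (upTo (suc (suc n))) (f 0) ∙ (ε ∙ ∑ (upTo (suc n)) (λ i → ∑ (upTo (suc i)) (λ j → f (suc j) (suc i))))
      ≈⟨ ∙-congˡ (identityˡ _) ⟩
    ∑ (upTo (suc (suc n))) (f 0) ∙ ∑ (upTo (suc n)) (λ i → ∑ (upTo (suc i)) (λ j → f (suc j) (suc i)))
      ≈⟨ ∙-congˡ (∑-triangle n (λ j i → f (suc j) (suc i))) ⟩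
    ∑ (upTo (suc (suc n))) (f 0) ∙ ∑ (upTo (suc n)) (λ j → ∑ (upTo (suc (n ℕ.∸ j))) (λ k → f (suc j) (suc (j ℕ.+ k))))
      ≡⟨ ∑-upTo-suc (suc n) _ ⟨
    ∑ (upTo (suc (suc n))) (λ j → ∑ (upTo (suc (suc n ℕ.∸ j))) (λ k → f j (j ℕ.+ k))) ∎

  -- Sums over deconcatenations and shuffles

  ∑-splits-∷ : ∀ (x : A) xs (f : List A → List A → X) →
               ∑ (splits (x ∷ xs)) (uncurry f) ≡ f [] (x ∷ xs) ∙ ∑ (splits xs) (λ (u , v) → f (x ∷ u) v)
  ∑-splits-∷ x xs f = cong (f [] (x ∷ xs) ∙_) (∑-map _ (splits xs) (uncurry f))

  -- In both sums a cut into three pieces either has an empty first piece or a first piece beginning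
  -- with `x`; the latter cuts are handled by induction.
  ∑-splits-assoc : ∀ (w : List A) (f : List A → List A → List A → X) →
    ∑ (splits w) (λ (u , v) → ∑ (splits u) (λ (u₁ , u₂) → f u₁ u₂ v)) ≈
    ∑ (splits w) (λ (u , v) → ∑ (splits v) (λ (v₁ , v₂) → f u v₁ v₂))
  ∑-splits-assoc []       f = ≈-refl
  ∑-splits-assoc (x ∷ w) f = begin
    ∑ (splits (x ∷ w)) (λ (u , v) → ∑ (splits u) (λ (u₁ , u₂) → f u₁ u₂ v))
      ≡⟨ ∑-splits-∷ x w (λ u v → ∑ (splits u) (λ (u₁ , u₂) → f u₁ u₂ v)) ⟩
    (f [] [] (x ∷ w) ∙ ε) ∙ ∑ (splits w) (λ (u , v) → ∑ (splits (x ∷ u)) (λ (u₁ , u₂) → f u₁ u₂ v))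
      ≈⟨ ∙-cong (identityʳ _) (∑-cong (splits w) λ (u , v) → reflexive (∑-splits-∷ x u (λ u₁ u₂ → f u₁ u₂ v))) ⟩
    f [] [] (x ∷ w) ∙ ∑ (splits w) (λ (u , v) → f [] (x ∷ u) v ∙ ∑ (splits u) (λ (u₁ , u₂) → f (x ∷ u₁) u₂ v))
      ≈⟨ ∙-congˡ (≈-trans (∑-∙ (splits w) _ _) (∙-congˡ (∑-splits-assoc w (λ u₁ → f (x ∷ u₁))))) ⟩
    f [] [] (x ∷ w) ∙ (∑ (splits w) (λ (u , v) → f [] (x ∷ u) v) ∙ ∑ (splits w) (λ (u , v) → ∑ (splits v) (λ (v₁ , v₂) → f (x ∷ u) v₁ v₂)))
      ≈⟨ assoc _ _ _ ⟨
    (f [] [] (x ∷ w) ∙ ∑ (splits w) (λ (u , v) → f [] (x ∷ u) v)) ∙ ∑ (splits w) (λ (u , v) → ∑ (splits v) (λ (v₁ , v₂) → f (x ∷ u) v₁ v₂))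
      ≡⟨ cong (_∙ ∑ (splits w) (λ (u , v) → ∑ (splits v) (λ (v₁ , v₂) → f (x ∷ u) v₁ v₂))) (∑-splits-∷ x w (f [])) ⟨
    ∑ (splits (x ∷ w)) (uncurry (f [])) ∙ ∑ (splits w) (λ (u , v) → ∑ (splits v) (λ (v₁ , v₂) → f (x ∷ u) v₁ v₂))
      ≡⟨ ∑-splits-∷ x w (λ u v → ∑ (splits v) (λ (v₁ , v₂) → f u v₁ v₂)) ⟨
    ∑ (splits (x ∷ w)) (λ (u , v) → ∑ (splits v) (λ (v₁ , v₂) → f u v₁ v₂)) ∎

  private
    ∑∑ : List A → List A → (List A → List A → List A → List A → X) → X
    ∑∑ p q h = ∑ (splits p) (λ (p₁ , p₂) → ∑ (splits q) (λ (q₁ , q₂) → h p₁ p₂ q₁ q₂))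

    sh : List A → List A → (List A → X) → X
    sh p q = ∑ (shuffles p q)

    sh-∷ : ∀ (x : A) xs y ys f →
      sh (x ∷ xs) (y ∷ ys) f ≈ sh xs (y ∷ ys) (f ∘ (x ∷_)) ∙ sh (x ∷ xs) ys (f ∘ (y ∷_))
    sh-∷ x xs y ys f = ≈-trans
      (∑-++ (map (x ∷_) (shuffles xs (y ∷ ys))) (map (y ∷_) (shuffles (x ∷ xs) ys)) f)
      (reflexive (cong₂ _∙_ (∑-map (x ∷_) (shuffles xs (y ∷ ys)) f) (∑-map (y ∷_) (shuffles (x ∷ xs) ys) f)))

    sh-[]ʳ : ∀ (xs : List A) f → sh xs [] f ≈ f xs
    sh-[]ʳ xs f rewrite shuffles-[]ʳ xs = identityʳ _

    ∑∑-∷ : ∀ (x : A) p y q h →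
      ∑∑ (x ∷ p) (y ∷ q) h ≈
      (h [] (x ∷ p) [] (y ∷ q) ∙ ∑ (splits q) (λ (q₁ , q₂) → h [] (x ∷ p) (y ∷ q₁) q₂)) ∙
      (∑ (splits p) (λ (p₁ , p₂) → h (x ∷ p₁) p₂ [] (y ∷ q)) ∙
       ∑ (splits p) (λ (p₁ , p₂) → ∑ (splits q) (λ (q₁ , q₂) → h (x ∷ p₁) p₂ (y ∷ q₁) q₂)))
    ∑∑-∷ x p y q h = begin
      ∑∑ (x ∷ p) (y ∷ q) h
        ≡⟨ ∑-splits-∷ x p (λ p₁ p₂ → ∑ (splits (y ∷ q)) (λ (q₁ , q₂) → h p₁ p₂ q₁ q₂)) ⟩
      ∑ (splits (y ∷ q)) (λ (q₁ , q₂) → h [] (x ∷ p) q₁ q₂) ∙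
      ∑ (splits p) (λ (p₁ , p₂) → ∑ (splits (y ∷ q)) (λ (q₁ , q₂) → h (x ∷ p₁) p₂ q₁ q₂))
        ≈⟨ ∙-cong (reflexive (∑-splits-∷ y q (h [] (x ∷ p))))
             (≈-trans
               (∑-cong (splits p) (λ (p₁ , p₂) → reflexive (∑-splits-∷ y q (h (x ∷ p₁) p₂))))
               (∑-∙ (splits p) _ _)) ⟩
      _ ∎

  -- A prefix of a shuffle of `p` and `q` is a shuffle of a prefix of each, and the rest is a
  -- shuffle of the remaining suffixes. The induction that keeps track of multiplicities
  -- distinguishes whether the first piece is empty and, if not, which word its first letter comes
  -- from.
  ∑-shuffles-splits : ∀ (p q : List A) (f : List A → List A → X) →
    ∑ (shuffles p q) (λ w → ∑ (splits w) (uncurry f)) ≈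
    ∑ (splits p) (λ (p₁ , p₂) → ∑ (splits q) (λ (q₁ , q₂) →
      ∑ (shuffles p₁ q₁) (λ w₁ → ∑ (shuffles p₂ q₂) (λ w₂ → f w₁ w₂))))
  ∑-shuffles-splits [] q f = ∙-congʳ (∑-cong (splits q) λ (q₁ , q₂) → begin
    f q₁ q₂                ≈⟨ identityʳ _ ⟨
    f q₁ q₂ ∙ ε            ≈⟨ identityʳ _ ⟨
    (f q₁ q₂ ∙ ε) ∙ ε      ∎)
  ∑-shuffles-splits (x ∷ p) [] f = ≈-trans (identityʳ _) (∑-cong (splits (x ∷ p)) λ (p₁ , p₂) → begin
    f p₁ p₂                                                ≈⟨ sh-[]ʳ p₂ (f p₁) ⟨
    sh p₂ [] (f p₁)                                        ≈⟨ sh-[]ʳ p₁ (λ w₁ → sh p₂ [] (f w₁)) ⟨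
    sh p₁ [] (λ w₁ → sh p₂ [] (f w₁))                      ≈⟨ identityʳ _ ⟨
    sh p₁ [] (λ w₁ → sh p₂ [] (f w₁)) ∙ ε                  ∎)
  ∑-shuffles-splits (x ∷ p) (y ∷ q) f = begin
    sh (x ∷ p) (y ∷ q) (λ w → ∑ (splits w) (uncurry f))
      ≈⟨ sh-∷ x p y q _ ⟩
    sh p (y ∷ q) (λ w → ∑ (splits (x ∷ w)) (uncurry f)) ∙ sh (x ∷ p) q (λ w → ∑ (splits (y ∷ w)) (uncurry f))
      ≈⟨ ∙-cong (peel x p (y ∷ q)) (peel y (x ∷ p) q) ⟩
    (sh p (y ∷ q) (f [] ∘ (x ∷_)) ∙ Σ₁) ∙ (sh (x ∷ p) q (f [] ∘ (y ∷_)) ∙ Σ₂)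
      ≈⟨ CS.interchange _ _ _ _ ⟩
    (sh p (y ∷ q) (f [] ∘ (x ∷_)) ∙ sh (x ∷ p) q (f [] ∘ (y ∷_))) ∙ (Σ₁ ∙ Σ₂)
      ≈⟨ ∙-cong (sh-∷ x p y q (f [])) (≈-refl) ⟨
    F₀ ∙ (Σ₁ ∙ Σ₂)
      ≈⟨ ∙-congˡ (∙-cong
          (eq₁ (∑-shuffles-splits p (y ∷ q) (f ∘ (x ∷_))))
          (eq₂ (∑-shuffles-splits (x ∷ p) q (f ∘ (y ∷_))))) ⟩
    F₀ ∙ ((B₁ ∙ D₁) ∙ (B₂ ∙ D₂))
      ≈⟨ ∙-congˡ (CS.interchange _ _ _ _) ⟩
    F₀ ∙ ((B₁ ∙ B₂) ∙ (D₁ ∙ D₂))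
      ≈⟨ ∙-congˡ (∙-cong (comm B₁ B₂) eq₃) ⟩
    F₀ ∙ ((B₂ ∙ B₁) ∙ D)
      ≈⟨ ∙-congˡ (assoc _ _ _) ⟩
    F₀ ∙ (B₂ ∙ (B₁ ∙ D))
      ≈⟨ assoc _ _ _ ⟨
    (F₀ ∙ B₂) ∙ (B₁ ∙ D)
      ≈⟨ ∙-cong (∙-congʳ (identityʳ _)) (≈-refl) ⟨
    (h [] (x ∷ p) [] (y ∷ q) ∙ B₂′) ∙ (B₁ ∙ D)
      ≈⟨ ∑∑-∷ x p y q h ⟨
    ∑∑ (x ∷ p) (y ∷ q) h ∎
    where
    h : List _ → List _ → List _ → List _ → X
    h p₁ p₂ q₁ q₂ = sh p₁ q₁ (λ w₁ → sh p₂ q₂ (f w₁))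
    -- `F₀` collects the cuts with empty first piece. In `B₁` the first piece is nonempty and draws
    -- on the first word only, in `B₂` on the second only. In `D₁` and `D₂` it draws on both and
    -- begins with `x`, respectively `y`.
    F₀ = sh (x ∷ p) (y ∷ q) (f [])
    Σ₁ = sh p (y ∷ q) (λ w → ∑ (splits w) (λ (u , v) → f (x ∷ u) v))
    Σ₂ = sh (x ∷ p) q (λ w → ∑ (splits w) (λ (u , v) → f (y ∷ u) v))
    B₁ = ∑ (splits p) (λ (p₁ , p₂) → h (x ∷ p₁) p₂ [] (y ∷ q))
    B₂′ = ∑ (splits q) (λ (q₁ , q₂) → h [] (x ∷ p) (y ∷ q₁) q₂)
    B₂ = B₂′
    D₁ = ∑ (splits p) (λ (p₁ , p₂) → ∑ (splits q) (λ (q₁ , q₂) →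
           sh p₁ (y ∷ q₁) (λ w₁ → sh p₂ q₂ (f (x ∷ w₁)))))
    D₂ = ∑ (splits p) (λ (p₁ , p₂) → ∑ (splits q) (λ (q₁ , q₂) →
           sh (x ∷ p₁) q₁ (λ w₁ → sh p₂ q₂ (f (y ∷ w₁)))))
    D  = ∑ (splits p) (λ (p₁ , p₂) → ∑ (splits q) (λ (q₁ , q₂) → h (x ∷ p₁) p₂ (y ∷ q₁) q₂))
    peel : ∀ z s t → sh s t (λ w → ∑ (splits (z ∷ w)) (uncurry f)) ≈
                     sh s t (f [] ∘ (z ∷_)) ∙ sh s t (λ w → ∑ (splits w) (λ (u , v) → f (z ∷ u) v))
    peel z s t = ≈-trans
      (∑-cong (shuffles s t) (λ w → reflexive (∑-splits-∷ z w f))) (∑-∙ (shuffles s t) _ _)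
    E₁ = ∑ (splits p) (λ (p₁ , p₂) → ∑ (splits (y ∷ q)) (λ (q₁ , q₂) → sh p₁ q₁ (λ w₁ → sh p₂ q₂ (f (x ∷ w₁)))))
    E₂ = ∑ (splits (x ∷ p)) (λ (p₁ , p₂) → ∑ (splits q) (λ (q₁ , q₂) → sh p₁ q₁ (λ w₁ → sh p₂ q₂ (f (y ∷ w₁)))))
    eq₁ : Σ₁ ≈ E₁ → Σ₁ ≈ B₁ ∙ D₁
    eq₁ ih = begin
      Σ₁
        ≈⟨ ih ⟩
      E₁
        ≈⟨ ∑-cong (splits p) (λ (p₁ , p₂) → ≈-trans
             (reflexive (∑-splits-∷ y q (λ q₁ q₂ → sh p₁ q₁ (λ w₁ → sh p₂ q₂ (f (x ∷ w₁))))))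
             (∙-congʳ (≈-trans (sh-[]ʳ p₁ _) (≈-sym (identityʳ _))))) ⟩
      ∑ (splits p) (λ (p₁ , p₂) → h (x ∷ p₁) p₂ [] (y ∷ q) ∙
        ∑ (splits q) (λ (q₁ , q₂) → sh p₁ (y ∷ q₁) (λ w₁ → sh p₂ q₂ (f (x ∷ w₁)))))
        ≈⟨ ∑-∙ (splits p) _ _ ⟩
      B₁ ∙ D₁ ∎
    eq₂ : Σ₂ ≈ E₂ → Σ₂ ≈ B₂ ∙ D₂
    eq₂ ih = begin
      Σ₂
        ≈⟨ ih ⟩
      E₂
        ≡⟨ ∑-splits-∷ x p (λ p₁ p₂ → ∑ (splits q) (λ (q₁ , q₂) → sh p₁ q₁ (λ w₁ → sh p₂ q₂ (f (y ∷ w₁))))) ⟩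
      ∑ (splits q) (λ (q₁ , q₂) → h [] (x ∷ p) (y ∷ q₁) q₂) ∙ D₂ ∎
    eq₃ : D₁ ∙ D₂ ≈ D
    eq₃ = ≈-sym (begin
      D
        ≈⟨ ∑-cong (splits p) (λ (p₁ , p₂) → ∑-cong (splits q) (λ (q₁ , q₂) → sh-∷ x p₁ y q₁ _)) ⟩
      ∑ (splits p) (λ (p₁ , p₂) → ∑ (splits q) (λ (q₁ , q₂) →
        sh p₁ (y ∷ q₁) (λ w₁ → sh p₂ q₂ (f (x ∷ w₁))) ∙ sh (x ∷ p₁) q₁ (λ w₁ → sh p₂ q₂ (f (y ∷ w₁)))))
        ≈⟨ ∑-cong (splits p) (λ (p₁ , p₂) → ∑-∙ (splits q) _ _) ⟩
      ∑ (splits p) (λ (p₁ , p₂) →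
        ∑ (splits q) (λ (q₁ , q₂) → sh p₁ (y ∷ q₁) (λ w₁ → sh p₂ q₂ (f (x ∷ w₁)))) ∙
        ∑ (splits q) (λ (q₁ , q₂) → sh (x ∷ p₁) q₁ (λ w₁ → sh p₂ q₂ (f (y ∷ w₁)))))
        ≈⟨ ∑-∙ (splits p) _ _ ⟩
      D₁ ∙ D₂ ∎)

-- Filters, and the passage between lists and vectors

filter-map : ∀ {P : Pred B p} (P? : Decidable P) (f : A → B) xs →
             filter P? (map f xs) ≡ map f (filter (P? ∘ f) xs)
filter-map P? f []       = refl
filter-map P? f (x ∷ xs) with does (P? (f x))
... | true  = cong (f x ∷_) (filter-map P? f xs)
... | false = filter-map P? f xs

module _ {P : Pred A p} {Q : Pred A q} (P? : Decidable P) (Q? : Decidable Q) where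

  filter-cong-∈ : ∀ xs → (∀ {x} → x ∈ xs → (P x → Q x) × (Q x → P x)) → filter P? xs ≡ filter Q? xs
  filter-cong-∈ []       _  = refl
  filter-cong-∈ (x ∷ xs) eq with P? x | Q? x
  ... | yes _  | yes _  = cong (x ∷_) (filter-cong-∈ xs (eq ∘ there))
  ... | yes px | no ¬qx = contradiction (proj₁ (eq (here refl)) px) ¬qx
  ... | no ¬px | yes qx = contradiction (proj₂ (eq (here refl)) qx) ¬px
  ... | no _   | no _   = filter-cong-∈ xs (eq ∘ there)

  filter-filter : (∀ {x} → P x → Q x) → ∀ xs → filter P? (filter Q? xs) ≡ filter P? xs
  filter-filter P⊆Q []       = refl
  filter-filter P⊆Q (x ∷ xs) with Q? x
  ... | yes _ with P? x
  ...   | yes _ = cong (x ∷_) (filter-filter P⊆Q xs)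
  ...   | no _  = filter-filter P⊆Q xs
  filter-filter P⊆Q (x ∷ xs) | no ¬qx =
    trans (filter-filter P⊆Q xs) (sym (List.filter-reject P? (¬qx ∘ P⊆Q)))

count≡length-filter : ∀ {P : Pred B p} (P? : Decidable P) (f : A → B) (xs : Vec A n) →
                      Vec.count (P? ∘ f) xs ≡ length (filter P? (toList (Vec.map f xs)))
count≡length-filter P? f []       = refl
count≡length-filter P? f (x ∷ xs) with does (P? (f x))
... | true  = cong suc (count≡length-filter P? f xs)
... | false = count≡length-filter P? f xs

module _ {R : A → A → Set r} where

  allPairs-lookup : ∀ (v : Vec A n) → AllPairs R (toList v) →
                    ∀ i j → toℕ i < toℕ j → R (lookup v i) (lookup v j)
  allPairs-lookup (x ∷ v) (Rx ∷ _)  Fin.zero    (Fin.suc j) _         = lookup-toList v Rx j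
    where
    lookup-toList : ∀ {P : A → Set r} {n} (v : Vec A n) → All P (toList v) → ∀ i → P (lookup v i)
    lookup-toList (y ∷ v) (Py ∷ _)  Fin.zero    = Py
    lookup-toList (y ∷ v) (_  ∷ Pv) (Fin.suc i) = lookup-toList v Pv i
  allPairs-lookup (x ∷ v) (_ ∷ Rv) (Fin.suc i) (Fin.suc j) (s≤s i<j) = allPairs-lookup v Rv i j i<j

  allPairs-toList : ∀ (v : Vec A n) → (∀ i j → toℕ i < toℕ j → R (lookup v i) (lookup v j)) →
                    AllPairs R (toList v)
  allPairs-toList []      _  = []
  allPairs-toList (x ∷ v) Rv =
    all-toList v (λ j → Rv Fin.zero (Fin.suc j) (s≤s z≤n)) ∷
    allPairs-toList v (λ i j i<j → Rv (Fin.suc i) (Fin.suc j) (s≤s i<j))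
    where
    all-toList : ∀ {P : A → Set r} {n} (v : Vec A n) → (∀ i → P (lookup v i)) → All P (toList v)
    all-toList []      _  = []
    all-toList (y ∷ v) Pv = Pv Fin.zero ∷ all-toList v (Pv ∘ Fin.suc)

-- Standardization

≡-𝔖 : {σ τ : 𝔖 n} → word σ ≡ word τ → σ ≡ τ
≡-𝔖 refl = refl

-- Equal letters are numbered from left to right and thus behave like an increasing pair, so the
-- strict descents between positions `i < j` determine the standardization.
SameInversions : Vec ℕ n → Vec ℕ n → Set
SameInversions v v′ = ∀ i j → toℕ i < toℕ j →
  (lookup v j < lookup v i → lookup v′ j < lookup v′ i) ×
  (lookup v′ j < lookup v′ i → lookup v j < lookup v i)

noLater-cong : (v v′ : Vec ℕ n) → SameInversions v v′ → ∀ {i j} → NoLater v i j → NoLater v′ i j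
noLater-cong v v′ same {i} {j} nl with ℕ.<-cmp (toℕ i) (toℕ j) | nl
... | tri< i<j _ _ | inj₁ lt = inj₁ (proj₁ (same i j i<j) lt)
... | tri< i<j _ _ | inj₂ (_ , j≤i) = contradiction j≤i (ℕ.<⇒≱ i<j)
... | tri≈ _ i≡j _ | _ =
  inj₂ (cong (lookup v′) (Fin.toℕ-injective (sym i≡j)) , ℕ.≤-reflexive (sym i≡j))
-- Position `j` precedes `i`, so `NoLater v i j` says exactly that this pair is not an inversion of
-- `v`; hence it is not one of `v′`.
... | tri> _ _ j<i | nl′ with ℕ.m≤n⇒m<n∨m≡n (ℕ.≮⇒≥ (≤⇒¬> nl′ ∘ proj₂ (same j i j<i)))
  where
  ≤⇒¬> : NoLater v i j → ¬ (lookup v i < lookup v j)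
  ≤⇒¬> (inj₁ lt)       gt = ℕ.<-asym lt gt
  ≤⇒¬> (inj₂ (eq , _)) gt = ℕ.<-irrefl (sym eq) gt
...   | inj₁ lt = inj₁ lt
...   | inj₂ eq = inj₂ (eq , ℕ.<⇒≤ j<i)

std-cong : (v v′ : Vec ℕ n) → SameInversions v v′ → std v ≡ std v′
std-cong {n} v v′ same = ≡-𝔖 (Vec.tabulate-cong λ i → ℕ.≤-antisym
  (count-mono (noLater? v i) (noLater? v′ i) (noLater-cong v v′ same) (Vec.allFin n))
  (count-mono (noLater? v′ i) (noLater? v i)
    (noLater-cong v′ v (λ i j i<j → proj₂ (same i j i<j) , proj₁ (same i j i<j))) (Vec.allFin n)))

-- Ranks increase strictly along the numbering, in which the right one of two equal letters comes
-- later.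
stdWord-sameInversions : (v : Vec ℕ n) → SameInversions (stdWord v) v
stdWord-sameInversions v i j i<j
  rewrite Vec.lookup∘tabulate (rank v) i | Vec.lookup∘tabulate (rank v) j = to , from
  where
  from : lookup v j < lookup v i → rank v j < rank v i
  from lt = rank-strict v j i (inj₁ lt)
    λ { (inj₁ gt) → ℕ.<-asym lt gt ; (inj₂ (eq , _)) → ℕ.<-irrefl (sym eq) lt }
  to : rank v j < rank v i → lookup v j < lookup v i
  to lt with ℕ.<-cmp (lookup v i) (lookup v j)
  ... | tri> _ _ gt = gt
  ... | tri< i≺j i≢j _ = contradiction lt (ℕ.<-asym (rank-strict v i j (inj₁ i≺j)
    λ { (inj₁ gt) → ℕ.<-asym i≺j gt ; (inj₂ (eq , _)) → i≢j (sym eq) }))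
  ... | tri≈ ¬lt eq ¬gt = contradiction lt (ℕ.<-asym (rank-strict v i j (inj₂ (eq , ℕ.<⇒≤ i<j))
    λ { (inj₁ gt) → ¬gt gt ; (inj₂ (_ , j≤i)) → ℕ.<⇒≱ i<j j≤i }))

lookup-take : ∀ m (xs : Vec A (m ℕ.+ n)) i → lookup (Vec.take m xs) i ≡ lookup xs (i ↑ˡ n)
lookup-take (suc m) (x ∷ xs) Fin.zero    = refl
lookup-take (suc m) (x ∷ xs) (Fin.suc i) = lookup-take m xs i

lookup-drop : ∀ m (xs : Vec A (m ℕ.+ n)) i → lookup (Vec.drop m xs) i ≡ lookup xs (m ↑ʳ i)
lookup-drop zero    xs       i = refl
lookup-drop (suc m) (x ∷ xs) i = lookup-drop m xs i

-- Passing to a factor only forgets inversions, so standardizing beforehand changes nothing. This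
-- and `std-drop` turn membership of `std v` in a convolution set into a condition on the factors of
-- `v`.
std-take : ∀ m (v : Vec ℕ (m ℕ.+ n)) → std (Vec.take m (stdWord v)) ≡ std (Vec.take m v)
std-take {n} m v = std-cong (Vec.take m (stdWord v)) (Vec.take m v) same
  where
  same : SameInversions (Vec.take m (stdWord v)) (Vec.take m v)
  same i j i<j
    rewrite lookup-take m v i | lookup-take m v j
          | lookup-take m (stdWord v) i | lookup-take m (stdWord v) j =
    stdWord-sameInversions v (i ↑ˡ n) (j ↑ˡ n)
      (subst₂ _<_ (sym (Fin.toℕ-↑ˡ i n)) (sym (Fin.toℕ-↑ˡ j n)) i<j)

std-drop : ∀ m (v : Vec ℕ (m ℕ.+ n)) → std (Vec.drop m (stdWord v)) ≡ std (Vec.drop m v)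
std-drop m v = std-cong (Vec.drop m (stdWord v)) (Vec.drop m v) same
  where
  same : SameInversions (Vec.drop m (stdWord v)) (Vec.drop m v)
  same i j i<j
    rewrite lookup-drop m v i | lookup-drop m v j
          | lookup-drop m (stdWord v) i | lookup-drop m (stdWord v) j =
    stdWord-sameInversions v (m ↑ʳ i) (m ↑ʳ j)
      (subst₂ _<_ (sym (Fin.toℕ-↑ʳ m i)) (sym (Fin.toℕ-↑ʳ m j)) (ℕ.+-monoʳ-< m i<j))

-- Permutation words

between : ∀ a b → Decidable (λ x → a ≤ x × x ≤ b)
between a b x = (a ≤? x) ×-dec (x ≤? b)

-- `IsPermutation` on lists, where filters and shuffles live and no length index has to be matched.
PermutationWord : List ℕ → Set
PermutationWord xs = All (λ x → 1 ≤ x × x ≤ length xs) xs × Unique xs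

-- Open on the left: the letters run from `i + 1` to `j`, as in the intervals produced by cuts.
interval : ℕ → ℕ → List ℕ
interval i j = applyUpTo (λ k → suc (i ℕ.+ k)) (j ℕ.∸ i)

length-interval : ∀ i j → length (interval i j) ≡ j ℕ.∸ i
length-interval i j = List.length-applyUpTo _ (j ℕ.∸ i)

∈-interval⁺ : ∀ {i j x} → suc i ≤ x × x ≤ j → x ∈ interval i j
∈-interval⁺ {i} {j} {x} (i<x , x≤j) =
  subst (_∈ interval i j) (ℕ.m+[n∸m]≡n i<x)
    (Mem.∈-applyUpTo⁺ (λ k → suc (i ℕ.+ k))
      (ℕ.∸-monoˡ-< {x} {suc i} {suc j} (s≤s x≤j) i<x))

∈-interval⁻ : ∀ {i j x} → x ∈ interval i j → suc i ≤ x × x ≤ j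
∈-interval⁻ {i} {j} x∈ with Mem.∈-applyUpTo⁻ (λ k → suc (i ℕ.+ k)) x∈
... | k , k<j∸i , refl = s≤s (ℕ.m≤m+n i k) , ℕ.≤-trans (ℕ.≤-reflexive (sym (ℕ.+-suc i k)))
      (ℕ.≤-trans (ℕ.+-monoʳ-≤ i k<j∸i) (ℕ.≤-reflexive (ℕ.m+[n∸m]≡n i≤j)))
  where
  i≤j : i ≤ j
  i≤j = ℕ.<⇒≤ (ℕ.m∸n≢0⇒n<m (λ eq → ℕ.n≮0 (subst (k <_) eq k<j∸i)))

interval-unique : ∀ i j → Unique (interval i j)
interval-unique i j = Unique.applyUpTo⁺₁ _ (j ℕ.∸ i)
  (λ k<k′ _ eq → ℕ.<⇒≢ k<k′ (ℕ.+-cancelˡ-≡ i _ _ (ℕ.suc-injective eq)))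

module _ {xs : List ℕ} (xs-perm : PermutationWord xs) where

  -- A missing letter `x` would give `n + 1` distinct values in the interval from 1 to `n`, where
  -- `n` is the length.
  permutationWord-∋ : ∀ {x} → 1 ≤ x → x ≤ length xs → x ∈ xs
  permutationWord-∋ {x} 1≤x x≤n with x ∈? xs
    where open import Data.List.Membership.DecPropositional ℕ._≟_ using (_∈?_)
  ... | yes x∈ = x∈
  ... | no x∉  = contradiction
    (ℕ.≤-trans (unique-⊆-length (All.tabulate (λ { y∈ refl → x∉ y∈ }) ∷ proj₂ xs-perm) inc)
               (ℕ.≤-reflexive (length-interval 0 (length xs))))
    ℕ.1+n≰n
    where
    inc : ∀ {y} → y ∈ x ∷ xs → y ∈ interval 0 (length xs)
    inc (here refl) = ∈-interval⁺ (1≤x , x≤n)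
    inc (there y∈)  = ∈-interval⁺ (All.lookup (proj₁ xs-perm) y∈)

  -- The filtered word and the interval are duplicate-free lists with the same elements. This yields
  -- both the sizes of restrictions and the ranks of the letters of a permutation.
  length-filter-between : ∀ {i j} → j ≤ length xs → length (filter (between (suc i) j) xs) ≡ j ℕ.∸ i
  length-filter-between {i} {j} j≤n = trans
    (ℕ.≤-antisym
      (unique-⊆-length (Unique.filter⁺ (between (suc i) j) (proj₂ xs-perm))
        (λ x∈ → ∈-interval⁺ (proj₂ (Mem.∈-filter⁻ (between (suc i) j) {xs = xs} x∈))))
      (unique-⊆-length (interval-unique i j) λ x∈ →
        let i<x , x≤j = ∈-interval⁻ x∈ in
        Mem.∈-filter⁺ (between (suc i) j)
          (permutationWord-∋ (ℕ.≤-trans (s≤s z≤n) i<x) (ℕ.≤-trans x≤j j≤n)) (i<x , x≤j)))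
    (length-interval i j)

  permutationWord-↭ : ∀ {ys} → ys ↭ xs → PermutationWord ys
  permutationWord-↭ {ys} ys↭xs =
    subst (λ n → All (λ x → 1 ≤ x × x ≤ n) ys) (sym (Perm.↭-length ys↭xs))
      (Perm.All-resp-↭ (↭-sym ys↭xs) (proj₁ xs-perm)) ,
    unique-↭ (↭-sym ys↭xs) (proj₂ xs-perm)
    where
    unique-↭ : ∀ {xs ys : List ℕ} → xs ↭ ys → Unique xs → Unique ys
    unique-↭ Perm.refl              xs!                    = xs!
    unique-↭ (prep x xs↭ys)         (x∉ ∷ xs!)             = Perm.All-resp-↭ xs↭ys x∉ ∷ unique-↭ xs↭ys xs!
    unique-↭ (Perm.swap x y xs↭ys)  ((x≢y ∷ x∉) ∷ y∉ ∷ xs!) =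
      ((x≢y ∘ sym) ∷ Perm.All-resp-↭ xs↭ys y∉) ∷ Perm.All-resp-↭ xs↭ys x∉ ∷ unique-↭ xs↭ys xs!
    unique-↭ (Perm.trans xs↭zs zs↭ys) xs!                  = unique-↭ zs↭ys (unique-↭ xs↭zs xs!)

-- The rank of the letter `x` counts the letters of value at most `x`, and a permutation has exactly
-- `x` of them.
stdWord-permutation : (v : Vec ℕ n) → PermutationWord (toList v) → stdWord v ≡ v
stdWord-permutation {n} v v-perm = trans (Vec.tabulate-cong rank≡) (Vec.tabulate∘lookup v)
  where
  positive : ∀ i → 1 ≤ lookup v i × lookup v i ≤ n
  positive i = subst (λ n → 1 ≤ lookup v i × lookup v i ≤ n) (Vec.length-toList v)
    (All.lookup (proj₁ v-perm) (∈-lookup v i))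
    where
    ∈-lookup : ∀ {n} (v : Vec ℕ n) i → lookup v i ∈ toList v
    ∈-lookup (x ∷ v) Fin.zero    = here refl
    ∈-lookup (x ∷ v) (Fin.suc i) = there (∈-lookup v i)
  injective : ∀ i j → lookup v i ≡ lookup v j → i ≡ j
  injective i j eq with ℕ.<-cmp (toℕ i) (toℕ j)
  ... | tri< i<j _ _ = contradiction eq (allPairs-lookup v (proj₂ v-perm) i j i<j)
  ... | tri≈ _ i≡j _ = Fin.toℕ-injective i≡j
  ... | tri> _ _ j<i = contradiction (sym eq) (allPairs-lookup v (proj₂ v-perm) j i j<i)
  rank≡ : ∀ i → rank v i ≡ lookup v i
  rank≡ i = begin
    Vec.count (noLater? v i) (Vec.allFin n)
      ≡⟨ ℕ.≤-antisym
           (count-mono (noLater? v i) (between 1 x ∘ lookup v) to (Vec.allFin n))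
           (count-mono (between 1 x ∘ lookup v) (noLater? v i) from (Vec.allFin n)) ⟩
    Vec.count (between 1 x ∘ lookup v) (Vec.allFin n)
      ≡⟨ count≡length-filter (between 1 x) (lookup v) (Vec.allFin n) ⟩
    length (filter (between 1 x) (toList (Vec.map (lookup v) (Vec.allFin n))))
      ≡⟨ cong (length ∘ filter (between 1 x) ∘ toList) (Vec.map-lookup-allFin v) ⟩
    length (filter (between 1 x) (toList v))
      ≡⟨ length-filter-between v-perm (subst (x ≤_) (sym (Vec.length-toList v)) (proj₂ (positive i))) ⟩
    x ∎
    where
    open ≡.≡-Reasoning
    x = lookup v i
    to : ∀ {j} → NoLater v i j → 1 ≤ lookup v j × lookup v j ≤ x
    to {j} (inj₁ lt)       = proj₁ (positive j) , ℕ.<⇒≤ lt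
    to {j} (inj₂ (eq , _)) = proj₁ (positive j) , ℕ.≤-reflexive eq
    from : ∀ {j} → 1 ≤ lookup v j × lookup v j ≤ x → NoLater v i j
    from {j} (_ , le) with ℕ.m≤n⇒m<n∨m≡n le
    ... | inj₁ lt = inj₁ lt
    ... | inj₂ eq = inj₂ (eq , ℕ.≤-reflexive (cong toℕ (injective j i eq)))

-- The proof stored in `perm` is irrelevant; the property being decidable, a relevant proof can be
-- recomputed.
𝔖-permutationWord : (σ : 𝔖 n) → PermutationWord (toList (word σ))
𝔖-permutationWord {n} (perm w w-perm) with recompute (isPermutation? w) w-perm
... | bounds , w! =
  subst (λ n → All (λ x → 1 ≤ x × x ≤ n) (toList w)) (sym (Vec.length-toList w)) (all w bounds) ,
  unique w w!
  where
  all : ∀ {P : ℕ → Set} {n} (w : Vec ℕ n) → VecAll.All P w → All P (toList w)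
  all []      VecAll.[]       = []
  all (x ∷ w) (Px VecAll.∷ Pw) = Px ∷ all w Pw
  unique : ∀ {n} (w : Vec ℕ n) → Vec.Unique w → Unique (toList w)
  unique []      VecAllPairs.[]        = []
  unique (x ∷ w) (x∉ VecAllPairs.∷ w!) = all w x∉ ∷ unique w w!

-- Colored words and their standardization

module Words (C : Set) where

  Letter : Set
  Letter = ℕ × C

  -- The same type as `ColoredPermutation`, without the ring parameter: the combinatorics of words
  -- is independent of coefficients.
  Colored : Set
  Colored = Σ ℕ λ n → 𝔖 n × Vec C n

  vpack : Vec Letter n → 𝔖 n × Vec C n
  vpack v = std (Vec.map proj₁ v) , Vec.map proj₂ v

  -- A word with positive letters occurs in the series of exactly one basis element, `G (pack w)`.
  -- So `coeff x (pack w)` is the coefficient of `w` in the series realizing `x`.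
  pack : List Letter → Colored
  pack w = length w , vpack (fromList w)

  letters : Colored → List Letter
  letters (n , σ , u) = toList (Vec.zip (word σ) u)

  -- An equality of pairs, because `length (toList v)` is equal to `n` only up to a proof.
  toList≅ : (v : Vec A n) → _≡_ {A = Σ ℕ (Vec A)} (length (toList v) , fromList (toList v)) (n , v)
  toList≅ []      = refl
  toList≅ (x ∷ v) = cong (λ (n , v) → suc n , x ∷ v) (toList≅ v)

  pack-toList : (v : Vec Letter n) → pack (toList v) ≡ (n , vpack v)
  pack-toList v = cong (λ (n , v) → n , vpack v) (toList≅ v)

  map-proj₁-letters : ∀ ((n , σ , u) : Colored) → map proj₁ (letters (n , σ , u)) ≡ toList (word σ)
  map-proj₁-letters (n , σ , u) =
    trans (sym (Vec.toList-map proj₁ (Vec.zip (word σ) u))) (cong toList (Vec.map-proj₁-zip (word σ) u))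

  letters-permutationWord : ∀ c → PermutationWord (map proj₁ (letters c))
  letters-permutationWord c@(n , σ , u) =
    subst PermutationWord (sym (map-proj₁-letters c)) (𝔖-permutationWord σ)

  length-letters : ∀ c → length (letters c) ≡ proj₁ c
  length-letters (n , σ , u) = Vec.length-toList (Vec.zip (word σ) u)

  letters-bounds : ∀ c {x} → x ∈ letters c → 1 ≤ proj₁ x × proj₁ x ≤ proj₁ c
  letters-bounds c x∈ =
    subst (λ n → 1 ≤ _ × _ ≤ n) (trans (List.length-map proj₁ (letters c)) (length-letters c))
      (All.lookup (proj₁ (letters-permutationWord c)) (Mem.∈-map⁺ proj₁ x∈))

  pack-letters : ∀ c → pack (letters c) ≡ c
  pack-letters c@(n , σ , u) = trans (pack-toList (Vec.zip (word σ) u)) (cong (n ,_) (cong₂ _,_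
    (≡-𝔖 (trans (cong stdWord (Vec.map-proj₁-zip (word σ) u))
                (stdWord-permutation (word σ) (𝔖-permutationWord σ))))
    (Vec.map-proj₂-zip (word σ) u)))

  letters-pack : ∀ w → PermutationWord (map proj₁ w) → letters (pack w) ≡ w
  letters-pack w w-perm = begin
    toList (Vec.zip (stdWord (Vec.map proj₁ v)) (Vec.map proj₂ v))
      ≡⟨ cong (λ x → toList (Vec.zip x (Vec.map proj₂ v)))
           (stdWord-permutation (Vec.map proj₁ v) (subst PermutationWord (sym eq) w-perm)) ⟩
    toList (Vec.zip (Vec.map proj₁ v) (Vec.map proj₂ v))
      ≡⟨ cong toList (Vec.map-<,>-zip proj₁ proj₂ v) ⟨
    toList (Vec.map id v)
      ≡⟨ cong toList (Vec.map-id v) ⟩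
    toList v
      ≡⟨ Vec.toList∘fromList w ⟩
    w ∎
    where
    open ≡.≡-Reasoning
    v = fromList w
    eq : toList (Vec.map proj₁ v) ≡ map proj₁ w
    eq = trans (Vec.toList-map proj₁ v) (cong (map proj₁) (Vec.toList∘fromList w))

  -- A word of pairs of letters of the same color encodes two words, which have
  -- the same standardization if they have the same inversions.
  Letter² : Set
  Letter² = ℕ × ℕ × C

  fst snd : Letter² → Letter
  fst (x , x′ , c) = x , c
  snd (x , x′ , c) = x′ , c

  Compatible : Letter² → Letter² → Set
  Compatible (x , x′ , _) (y , y′ , _) = (y < x → y′ < x′) × (y′ < x′ → y < x)

  pack-compatible : ∀ z → AllPairs Compatible z → pack (map fst z) ≡ pack (map snd z)
  pack-compatible z z-comp = begin
    pack (map fst z)            ≡⟨ pack-map fst ⟩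
    length z , vpack (Vec.map fst v) ≡⟨ cong (length z ,_) (cong₂ _,_ (std-cong (Vec.map proj₁ (Vec.map fst v)) (Vec.map proj₁ (Vec.map snd v)) same) colors) ⟩
    length z , vpack (Vec.map snd v) ≡⟨ pack-map snd ⟨
    pack (map snd z)            ∎
    where
    open ≡.≡-Reasoning
    v = fromList z
    pack-map : ∀ f → pack (map f z) ≡ (length z , vpack (Vec.map f v))
    pack-map f = trans (cong pack (trans (cong (map f) (sym (Vec.toList∘fromList z)))
                                         (sym (Vec.toList-map f v))))
                       (pack-toList (Vec.map f v))
    colors : Vec.map proj₂ (Vec.map fst v) ≡ Vec.map proj₂ (Vec.map snd v)
    colors = trans (sym (Vec.map-∘ proj₂ fst v)) (Vec.map-∘ proj₂ snd v)
    same : SameInversions (Vec.map proj₁ (Vec.map fst v)) (Vec.map proj₁ (Vec.map snd v))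
    same i j i<j
      rewrite Vec.lookup-map i proj₁ (Vec.map fst v) | Vec.lookup-map j proj₁ (Vec.map fst v)
            | Vec.lookup-map i proj₁ (Vec.map snd v) | Vec.lookup-map j proj₁ (Vec.map snd v)
            | Vec.lookup-map i fst v | Vec.lookup-map j fst v
            | Vec.lookup-map i snd v | Vec.lookup-map j snd v =
      allPairs-lookup v (subst (AllPairs Compatible) (sym (Vec.toList∘fromList z)) z-comp) i j i<j

  -- Pairing each letter with its rank encodes a word together with its standardization, so that one
  -- shuffle of such pairs acts on both at once.
  compatible-pack : ∀ w → ∃ λ z → map fst z ≡ w × map snd z ≡ letters (pack w) × AllPairs Compatible z
  compatible-pack w = toList z ,
    trans (sym (Vec.toList-map fst z)) (trans (cong toList (map-fst v ranks)) (Vec.toList∘fromList w)) ,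
    trans (sym (Vec.toList-map snd z)) (cong toList (map-snd v ranks)) ,
    allPairs-toList z compatible
    where
    join : Letter → ℕ → Letter²
    join (x , c) x′ = x , x′ , c
    v = fromList w
    ranks = stdWord (Vec.map proj₁ v)
    z = Vec.zipWith join v ranks
    map-fst : ∀ {n} (v : Vec Letter n) t → Vec.map fst (Vec.zipWith join v t) ≡ v
    map-fst []      []      = refl
    map-fst (x ∷ v) (_ ∷ t) = cong (x ∷_) (map-fst v t)
    map-snd : ∀ {n} (v : Vec Letter n) t →
              Vec.map snd (Vec.zipWith join v t) ≡ Vec.zip t (Vec.map proj₂ v)
    map-snd []      []      = refl
    map-snd (_ ∷ v) (_ ∷ t) = cong (_ ∷_) (map-snd v t)
    compatible : ∀ i j → toℕ i < toℕ j → Compatible (lookup z i) (lookup z j)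
    compatible i j i<j
      rewrite Vec.lookup-zipWith join i v ranks | Vec.lookup-zipWith join j v ranks =
      let to , from = stdWord-sameInversions (Vec.map proj₁ v) i j i<j in
      (λ lt → from (subst₂ _<_ (sym (Vec.lookup-map j proj₁ v)) (sym (Vec.lookup-map i proj₁ v)) lt)) ,
      (λ lt → subst₂ _<_ (Vec.lookup-map j proj₁ v) (Vec.lookup-map i proj₁ v) (to lt))

  -- Restriction to intervals

  shift : ℕ → List Letter → List Letter
  shift k = map (λ (x , c) → k ℕ.+ x , c)

  pack-shift : ∀ k w → pack (shift k w) ≡ pack w
  pack-shift k w = begin
    pack (shift k w)     ≡⟨ cong pack (List.map-∘ w) ⟩
    pack (map snd z)     ≡⟨ pack-compatible z z-comp ⟨
    pack (map fst z)     ≡⟨ cong pack (trans (sym (List.map-∘ w)) (List.map-id w)) ⟩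
    pack w               ∎
    where
    open ≡.≡-Reasoning
    z = map (λ (x , c) → x , k ℕ.+ x , c) w
    z-comp : AllPairs Compatible z
    z-comp = AllPairs.map⁺ (universal w)
      where
      universal : ∀ w → AllPairs (λ (x , _) (y , _) → (y < x → k ℕ.+ y < k ℕ.+ x) × (k ℕ.+ y < k ℕ.+ x → y < x)) w
      universal []      = []
      universal (x ∷ w) = All.universal (λ _ → ℕ.+-monoʳ-< k , ℕ.+-cancelˡ-< k _ _) w ∷ universal w

  restrictWord : ℕ → ℕ → List Letter → List Letter
  restrictWord a b = filter (between a b ∘ proj₁)

  map-restrictWord : ∀ a b w → map proj₁ (restrictWord a b w) ≡ filter (between a b) (map proj₁ w)
  map-restrictWord a b w = sym (filter-map (between a b) proj₁ w)

  length-restrictWord : ∀ {i j w} → PermutationWord (map proj₁ w) → j ≤ length w →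
                        length (restrictWord (suc i) j w) ≡ j ℕ.∸ i
  length-restrictWord {i} {j} {w} w-perm j≤n = begin
    length (restrictWord (suc i) j w)                 ≡⟨ List.length-map proj₁ (restrictWord (suc i) j w) ⟨
    length (map proj₁ (restrictWord (suc i) j w))     ≡⟨ cong length (map-restrictWord (suc i) j w) ⟩
    length (filter (between (suc i) j) (map proj₁ w)) ≡⟨ length-filter-between w-perm (subst (j ≤_) (sym (List.length-map proj₁ w)) j≤n) ⟩
    j ℕ.∸ i                                             ∎
    where open ≡.≡-Reasoning

  restrictWord-shift : ∀ i p q w → restrictWord (suc (i ℕ.+ p)) (i ℕ.+ q) (shift i w) ≡ shift i (restrictWord (suc p) q w)
  restrictWord-shift i p q w = trans
    (filter-map (between (suc (i ℕ.+ p)) (i ℕ.+ q) ∘ proj₁) (λ (x , c) → i ℕ.+ x , c) w)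
    (cong (shift i) (filter-cong-∈ _ _ w λ {(x , _)} _ →
      (λ (lo , hi) → ℕ.+-cancelˡ-≤ i _ _ (subst (_≤ i ℕ.+ x) (sym (ℕ.+-suc i p)) lo) , ℕ.+-cancelˡ-≤ i _ _ hi) ,
      (λ (lo , hi) → subst (_≤ i ℕ.+ x) (ℕ.+-suc i p) (ℕ.+-monoʳ-≤ i lo) , ℕ.+-monoʳ-≤ i hi)))

  -- The letters kept are those from `i + 1` to `j`, each once, so subtracting `i` already gives a
  -- permutation word, which standardization fixes.
  restrictWord-unshift : ∀ {i j w} → PermutationWord (map proj₁ w) → j ≤ length w →
    restrictWord (suc i) j w ≡ shift i (letters (pack (restrictWord (suc i) j w)))
  restrictWord-unshift {i} {j} {w} w-perm j≤n = begin
    W                              ≡⟨ W≡ ⟩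
    shift i V                      ≡⟨ cong (shift i) (letters-pack V V-perm) ⟨
    shift i (letters (pack V))     ≡⟨ cong (shift i ∘ letters) (trans (sym (pack-shift i V)) (cong pack (sym W≡))) ⟩
    shift i (letters (pack W))     ∎
    where
    open ≡.≡-Reasoning
    W = restrictWord (suc i) j w
    V = map (λ (x , c) → x ℕ.∸ i , c) W
    W-bounds : All (λ (x , _) → suc i ≤ x × x ≤ j) W
    W-bounds = All.all-filter (between (suc i) j ∘ proj₁) w
    W≡ : W ≡ shift i V
    W≡ = trans (sym (List.map-id W)) (trans (List.map-cong-local
      (All.map (λ {(x , c)} (lo , _) → cong (_, c) (sym (ℕ.m+[n∸m]≡n (ℕ.<⇒≤ lo)))) W-bounds)) (List.map-∘ W))
    length-V : length (map proj₁ V) ≡ j ℕ.∸ i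
    length-V = trans (List.length-map proj₁ V) (trans (List.length-map _ W) (length-restrictWord w-perm j≤n))
    W-unique : Unique (map proj₁ W)
    W-unique = subst Unique (sym (map-restrictWord (suc i) j w)) (Unique.filter⁺ (between (suc i) j) (proj₂ w-perm))
    V-perm : PermutationWord (map proj₁ V)
    V-perm = subst (λ n → All (λ x → 1 ≤ x × x ≤ n) (map proj₁ V)) (sym length-V)
        (All.map⁺ (All.map⁺ (All.map (λ (lo , hi) → ℕ.m<n⇒0<n∸m lo , ℕ.∸-monoˡ-≤ i hi) W-bounds))) ,
      AllPairs.map (λ ne eq → ne (cong (i ℕ.+_) eq)) (AllPairs.map⁻ {f = i ℕ.+_}
        (subst Unique (trans (cong (map proj₁) W≡) (trans (sym (List.map-∘ V)) (List.map-∘ V))) W-unique))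

  restrictᶜ : ℕ → ℕ → Colored → Colored
  restrictᶜ a b c = pack (restrictWord a b (letters c))

  size-restrict : ∀ {i j} c → j ≤ proj₁ c → proj₁ (restrictᶜ (suc i) j c) ≡ j ℕ.∸ i
  size-restrict c j≤n = length-restrictWord (letters-permutationWord c) (subst (_ ≤_) (sym (length-letters c)) j≤n)

  shift-letters-restrict : ∀ {i j} c → j ≤ proj₁ c →
    shift i (letters (restrictᶜ (suc i) j c)) ≡ restrictWord (suc i) j (letters c)
  shift-letters-restrict c j≤n =
    sym (restrictWord-unshift (letters-permutationWord c) (subst (_ ≤_) (sym (length-letters c)) j≤n))

  -- Standardizing `[i + 1, j]` subtracts `i`, so the interval `[p + 1, q]` of the result comes from
  -- `[i + p + 1, i + q]`, which lies in `[i + 1, j]`; standardization does not see the shift.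
  restrict-restrict : ∀ i p {q j} c → i ℕ.+ q ≤ j → j ≤ proj₁ c →
    restrictᶜ (suc p) q (restrictᶜ (suc i) j c) ≡ restrictᶜ (suc (i ℕ.+ p)) (i ℕ.+ q) c
  restrict-restrict i p {q} {j} c i+q≤j j≤n = begin
    pack (restrictWord (suc p) q V)
      ≡⟨ pack-shift i _ ⟨
    pack (shift i (restrictWord (suc p) q V))
      ≡⟨ cong pack (restrictWord-shift i p q V) ⟨
    pack (restrictWord (suc (i ℕ.+ p)) (i ℕ.+ q) (shift i V))
      ≡⟨ cong (pack ∘ restrictWord (suc (i ℕ.+ p)) (i ℕ.+ q)) (shift-letters-restrict c j≤n) ⟩
    pack (restrictWord (suc (i ℕ.+ p)) (i ℕ.+ q) (restrictWord (suc i) j (letters c)))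
      ≡⟨ cong pack (filter-filter (between (suc (i ℕ.+ p)) (i ℕ.+ q) ∘ proj₁) (between (suc i) j ∘ proj₁)
           (λ (lo , hi) → ℕ.≤-trans (s≤s (ℕ.m≤m+n i p)) lo , ℕ.≤-trans hi i+q≤j) (letters c)) ⟩
    pack (restrictWord (suc (i ℕ.+ p)) (i ℕ.+ q) (letters c)) ∎
    where
    open ≡.≡-Reasoning
    V = letters (restrictᶜ (suc i) j c)

  restrict-all : ∀ c → restrictᶜ 1 (proj₁ c) c ≡ c
  restrict-all c = trans
    (cong pack (List.filter-all (between 1 (proj₁ c) ∘ proj₁) (All.tabulate (letters-bounds c))))
    (pack-letters c)

  -- The source of connectedness: in degree 0 there is only the unit, up to scalars.
  size0 : ∀ {c} → proj₁ c ≡ 0 → c ≡ pack []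
  size0 {c} eq with letters c | pack-letters c | length-letters c
  ... | []    | refl | _    = refl
  ... | _ ∷ _ | _    | eq′  = contradiction (trans eq′ eq) λ ()

  shift-zero : ∀ w → shift 0 w ≡ w
  shift-zero = List.map-id

  -- The pairs of intervals of c of sizes |p| and |q| equal to (p , q) are the
  -- occurrences of c among the shuffles of p with q shifted by |p|.
  ∈-shuffles⇒restrict : ∀ c p q → letters c ∈ shuffles (letters p) (shift (proj₁ p) (letters q)) →
    proj₁ p ≤ proj₁ c × restrictᶜ 1 (proj₁ p) c ≡ p × restrictᶜ (suc (proj₁ p)) (proj₁ c) c ≡ q
  ∈-shuffles⇒restrict c p q c∈ = p≤c , eq₁ , eq₂
    where
    k = proj₁ p
    -- Letters of `p` are at most `k` and the raised letters of `q` exceed `k`, so this threshold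
    -- undoes the shuffle.
    small? : Decidable (λ (x : Letter) → proj₁ x ≤ k)
    small? x = proj₁ x ≤? k
    all-small : All (λ x → proj₁ x ≤ k) (letters p)
    all-small = All.tabulate (proj₂ ∘ letters-bounds p)
    all-large : All (λ x → ¬ (proj₁ x ≤ k)) (shift k (letters q))
    all-large = All.map⁺ (All.tabulate λ x∈ → ℕ.<⇒≱ (ℕ.m<m+n k (proj₁ (letters-bounds q x∈))))
    filters : filter small? (letters c) ≡ letters p × filter (¬? ∘ small?) (letters c) ≡ shift k (letters q)
    filters = filter-shuffles small? (letters p) (shift k (letters q)) c∈ all-small all-large
    p≤c : k ≤ proj₁ c
    p≤c = begin
      k                                          ≡⟨ length-letters p ⟨
      length (letters p)                         ≡⟨ cong length (proj₁ filters) ⟨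
      length (filter small? (letters c))         ≤⟨ List.length-filter small? (letters c) ⟩
      length (letters c)                         ≡⟨ length-letters c ⟩
      proj₁ c                                    ∎
      where open ℕ.≤-Reasoning
    eq₁ : restrictᶜ 1 k c ≡ p
    eq₁ = trans (cong pack (trans
      (filter-cong-∈ _ small? (letters c) λ x∈ → proj₂ , λ x≤k → proj₁ (letters-bounds c x∈) , x≤k)
      (proj₁ filters))) (pack-letters p)
    eq₂ : restrictᶜ (suc k) (proj₁ c) c ≡ q
    eq₂ = trans (cong pack (trans
      (filter-cong-∈ _ (¬? ∘ small?) (letters c) λ x∈ →
        (λ (k<x , _) → ℕ.<⇒≱ k<x) , λ x≰k → ℕ.≰⇒> x≰k , proj₂ (letters-bounds c x∈))
      (proj₂ filters))) (trans (pack-shift k (letters q)) (pack-letters q))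

  restrict⇒∈-shuffles : ∀ {i} c → i ≤ proj₁ c →
    letters c ∈ shuffles (letters (restrictᶜ 1 i c)) (shift i (letters (restrictᶜ (suc i) (proj₁ c) c)))
  restrict⇒∈-shuffles {i} c i≤n = subst₂ (λ u v → letters c ∈ shuffles u v) eq₁ eq₂
    (∈-shuffles-filter small? (letters c))
    where
    small? : Decidable (λ (x : Letter) → proj₁ x ≤ i)
    small? x = proj₁ x ≤? i
    eq₁ : filter small? (letters c) ≡ letters (restrictᶜ 1 i c)
    eq₁ = trans
      (filter-cong-∈ small? (between 1 i ∘ proj₁) (letters c) λ x∈ → (λ x≤i → proj₁ (letters-bounds c x∈) , x≤i) , proj₂)
      (trans (sym (shift-letters-restrict c i≤n)) (shift-zero _))
    eq₂ : filter (¬? ∘ small?) (letters c) ≡ shift i (letters (restrictᶜ (suc i) (proj₁ c) c))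
    eq₂ = trans
      (filter-cong-∈ (¬? ∘ small?) (between (suc i) (proj₁ c) ∘ proj₁) (letters c) λ x∈ →
        (λ x≰i → ℕ.≰⇒> x≰i , proj₂ (letters-bounds c x∈)) , λ (i<x , _) → ℕ.<⇒≱ i<x)
      (sym (shift-letters-restrict c ℕ.≤-refl))

  shuffles-letters-unique : ∀ p q → Unique (shuffles (letters p) (shift (proj₁ p) (letters q)))
  shuffles-letters-unique p q = shuffles-unique (λ x → proj₁ x ≤? proj₁ p) _ _
    (All.tabulate (proj₂ ∘ letters-bounds p))
    (All.map⁺ (All.tabulate λ x∈ → ℕ.<⇒≱ (ℕ.m<m+n (proj₁ p) (proj₁ (letters-bounds q x∈)))))

  -- The word of `p` followed by the raised word of `q` is a permutation word, and a shuffle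
  -- rearranges it; standardization fixes such words.
  shuffles-letters-pack : ∀ p q {w} → w ∈ shuffles (letters p) (shift (proj₁ p) (letters q)) →
                          letters (pack w) ≡ w
  shuffles-letters-pack p q {w} w∈ = letters-pack w
    (permutationWord-↭ concat-perm (subst (map proj₁ w ↭_) (List.map-++ proj₁ (letters p) _) (Perm.map⁺ proj₁ (shuffles-↭ (letters p) (shift k (letters q)) w∈))))
    where
    k = proj₁ p
    P = map proj₁ (letters p)
    Q = map proj₁ (shift k (letters q))
    Q≡ : Q ≡ map (k ℕ.+_) (map proj₁ (letters q))
    Q≡ = trans (sym (List.map-∘ (letters q))) (List.map-∘ (letters q))
    len : length (P ++ Q) ≡ k ℕ.+ proj₁ q
    len = trans (List.length-++ P) (cong₂ ℕ._+_
      (trans (List.length-map proj₁ (letters p)) (length-letters p))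
      (trans (List.length-map proj₁ (shift k (letters q))) (trans (List.length-map _ (letters q)) (length-letters q))))
    small : All (λ x → 1 ≤ x × x ≤ k) P
    small = All.map⁺ (All.tabulate (letters-bounds p))
    large : All (λ x → k < x × x ≤ k ℕ.+ proj₁ q) Q
    large = All.map⁺ (All.map⁺ (All.tabulate λ x∈ → let lo , hi = letters-bounds q x∈ in
      ℕ.m<m+n k lo , ℕ.+-monoʳ-≤ k hi))
    concat-perm : PermutationWord (P ++ Q)
    concat-perm = subst (λ n → All (λ x → 1 ≤ x × x ≤ n) (P ++ Q)) (sym len)
        (All.++⁺ (All.map (λ (lo , hi) → lo , ℕ.≤-trans hi (ℕ.m≤m+n k _)) small)
                 (All.map (λ (lo , hi) → ℕ.≤-trans (s≤s z≤n) lo , hi) large)) ,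
      Unique.++⁺ (proj₂ (letters-permutationWord p))
        (subst Unique (sym Q≡) (Unique.map⁺ (ℕ.+-cancelˡ-≡ k _ _) (proj₂ (letters-permutationWord q))))
        λ (x∈P , x∈Q) → ℕ.<⇒≱ (proj₁ (All.lookup large x∈Q)) (proj₂ (All.lookup small x∈P))

  -- An inversion of a shuffle lies inside `u`, inside `v`, or between a letter of `v` and a later
  -- letter of `u`; the last kind is decided by positions alone, before and after standardization.
  -- Encoding by pairs of letters lets both versions be shuffled simultaneously.
  map-pack-shuffles : ∀ u v → (∀ {x y} → x ∈ u → y ∈ v → proj₁ x < proj₁ y) →
    map pack (shuffles u v) ≡ map pack (shuffles (letters (pack u)) (shift (length u) (letters (pack v))))
  map-pack-shuffles u v u<v with compatible-pack u | compatible-pack v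
  ... | z , refl , z-snd , z-comp | t , refl , t-snd , t-comp = begin
    map pack (shuffles (map fst z) (map fst t))
      ≡⟨ cong (λ s → map pack (shuffles (map fst z) s)) (List.map-∘ t) ⟩
    map pack (shuffles (map fst z) (map fst t′))
      ≡⟨ cong (map pack) (shuffles-map fst z t′) ⟩
    map pack (map (map fst) (shuffles z t′))
      ≡⟨ List.map-∘ (shuffles z t′) ⟨
    map (pack ∘ map fst) (shuffles z t′)
      ≡⟨ List.map-cong-local (All.tabulate λ {w} w∈ → pack-compatible w
           (shuffles-AllPairs z t′ w∈ z-comp t′-comp cross)) ⟩
    map (pack ∘ map snd) (shuffles z t′)
      ≡⟨ List.map-∘ (shuffles z t′) ⟩
    map pack (map (map snd) (shuffles z t′))
      ≡⟨ cong (map pack) (shuffles-map snd z t′) ⟨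
    map pack (shuffles (map snd z) (map snd t′))
      ≡⟨ cong₂ (λ r s → map pack (shuffles r s)) z-snd t′-snd ⟩
    map pack (shuffles (letters (pack (map fst z))) (shift k (letters (pack (map fst t))))) ∎
    where
    open ≡.≡-Reasoning
    k = length (map fst z)
    raise : Letter² → Letter²
    raise (x , x′ , c) = x , k ℕ.+ x′ , c
    t′ = map raise t
    t′-snd : map snd t′ ≡ shift k (letters (pack (map fst t)))
    t′-snd = trans (sym (List.map-∘ t)) (trans (List.map-∘ t) (cong (shift k) t-snd))
    t′-comp : AllPairs Compatible t′
    t′-comp = AllPairs.map⁺ (AllPairs.map
      (λ (to , from) → (λ lt → ℕ.+-monoʳ-< k (to lt)) , (λ lt → from (ℕ.+-cancelˡ-< k _ _ lt))) t-comp)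
    -- Across the two words the letter from `z` is the smaller one in both coordinates, so the pair
    -- is compatible whichever comes first.
    cross : ∀ {x y} → x ∈ z → y ∈ t′ → Compatible x y × Compatible y x
    cross {x} x∈ y∈ with Mem.∈-map⁻ raise y∈
    ... | y , y∈′ , refl =
      ((λ gt → contradiction gt (ℕ.<-asym lt)) , (λ gt → contradiction gt (ℕ.<-asym lt′))) ,
      ((λ _ → lt′) , (λ _ → lt))
      where
      lt : proj₁ x < proj₁ y
      lt = u<v (Mem.∈-map⁺ fst x∈) (Mem.∈-map⁺ fst y∈′)
      lt′ : proj₁ (snd x) < k ℕ.+ proj₁ (snd y)
      lt′ = ℕ.≤-<-trans
        (proj₂ (letters-bounds (pack (map fst z)) (subst (snd x ∈_) z-snd (Mem.∈-map⁺ snd x∈))))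
        (ℕ.m<m+n k (proj₁ (letters-bounds (pack (map fst t)) (subst (snd y ∈_) t-snd (Mem.∈-map⁺ snd y∈′)))))

-- Sums in rings and modules

module RingSums {c ℓ : Level} (R : Ring c ℓ) where
  open Ring R using (_*_; _≈_; +-congˡ; zeroˡ; zeroʳ; distribˡ; distribʳ)
    renaming (trans to ≈-trans)
  open Summation (Ring.+-commutativeMonoid R)

  *-distribˡ-∑ : ∀ {a} {A : Set a} k (xs : List A) f → k * ∑ xs f ≈ ∑ xs (λ x → k * f x)
  *-distribˡ-∑ k []       f = zeroʳ k
  *-distribˡ-∑ k (x ∷ xs) f = ≈-trans (distribˡ k _ _) (+-congˡ (*-distribˡ-∑ k xs f))

  *-distribʳ-∑ : ∀ {a} {A : Set a} k (xs : List A) f → ∑ xs f * k ≈ ∑ xs (λ x → f x * k)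
  *-distribʳ-∑ k []       f = zeroˡ k
  *-distribʳ-∑ k (x ∷ xs) f = ≈-trans (distribʳ k _ _) (+-congˡ (*-distribʳ-∑ k xs f))

module LinearAlgebra {c ℓ : Level} (K : CommutativeRing c ℓ) where
  open HopfAlgebras K

  module K = CommutativeRing K
  open K using (_*_; _+_; -_; 0#; 1#; _≈_)
  module ∑ᴷ = Summation K.+-commutativeMonoid
  open ∑ᴷ using (∑)
  open RingSums K.ring public using (*-distribˡ-∑; *-distribʳ-∑)
  open import Algebra.Properties.Ring K.ring using (-‿distribˡ-*)

  ∑-*-∑ : ∀ (xs : List A) (ys : List B) (f : A → K.Carrier) (g : B → K.Carrier) →
          ∑ xs f * ∑ ys g ≈ ∑ xs (λ x → ∑ ys (λ y → f x * g y))
  ∑-*-∑ xs ys f g = K.trans (*-distribʳ-∑ (∑ ys g) xs f) (∑ᴷ.∑-cong xs (λ x → *-distribˡ-∑ (f x) ys g))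

  -- The Iverson bracket, with values in `K`.
  ⟦_⟧ : {P : Set p} → Dec P → K.Carrier
  ⟦ d ⟧ = if does d then 1# else 0#

  ⟦⟧-cong : {P : Set p} {Q : Set q} (P? : Dec P) (Q? : Dec Q) → (P → Q) → (Q → P) → ⟦ P? ⟧ ≈ ⟦ Q? ⟧
  ⟦⟧-cong (yes _)  (yes _)  _  _    = K.refl
  ⟦⟧-cong (yes px) (no ¬qx) to _    = contradiction (to px) ¬qx
  ⟦⟧-cong (no ¬px) (yes qx) _  from = contradiction (from qx) ¬px
  ⟦⟧-cong (no _)   (no _)   _  _    = K.refl

  ⟦⟧-true : {P : Set p} (P? : Dec P) → P → ⟦ P? ⟧ ≈ 1#
  ⟦⟧-true (yes _)  _  = K.refl
  ⟦⟧-true (no ¬px) px = contradiction px ¬px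

  ⟦⟧-false : {P : Set p} (P? : Dec P) → ¬ P → ⟦ P? ⟧ ≈ 0#
  ⟦⟧-false (yes px) ¬px = contradiction px ¬px
  ⟦⟧-false (no _)   _   = K.refl

  ⟦⟧-× : {P : Set p} {Q : Set q} (P? : Dec P) (Q? : Dec Q) → ⟦ P? ×-dec Q? ⟧ ≈ ⟦ P? ⟧ * ⟦ Q? ⟧
  ⟦⟧-× (yes _) (yes _) = K.sym (K.*-identityˡ 1#)
  ⟦⟧-× (yes _) (no _)  = K.sym (K.*-identityˡ 0#)
  ⟦⟧-× (no _)  (yes _) = K.sym (K.zeroˡ _)
  ⟦⟧-× (no _)  (no _)  = K.sym (K.zeroˡ _)

  IsModule : RawModule μ ℓμ → Set (c ⊔ ℓ ⊔ μ ⊔ ℓμ)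
  IsModule M = IsLeftModule K.ring _≈ᴹ_ _+ᴹ_ 0ᴹ -ᴹ_ _*ₗ_
    where open RawLeftModule M

  ground : RawModule c ℓ
  ground = RawAlgebra.rawModule groundAlgebra

  ground-isModule : IsModule ground
  ground-isModule = LeftModule.isLeftModule (TensorUnit.leftModule {R = K.ring})

  module Module {m ℓm : Level} {M : RawModule m ℓm} (isM : IsModule M) where
    leftModule : LeftModule K.ring m ℓm
    leftModule = record { isLeftModule = isM }

    open LeftModule leftModule public
    open Summation +ᴹ-commutativeMonoid public using () renaming
      ( ∑ to ∑ᴹ; ∑-cong to ∑ᴹ-cong; ∑-++ to ∑ᴹ-++; ∑-map to ∑ᴹ-map)
    open import Algebra.Properties.AbelianGroup +ᴹ-abelianGroup public using (inverseˡ-unique)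
    open SetoidReasoning ≈ᴹ-setoid

    *ₗ-distrib-∑ᴹ : ∀ k (xs : List A) f → k *ₗ ∑ᴹ xs f ≈ᴹ ∑ᴹ xs (λ x → k *ₗ f x)
    *ₗ-distrib-∑ᴹ k []       f = *ₗ-zeroʳ k
    *ₗ-distrib-∑ᴹ k (x ∷ xs) f = ≈ᴹ-trans (*ₗ-distribˡ k _ _) (+ᴹ-congˡ (*ₗ-distrib-∑ᴹ k xs f))

    -1*ₗ : ∀ x → (- 1#) *ₗ x ≈ᴹ -ᴹ x
    -1*ₗ x = inverseˡ-unique _ _ (begin
      (- 1#) *ₗ x +ᴹ x         ≈⟨ +ᴹ-congˡ (*ₗ-identityˡ x) ⟨
      (- 1#) *ₗ x +ᴹ 1# *ₗ x   ≈⟨ *ₗ-distribʳ x (- 1#) 1# ⟨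
      (- 1# + 1#) *ₗ x         ≈⟨ *ₗ-congʳ (K.-‿inverseˡ 1#) ⟩
      0# *ₗ x                  ≈⟨ *ₗ-zeroˡ x ⟩
      0ᴹ                       ∎)

    -- Agrees with `linear` by computation, but over any basis `B`: it is applied to colored
    -- permutations and to pairs of them.
    extend : (B → Carrierᴹ) → List (K.Carrier × B) → Carrierᴹ
    extend f x = ∑ᴹ x (λ (k , b) → k *ₗ f b)

    extend-scale : ∀ (f : B → Carrierᴹ) k x → extend f (map (λ (k′ , b) → k * k′ , b) x) ≈ᴹ k *ₗ extend f x
    extend-scale f k x = begin
      extend f (map (λ (k′ , b) → k * k′ , b) x)   ≡⟨ ∑ᴹ-map _ x _ ⟩
      ∑ᴹ x (λ (k′ , b) → (k * k′) *ₗ f b)          ≈⟨ ∑ᴹ-cong x (λ (k′ , b) → *ₗ-assoc k k′ (f b)) ⟩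
      ∑ᴹ x (λ (k′ , b) → k *ₗ k′ *ₗ f b)           ≈⟨ *ₗ-distrib-∑ᴹ k x _ ⟨
      k *ₗ extend f x                              ∎

    extend-neg : ∀ (f : B → Carrierᴹ) x → extend f (map (λ (k , b) → - k , b) x) ≈ᴹ -ᴹ extend f x
    extend-neg f x = begin
      extend f (map (λ (k , b) → - k , b) x)      ≡⟨ ∑ᴹ-map _ x _ ⟩
      ∑ᴹ x (λ (k , b) → (- k) *ₗ f b)             ≈⟨ ∑ᴹ-cong x (λ (k , b) → *ₗ-congʳ (K.trans (K.-‿cong (K.sym (K.*-identityˡ k))) (-‿distribˡ-* 1# k))) ⟩
      ∑ᴹ x (λ (k , b) → (- 1# * k) *ₗ f b)        ≡⟨ ∑ᴹ-map _ x _ ⟨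
      extend f (map (λ (k , b) → - 1# * k , b) x) ≈⟨ extend-scale f (- 1#) x ⟩
      (- 1#) *ₗ extend f x                        ≈⟨ -1*ₗ _ ⟩
      -ᴹ extend f x                               ∎

  isLinear-cong : {M : RawModule μ ℓμ} {N : RawModule ν ℓν} (isN : IsModule N) →
    let open RawLeftModule N in
    {f g : RawLeftModule.Carrierᴹ M → Carrierᴹ} → (∀ x → f x ≈ᴹ g x) → IsLinear M N f → IsLinear M N g
  isLinear-cong isN f≈g f-linear = record
    { +ᴹ-isGroupHomomorphism = record
      { isMonoidHomomorphism = record
        { isMagmaHomomorphism = record
          { isRelHomomorphism = record
            { cong = λ x≈y → N.≈ᴹ-trans (N.≈ᴹ-sym (f≈g _)) (N.≈ᴹ-trans (f.⟦⟧-cong x≈y) (f≈g _)) }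
          ; homo = λ x y → N.≈ᴹ-trans (N.≈ᴹ-sym (f≈g _)) (N.≈ᴹ-trans (f.+ᴹ-homo x y) (N.+ᴹ-cong (f≈g x) (f≈g y)))
          }
        ; ε-homo = N.≈ᴹ-trans (N.≈ᴹ-sym (f≈g _)) f.0ᴹ-homo
        }
      ; ⁻¹-homo = λ x → N.≈ᴹ-trans (N.≈ᴹ-sym (f≈g _)) (N.≈ᴹ-trans (f.-ᴹ-homo x) (N.-ᴹ‿cong (f≈g x)))
      }
    ; *ₗ-homo = λ k x → N.≈ᴹ-trans (N.≈ᴹ-sym (f≈g _)) (N.≈ᴹ-trans (f.*ₗ-homo k x) (N.*ₗ-congˡ (f≈g x)))
    }
    where
    module N = Module isN
    module f = LeftModuleMorphisms.IsLeftModuleHomomorphism f-linear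

  -- Free modules

  module Free {B : Set b} (_≟_ : DecidableEquality B) where

    Formal : Set (c ⊔ b)
    Formal = List (K.Carrier × B)

    -- The extension of a Kronecker delta, so that the facts about `extend` apply to coefficients
    -- too; `coeff-coefficient` compares it with `coeff`.
    coefficient : Formal → B → K.Carrier
    coefficient x b = Module.extend ground-isModule (λ a → ⟦ a ≟ b ⟧) x

    remove : B → Formal → Formal
    remove a = filter (λ (_ , a′) → ¬? (a′ ≟ a))

    module _ {m ℓm : Level} {M : RawModule m ℓm} (isM : IsModule M) where
      open Module isM
      open SetoidReasoning ≈ᴹ-setoid
      open import Algebra.Properties.CommutativeSemigroup
        (CommutativeMonoid.commutativeSemigroup +ᴹ-commutativeMonoid) renaming (x∙yz≈y∙xz to x+[y+z]≈y+[x+z])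

      -- A formal combination is an unnormalized list; this collects its terms at one basis element,
      -- which is one step of a normalization.
      extend-remove : ∀ (f : B → Carrierᴹ) a x → extend f x ≈ᴹ coefficient x a *ₗ f a +ᴹ extend f (remove a x)
      extend-remove f a [] = ≈ᴹ-sym (≈ᴹ-trans (+ᴹ-identityʳ _) (*ₗ-zeroˡ (f a)))
      extend-remove f a ((k , a′) ∷ x) with a′ ≟ a
      ... | yes refl = begin
        k *ₗ f a′ +ᴹ extend f x                                                ≈⟨ +ᴹ-congˡ (extend-remove f a′ x) ⟩
        k *ₗ f a′ +ᴹ (coefficient x a′ *ₗ f a′ +ᴹ extend f (remove a′ x))      ≈⟨ +ᴹ-assoc _ _ _ ⟨
        (k *ₗ f a′ +ᴹ coefficient x a′ *ₗ f a′) +ᴹ extend f (remove a′ x)      ≈⟨ +ᴹ-congʳ (*ₗ-distribʳ _ _ _) ⟨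
        (k + coefficient x a′) *ₗ f a′ +ᴹ extend f (remove a′ x)               ≈⟨ +ᴹ-congʳ (*ₗ-congʳ (K.+-congʳ (K.*-identityʳ k))) ⟨
        (k * 1# + coefficient x a′) *ₗ f a′ +ᴹ extend f (remove a′ x)          ∎
      ... | no _ = begin
        k *ₗ f a′ +ᴹ extend f x                                              ≈⟨ +ᴹ-congˡ (extend-remove f a x) ⟩
        k *ₗ f a′ +ᴹ (coefficient x a *ₗ f a +ᴹ extend f (remove a x))       ≈⟨ x+[y+z]≈y+[x+z] _ _ _ ⟩
        coefficient x a *ₗ f a +ᴹ (k *ₗ f a′ +ᴹ extend f (remove a x))       ≈⟨ +ᴹ-congʳ (*ₗ-congʳ (K.trans (K.+-congʳ (K.zeroʳ k)) (K.+-identityˡ _))) ⟨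
        (k * 0# + coefficient x a) *ₗ f a +ᴹ (k *ₗ f a′ +ᴹ extend f (remove a x)) ∎

    module _ {m ℓm : Level} {M : RawModule m ℓm} (isM : IsModule M) where
      open Module isM
      open SetoidReasoning ≈ᴹ-setoid

      -- Induction on the length: the terms at the basis element of the head are collected, their
      -- total coefficient is zero, and removing them leaves a shorter list whose coefficients still
      -- vanish.
      extend-zero : ∀ (f : B → Carrierᴹ) x → (∀ b → coefficient x b ≈ 0#) → extend f x ≈ᴹ 0ᴹ
      extend-zero f x = go (length x) x ℕ.≤-refl
        where
        go : ∀ n x → length x ≤ n → (∀ b → coefficient x b ≈ 0#) → extend f x ≈ᴹ 0ᴹ
        go n       []                  _         _   = ≈ᴹ-refl
        go (suc n) x@((k , a) ∷ x′) (s≤s len) x≈0 = begin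
          extend f x                                          ≈⟨ extend-remove isM f a x ⟩
          coefficient x a *ₗ f a +ᴹ extend f (remove a x)     ≈⟨ +ᴹ-cong (≈ᴹ-trans (*ₗ-congʳ (x≈0 a)) (*ₗ-zeroˡ (f a)))
                                                                   (go n (remove a x) shorter removed) ⟩
          0ᴹ +ᴹ 0ᴹ                                            ≈⟨ +ᴹ-identityˡ 0ᴹ ⟩
          0ᴹ                                                  ∎
          where
          shorter : length (remove a x) ≤ n
          shorter = ℕ.≤-trans (ℕ.≤-reflexive (cong length
            (List.filter-reject (λ (_ , a′) → ¬? (a′ ≟ a)) {k , a} (λ ne → ne refl))))
            (ℕ.≤-trans (List.length-filter _ x′) len)
          -- The same collection of terms, applied to the Kronecker delta at `b`, compares the
          -- coefficients before and after the removal.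
          removed : ∀ b → coefficient (remove a x) b ≈ 0#
          removed b = K.trans (K.sym (K.trans (K.+-congʳ (K.trans (K.*-congʳ (x≈0 a)) (K.zeroˡ _))) (K.+-identityˡ _)))
            (K.trans (K.sym (extend-remove ground-isModule (λ a′ → ⟦ a′ ≟ b ⟧) a x)) (x≈0 b))

      -- `extend-zero` for the difference of `x` and `y`. It makes linear extension well defined on
      -- combinations up to equality of coefficients.
      extend-cong : ∀ (f : B → Carrierᴹ) x y → (∀ b → coefficient x b ≈ coefficient y b) → extend f x ≈ᴹ extend f y
      extend-cong f x y x≈y = begin
        extend f x                                      ≈⟨ +ᴹ-identityʳ _ ⟨
        extend f x +ᴹ 0ᴹ                                ≈⟨ +ᴹ-congˡ (-ᴹ‿inverseˡ _) ⟨
        extend f x +ᴹ (-ᴹ extend f y +ᴹ extend f y)     ≈⟨ +ᴹ-assoc _ _ _ ⟨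
        (extend f x +ᴹ -ᴹ extend f y) +ᴹ extend f y     ≈⟨ +ᴹ-congʳ (+ᴹ-congˡ (extend-neg f y)) ⟨
        (extend f x +ᴹ extend f -y) +ᴹ extend f y       ≈⟨ +ᴹ-congʳ (∑ᴹ-++ x -y _) ⟨
        extend f (x ++ -y) +ᴹ extend f y                ≈⟨ +ᴹ-congʳ (extend-zero f (x ++ -y) difference) ⟩
        0ᴹ +ᴹ extend f y                                ≈⟨ +ᴹ-identityˡ _ ⟩
        extend f y                                      ∎
        where
        -y = map (λ (k , b) → - k , b) y
        difference : ∀ b → coefficient (x ++ -y) b ≈ 0#
        difference b = K.trans (∑ᴷ.∑-++ x -y _)
          (K.trans (K.+-cong (x≈y b) (Module.extend-neg ground-isModule (λ a → ⟦ a ≟ b ⟧) y)) (K.-‿inverseʳ _))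

  -- Tensor products of modules

  module _ {m ℓm n ℓn : Level} {M : RawModule m ℓm} {N : RawModule n ℓn}
           (isM : IsModule M) (isN : IsModule N) where
    private
      module M = Module isM
      module N = Module isN
      module T = RawLeftModule (M ⊗ N)

    infix 4 _≈ᵀ_
    _≈ᵀ_ : Tensors M N → Tensors M N → Set _
    _≈ᵀ_ = _≈⊗_ M N

    ⊗-+-commutativeMonoid : CommutativeMonoid _ _
    ⊗-+-commutativeMonoid = record
      { Carrier = Tensors M N
      ; _≈_     = _≈ᵀ_
      ; _∙_     = _++_
      ; ε       = []
      ; isCommutativeMonoid = record
        { isMonoid = record
          { isSemigroup = record
            { isMagma = record
              { isEquivalence = record { refl = ≈⊗-refl ; sym = ≈⊗-sym ; trans = ≈⊗-trans }
              ; ∙-cong        = ++-cong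
              }
            ; assoc = λ s t u → ≡⇒≈ (List.++-assoc s t u)
            }
          ; identity = (λ _ → ≈⊗-refl) , λ s → ≡⇒≈ (List.++-identityʳ s)
          }
        ; comm = ++-comm
        }
      }
      where
      ≡⇒≈ : ∀ {s t} → s ≡ t → s ≈ᵀ t
      ≡⇒≈ refl = ≈⊗-refl

    private
      module CM = CommutativeMonoid ⊗-+-commutativeMonoid
      open SetoidReasoning CM.setoid
      open import Algebra.Properties.CommutativeSemigroup CM.commutativeSemigroup
        renaming (interchange to ++-interchange)

    -- The generating relations kill a zero on the left; the scalar `0#` carries it across the
    -- tensor sign.
    ⊗-zeroʳ : ∀ x → ((x , N.0ᴹ) ∷ []) ≈ᵀ []
    ⊗-zeroʳ x = begin
      (x , N.0ᴹ) ∷ []            ≈⟨ ⊗-cong M.≈ᴹ-refl (N.*ₗ-zeroˡ N.0ᴹ) ⟨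
      (x , 0# N.*ₗ N.0ᴹ) ∷ []    ≈⟨ ⊗-scale 0# x N.0ᴹ ⟨
      (0# M.*ₗ x , N.0ᴹ) ∷ []    ≈⟨ ⊗-cong (M.*ₗ-zeroˡ x) N.≈ᴹ-refl ⟩
      (M.0ᴹ , N.0ᴹ) ∷ []         ≈⟨ ⊗-zero N.0ᴹ ⟩
      []                         ∎

    private
      -- By induction on the derivation, compatibility with scalars not being one of the generating
      -- rules.
      *-congˡ : ∀ k {s t} → s ≈ᵀ t → k T.*ₗ s ≈ᵀ k T.*ₗ t
      *-congˡ k ≈⊗-refl           = ≈⊗-refl
      *-congˡ k (≈⊗-sym s≈t)      = ≈⊗-sym (*-congˡ k s≈t)
      *-congˡ k (≈⊗-trans s≈t t≈u) = ≈⊗-trans (*-congˡ k s≈t) (*-congˡ k t≈u)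
      *-congˡ k (++-cong {s} {s′} {t} {t′} s≈ t≈) = begin
        k T.*ₗ (s ++ t)               ≡⟨ List.map-++ _ s t ⟩
        k T.*ₗ s ++ k T.*ₗ t          ≈⟨ ++-cong (*-congˡ k s≈) (*-congˡ k t≈) ⟩
        k T.*ₗ s′ ++ k T.*ₗ t′        ≡⟨ List.map-++ _ s′ t′ ⟨
        k T.*ₗ (s′ ++ t′)             ∎
      *-congˡ k (++-comm s t) = begin
        k T.*ₗ (s ++ t)          ≡⟨ List.map-++ _ s t ⟩
        k T.*ₗ s ++ k T.*ₗ t     ≈⟨ ++-comm (k T.*ₗ s) (k T.*ₗ t) ⟩
        k T.*ₗ t ++ k T.*ₗ s     ≡⟨ List.map-++ _ t s ⟨
        k T.*ₗ (t ++ s)          ∎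
      *-congˡ k (⊗-cong x≈ y≈)  = ⊗-cong (M.*ₗ-congˡ x≈) y≈
      *-congˡ k (⊗-addˡ x x′ y) = ≈⊗-trans (⊗-cong (M.*ₗ-distribˡ k x x′) N.≈ᴹ-refl) (⊗-addˡ _ _ y)
      *-congˡ k (⊗-addʳ x y y′) = ⊗-addʳ _ y y′
      *-congˡ k (⊗-zero y)      = ≈⊗-trans (⊗-cong (M.*ₗ-zeroʳ k) N.≈ᴹ-refl) (⊗-zero y)
      *-congˡ k (⊗-scale k′ x y) = begin
        (k M.*ₗ k′ M.*ₗ x , y) ∷ []    ≈⟨ ⊗-cong (M.*ₗ-assoc k k′ x) N.≈ᴹ-refl ⟨
        ((k * k′) M.*ₗ x , y) ∷ []     ≈⟨ ⊗-cong (M.*ₗ-congʳ (K.*-comm k k′)) N.≈ᴹ-refl ⟩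
        ((k′ * k) M.*ₗ x , y) ∷ []     ≈⟨ ⊗-cong (M.*ₗ-assoc k′ k x) N.≈ᴹ-refl ⟩
        (k′ M.*ₗ k M.*ₗ x , y) ∷ []    ≈⟨ ⊗-scale k′ _ y ⟩
        (k M.*ₗ x , k′ N.*ₗ y) ∷ []    ∎

      map-cong-≈ : ∀ (f g : M.Carrierᴹ → M.Carrierᴹ) → (∀ x → f x M.≈ᴹ g x) → ∀ (t : Tensors M N) →
                   map (λ (x , y) → f x , y) t ≈ᵀ map (λ (x , y) → g x , y) t
      map-cong-≈ f g f≈g []            = ≈⊗-refl
      map-cong-≈ f g f≈g ((x , y) ∷ t) = ++-cong (⊗-cong (f≈g x) N.≈ᴹ-refl) (map-cong-≈ f g f≈g t)

      *-cong : ∀ {k k′} {s t} → k ≈ k′ → s ≈ᵀ t → k T.*ₗ s ≈ᵀ k′ T.*ₗ t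
      *-cong {k} {k′} {s} {t} k≈ s≈ = ≈⊗-trans (*-congˡ k s≈) (map-cong-≈ (k M.*ₗ_) (k′ M.*ₗ_) (λ x → M.*ₗ-congʳ k≈) t)

      *-zeroˡ : ∀ t → 0# T.*ₗ t ≈ᵀ []
      *-zeroˡ []            = ≈⊗-refl
      *-zeroˡ ((x , y) ∷ t) =
        ++-cong (≈⊗-trans (⊗-cong (M.*ₗ-zeroˡ x) N.≈ᴹ-refl) (⊗-zero y)) (*-zeroˡ t)

      *-distribʳ : ∀ t k k′ → (k + k′) T.*ₗ t ≈ᵀ k T.*ₗ t ++ k′ T.*ₗ t
      *-distribʳ []            k k′ = ≈⊗-refl
      *-distribʳ ((x , y) ∷ t) k k′ = begin
        ((k + k′) M.*ₗ x , y) ∷ [] ++ (k + k′) T.*ₗ t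
          ≈⟨ ++-cong (≈⊗-trans (⊗-cong (M.*ₗ-distribʳ x k k′) N.≈ᴹ-refl) (⊗-addˡ _ _ y)) (*-distribʳ t k k′) ⟩
        (((k M.*ₗ x , y) ∷ []) ++ ((k′ M.*ₗ x , y) ∷ [])) ++ (k T.*ₗ t ++ k′ T.*ₗ t)
          ≈⟨ ++-interchange ((k M.*ₗ x , y) ∷ []) ((k′ M.*ₗ x , y) ∷ []) (k T.*ₗ t) (k′ T.*ₗ t) ⟩
        (((k M.*ₗ x , y) ∷ []) ++ k T.*ₗ t) ++ (((k′ M.*ₗ x , y) ∷ []) ++ k′ T.*ₗ t) ∎

      *-assoc : ∀ k k′ t → (k * k′) T.*ₗ t ≈ᵀ k T.*ₗ k′ T.*ₗ t
      *-assoc k k′ []            = ≈⊗-refl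
      *-assoc k k′ ((x , y) ∷ t) = ++-cong (⊗-cong (M.*ₗ-assoc k k′ x) N.≈ᴹ-refl) (*-assoc k k′ t)

      *-identityˡ : ∀ t → 1# T.*ₗ t ≈ᵀ t
      *-identityˡ []            = ≈⊗-refl
      *-identityˡ ((x , y) ∷ t) = ++-cong (⊗-cong (M.*ₗ-identityˡ x) N.≈ᴹ-refl) (*-identityˡ t)

      -- Negation acts on left factors, where it is the scalar `- 1#`; its laws thus follow from
      -- those of scalars.
      neg : ∀ t → T.-ᴹ t ≈ᵀ (- 1#) T.*ₗ t
      neg = map-cong-≈ M.-ᴹ_ ((- 1#) M.*ₗ_) (λ x → M.≈ᴹ-sym (M.-1*ₗ x))

      inverseˡ : ∀ t → T.-ᴹ t ++ t ≈ᵀ []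
      inverseˡ t = begin
        T.-ᴹ t ++ t                        ≈⟨ ++-cong (neg t) (≈⊗-sym (*-identityˡ t)) ⟩
        (- 1#) T.*ₗ t ++ 1# T.*ₗ t         ≈⟨ *-distribʳ t (- 1#) 1# ⟨
        (- 1# + 1#) T.*ₗ t                 ≈⟨ *-cong (K.-‿inverseˡ 1#) ≈⊗-refl ⟩
        0# T.*ₗ t                          ≈⟨ *-zeroˡ t ⟩
        []                                 ∎

    ⊗-isModule : IsModule (M ⊗ N)
    ⊗-isModule = record
      { isLeftSemimodule = record
        { +ᴹ-isCommutativeMonoid = CM.isCommutativeMonoid
        ; isPreleftSemimodule = record
          { *ₗ-cong      = *-cong
          ; *ₗ-zeroˡ     = *-zeroˡ
          ; *ₗ-distribʳ  = *-distribʳ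
          ; *ₗ-identityˡ = *-identityˡ
          ; *ₗ-assoc     = *-assoc
          ; *ₗ-zeroʳ     = λ _ → ≈⊗-refl
          ; *ₗ-distribˡ  = λ k s t → CM.reflexive (List.map-++ _ s t)
          }
        }
      ; -ᴹ‿cong    = λ {s} {t} s≈t → ≈⊗-trans (neg s) (≈⊗-trans (*-congˡ (- 1#) s≈t) (≈⊗-sym (neg t)))
      ; -ᴹ‿inverse = inverseˡ , λ t → ≈⊗-trans (++-comm t _) (inverseˡ t)
      }

    private
      module ∑ᵀ = Summation ⊗-+-commutativeMonoid

    ⊗-∑ˡ : ∀ (xs : List A) (f : A → M.Carrierᴹ) y → ((M.∑ᴹ xs f , y) ∷ []) ≈ᵀ ∑ᵀ.∑ xs (λ x → (f x , y) ∷ [])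
    ⊗-∑ˡ []       f y = ⊗-zero y
    ⊗-∑ˡ (x ∷ xs) f y = ≈⊗-trans (⊗-addˡ _ _ y) (++-cong ≈⊗-refl (⊗-∑ˡ xs f y))

    ⊗-∑ʳ : ∀ x (ys : List A) (f : A → N.Carrierᴹ) → ((x , N.∑ᴹ ys f) ∷ []) ≈ᵀ ∑ᵀ.∑ ys (λ y → (x , f y) ∷ [])
    ⊗-∑ʳ x []       f = ⊗-zeroʳ x
    ⊗-∑ʳ x (y ∷ ys) f = ≈⊗-trans (⊗-addʳ x _ _) (++-cong ≈⊗-refl (⊗-∑ʳ x ys f))

-- Convolution over the restrictions of the elements of B to the intervals
-- [1 , i] and [i + 1 , n], where n is the size.

module IntervalConvolution
  {B : Set} (size : B → ℕ) (restrict : ℕ → ℕ → B → B) (∅ : B)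
  (size0 : ∀ {a} → size a ≡ 0 → a ≡ ∅)
  (size-restrict : ∀ {i j} a → j ≤ size a → size (restrict (suc i) j a) ≡ j ℕ.∸ i)
  (restrict-all : ∀ a → restrict 1 (size a) a ≡ a)
  (restrict-restrict : ∀ i p {q j} a → i ℕ.+ q ≤ j → j ≤ size a →
    restrict (suc p) q (restrict (suc i) j a) ≡ restrict (suc (i ℕ.+ p)) (i ℕ.+ q) a)
  where

  head tail : ℕ → B → B
  head i a = restrict 1 i a
  tail i a = restrict (suc i) (size a) a

  module _ {r ℓr : Level} (M : CommutativeMonoid r ℓr) where
    private
      module M = CommutativeMonoid M
      module ∑ᴹ = Summation M

    -- Both sums run over the double cuts of `a` into three intervals: the left side makes the upper
    -- cut first, the right side the lower one. With values in any commutative monoid, it serves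
    -- both the associativity of convolution and coassociativity.
    ∑-restrict-assoc : ∀ a (F : B → B → B → M.Carrier) →
      ∑ᴹ.∑ (upTo (suc (size a))) (λ i → ∑ᴹ.∑ (upTo (suc (size (head i a)))) (λ j →
        F (head j (head i a)) (tail j (head i a)) (tail i a))) M.≈
      ∑ᴹ.∑ (upTo (suc (size a))) (λ i → ∑ᴹ.∑ (upTo (suc (size (tail i a)))) (λ j →
        F (head i a) (head j (tail i a)) (tail j (tail i a))))
    ∑-restrict-assoc a F = M.trans (∑ᴹ.∑-congᵘ (suc N) left)
      (M.trans (∑ᴹ.∑-triangle N triple) (M.sym (∑ᴹ.∑-congᵘ (suc N) right)))
      where
      N = size a
      triple : ℕ → ℕ → M.Carrier
      triple j i = F (head j a) (restrict (suc j) i a) (tail i a)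
      F-cong : ∀ {x x′ y y′ z z′} → x ≡ x′ → y ≡ y′ → z ≡ z′ → F x y z M.≈ F x′ y′ z′
      F-cong refl refl refl = M.refl
      left : ∀ i → i < suc N →
        ∑ᴹ.∑ (upTo (suc (size (head i a)))) (λ j → F (head j (head i a)) (tail j (head i a)) (tail i a)) M.≈
        ∑ᴹ.∑ (upTo (suc i)) (λ j → triple j i)
      -- The size of `head i a` is `i` only up to a proof, so it is replaced at once in the range of
      -- the sum and in the upper end of the middle interval.
      left i (s≤s i≤N) = M.trans
        (M.reflexive (cong (λ m → ∑ᴹ.∑ (upTo (suc m)) (λ j → F (head j (head i a)) (restrict (suc j) m (head i a)) (tail i a)))
          (size-restrict {0} a i≤N)))
        (∑ᴹ.∑-congᵘ (suc i) λ { j (s≤s j≤i) →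
          F-cong (restrict-restrict 0 0 a j≤i i≤N) (restrict-restrict 0 j a ℕ.≤-refl i≤N) refl })
      right : ∀ j → j < suc N →
        ∑ᴹ.∑ (upTo (suc (size (tail j a)))) (λ k → F (head j a) (head k (tail j a)) (tail k (tail j a))) M.≈
        ∑ᴹ.∑ (upTo (suc (N ℕ.∸ j))) (λ k → triple j (j ℕ.+ k))
      right j (s≤s j≤N) = M.trans
        (M.reflexive (cong (λ m → ∑ᴹ.∑ (upTo (suc m)) (λ k → F (head j a) (head k (tail j a)) (restrict (suc k) m (tail j a))))
          (size-restrict {j} a ℕ.≤-refl)))
        (∑ᴹ.∑-congᵘ (suc (N ℕ.∸ j)) λ { k (s≤s k≤) → F-cong refl
          (trans (restrict-restrict j 0 a (ℕ.≤-trans (ℕ.+-monoʳ-≤ j k≤) (ℕ.≤-reflexive (ℕ.m+[n∸m]≡n j≤N))) ℕ.≤-refl)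
            (cong (λ m → restrict (suc m) (j ℕ.+ k) a) (ℕ.+-identityʳ j)))
          (trans (restrict-restrict j k a (ℕ.≤-reflexive (ℕ.m+[n∸m]≡n j≤N)) ℕ.≤-refl)
            (cong (λ m → restrict (suc (j ℕ.+ k)) m a) (ℕ.m+[n∸m]≡n j≤N))) })

  -- Restricting `∅` to an empty interval gives an element of size 0, which is `∅` again.
  size-∅ : size ∅ ≡ 0
  size-∅ = trans (cong size (sym (size0 (size-restrict {0} ∅ z≤n)))) (size-restrict {0} ∅ z≤n)

  tail-all : ∀ a → tail (size a) a ≡ ∅
  tail-all a = size0 (trans (size-restrict {size a} a ℕ.≤-refl) (ℕ.n∸n≡0 (size a)))

  head-zero : ∀ a → head 0 a ≡ ∅
  head-zero a = size0 (size-restrict {0} a z≤n)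

  module Convolution {r ℓr : Level} (R : Ring r ℓr) where
    private
      module R = Ring R
      module ∑ᴿ = Summation R.+-commutativeMonoid
    open RingSums R renaming (*-distribˡ-∑ to R-distribˡ-∑; *-distribʳ-∑ to R-distribʳ-∑)
    open SetoidReasoning R.setoid

    Map : Set r
    Map = B → R.Carrier

    infix 4 _≗ᴿ_
    _≗ᴿ_ : Map → Map → Set ℓr
    f ≗ᴿ g = ∀ a → f a R.≈ g a

    infixl 7 _⋆_
    -- Maps are given by their values on the basis. For `R` the algebra itself this is the
    -- convolution of linear endomorphisms, for `R` the base ring that of linear forms.
    _⋆_ : Map → Map → Map
    (f ⋆ g) a = ∑ᴿ.∑ (upTo (suc (size a))) (λ i → f (head i a) R.* g (tail i a))

    unit : Map
    unit a = if does (size a ℕ.≟ 0) then R.1# else R.0#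

    unit-suc : ∀ {a} → size a ≢ 0 → unit a R.≈ R.0#
    unit-suc {a} ne with size a
    ... | zero  = contradiction refl ne
    ... | suc _ = R.refl

    unit-∅ : unit ∅ R.≈ R.1#
    unit-∅ = R.reflexive (cong (λ n → if does (n ℕ.≟ 0) then R.1# else R.0#) size-∅)

    ⋆-cong : ∀ {f f′ g g′} → f ≗ᴿ f′ → g ≗ᴿ g′ → f ⋆ g ≗ᴿ f′ ⋆ g′
    ⋆-cong f≗ g≗ a = ∑ᴿ.∑-cong (upTo (suc (size a))) (λ i → R.*-cong (f≗ (head i a)) (g≗ (tail i a)))

    ⋆-assoc : ∀ f g h → (f ⋆ g) ⋆ h ≗ᴿ f ⋆ (g ⋆ h)
    ⋆-assoc f g h a = begin
      ((f ⋆ g) ⋆ h) a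
        ≈⟨ ∑ᴿ.∑-cong (upTo (suc (size a))) (λ i → R.trans
             (R-distribʳ-∑ (h (tail i a)) (upTo (suc (size (head i a)))) _)
             (∑ᴿ.∑-cong (upTo (suc (size (head i a)))) (λ j → R.*-assoc _ _ _))) ⟩
      ∑ᴿ.∑ (upTo (suc (size a))) (λ i → ∑ᴿ.∑ (upTo (suc (size (head i a)))) (λ j →
        f (head j (head i a)) R.* (g (tail j (head i a)) R.* h (tail i a))))
        ≈⟨ ∑-restrict-assoc R.+-commutativeMonoid a (λ x y z → f x R.* (g y R.* h z)) ⟩
      ∑ᴿ.∑ (upTo (suc (size a))) (λ i → ∑ᴿ.∑ (upTo (suc (size (tail i a)))) (λ j →
        f (head i a) R.* (g (head j (tail i a)) R.* h (tail j (tail i a)))))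
        ≈⟨ ∑ᴿ.∑-cong (upTo (suc (size a))) (λ i →
             R-distribˡ-∑ (f (head i a)) (upTo (suc (size (tail i a)))) _) ⟨
      (f ⋆ (g ⋆ h)) a ∎

    ⋆-identityˡ : ∀ f → unit ⋆ f ≗ᴿ f
    ⋆-identityˡ f a = begin
      (unit ⋆ f) a
        ≈⟨ ∑ᴿ.∑-unique (Unique.upTo⁺ (suc (size a))) (Mem.∈-upTo⁺ (s≤s z≤n)) (λ {i} i∈ i≢0 →
             R.trans (R.*-congʳ (unit-suc {head i a} (i≢0 ∘ trans (sym (size-restrict {0} a (ℕ.≤-pred (Mem.∈-upTo⁻ i∈)))))))
                     (R.zeroˡ _)) ⟩
      unit (head 0 a) R.* f (tail 0 a)
        ≈⟨ R.*-cong (R.trans (R.reflexive (cong unit (head-zero a))) unit-∅) (R.reflexive (cong f (restrict-all a))) ⟩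
      R.1# R.* f a
        ≈⟨ R.*-identityˡ (f a) ⟩
      f a ∎

    ⋆-identityʳ : ∀ f → f ⋆ unit ≗ᴿ f
    ⋆-identityʳ f a = begin
      (f ⋆ unit) a
        ≈⟨ ∑ᴿ.∑-unique (Unique.upTo⁺ (suc (size a))) (Mem.∈-upTo⁺ ℕ.≤-refl) (λ {i} i∈ i≢n →
             let i≤n = ℕ.≤-pred (Mem.∈-upTo⁻ i∈) in
             R.trans (R.*-congˡ (unit-suc {tail i a} λ eq → i≢n (ℕ.≤-antisym i≤n
                       (ℕ.m∸n≡0⇒m≤n (trans (sym (size-restrict {i} a ℕ.≤-refl)) eq)))))
                     (R.zeroʳ _)) ⟩
      f (head (size a) a) R.* unit (tail (size a) a)
        ≈⟨ R.*-cong (R.reflexive (cong f (restrict-all a))) (R.trans (R.reflexive (cong unit (tail-all a))) unit-∅) ⟩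
      f a R.* R.1#
        ≈⟨ R.*-identityʳ (f a) ⟩
      f a ∎

    -- If `f ∅` is 1, the term at the last cut of `(s ⋆ f) a` is `s a`; solving `(s ⋆ f) a = 0` for
    -- it gives this formula. The size is a separate argument so that it can be matched on.
    recursion : Map → Map → B → ℕ → R.Carrier
    recursion f s a zero    = R.1#
    recursion f s a (suc n) = R.- ∑ᴿ.∑ (upTo (suc n)) (λ i → s (head i a) R.* f (tail i a))

    -- The first argument bounds the size of the elements at which the value is meaningful.
    leftInverse′ : ℕ → Map → Map
    leftInverse′ zero    f a = R.1#
    leftInverse′ (suc k) f a = recursion f (leftInverse′ k f) a (size a)

    leftInverse : Map → Map
    leftInverse f a = leftInverse′ (size a) f a

    recursion-cong : ∀ f {s s′ : Map} a n → n ≤ size a →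
                     (∀ b → size b < n → s b R.≈ s′ b) → recursion f s a n R.≈ recursion f s′ a n
    recursion-cong f a zero    _   _   = R.refl
    recursion-cong f a (suc n) n≤ s≈s′ = R.-‿cong (∑ᴿ.∑-congᵘ (suc n) λ i i<n → R.*-congʳ
      (s≈s′ (head i a) (subst (_< suc n) (sym (size-restrict {0} a (ℕ.≤-trans (ℕ.<⇒≤ i<n) n≤))) i<n)))

    leftInverse′-bound : ∀ f k k′ a → size a ≤ k → size a ≤ k′ → leftInverse′ k f a R.≈ leftInverse′ k′ f a
    leftInverse′-bound f zero    zero     a _  _   = R.refl
    leftInverse′-bound f zero    (suc k′) a ≤0 _   = R.sym (R.reflexive (cong (recursion f _ a) (ℕ.n≤0⇒n≡0 ≤0)))
    leftInverse′-bound f (suc k) zero     a _  ≤0  = R.reflexive (cong (recursion f _ a) (ℕ.n≤0⇒n≡0 ≤0))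
    leftInverse′-bound f (suc k) (suc k′) a ≤k ≤k′ = recursion-cong f a (size a) ℕ.≤-refl λ b b<a →
      leftInverse′-bound f k k′ b (ℕ.≤-pred (ℕ.≤-trans b<a ≤k)) (ℕ.≤-pred (ℕ.≤-trans b<a ≤k′))

    leftInverse-⋆ : ∀ f → f ∅ R.≈ R.1# → leftInverse f ⋆ f ≗ᴿ unit
    leftInverse-⋆ f f1 a = begin
      (leftInverse f ⋆ f) a
        ≈⟨ ∑ᴿ.∑-upTo-last (size a) (λ i → leftInverse f (head i a) R.* f (tail i a)) ⟩
      S (size a) R.+ leftInverse f (head (size a) a) R.* f (tail (size a) a)
        ≈⟨ R.+-congˡ (R.trans (R.*-cong (R.reflexive (cong (leftInverse f) (restrict-all a)))
                                        (R.trans (R.reflexive (cong f (tail-all a))) f1))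
                              (R.*-identityʳ _)) ⟩
      S (size a) R.+ leftInverse f a
        ≈⟨ cancel (size a) refl ⟩
      unit a ∎
      where
      S : ℕ → R.Carrier
      S n = ∑ᴿ.∑ (upTo n) (λ i → leftInverse f (head i a) R.* f (tail i a))
      -- The size is generalized to `n` for matching; at a successor, the recursion makes the last
      -- term the negative of the sum of the others.
      cancel : ∀ n → n ≡ size a → S n R.+ leftInverse′ n f a R.≈ (if does (n ℕ.≟ 0) then R.1# else R.0#)
      cancel zero    _  = R.+-identityˡ R.1#
      cancel (suc n) eq = begin
        S (suc n) R.+ recursion f (leftInverse′ n f) a (size a)
          ≡⟨ cong (λ m → S (suc n) R.+ recursion f (leftInverse′ n f) a m) eq ⟨
        S (suc n) R.+ recursion f (leftInverse′ n f) a (suc n)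
          ≈⟨ R.+-congˡ (recursion-cong f a (suc n) (ℕ.≤-reflexive eq) λ b b≤n →
               leftInverse′-bound f n (size b) b (ℕ.≤-pred b≤n) ℕ.≤-refl) ⟩
        S (suc n) R.+ R.- S (suc n)
          ≈⟨ R.-‿inverseʳ (S (suc n)) ⟩
        R.0# ∎

    leftInverse-∅ : ∀ f → leftInverse f ∅ R.≈ R.1#
    leftInverse-∅ f = R.reflexive (cong (λ n → leftInverse′ n f ∅) size-∅)

    -- A left inverse s of f has itself a left inverse t, so t = t(sf) = (ts)f = f.
    ⋆-leftInverse : ∀ f → f (∅) R.≈ R.1# → f ⋆ leftInverse f ≗ᴿ unit
    ⋆-leftInverse f f1 a = R.trans (⋆-cong {g = s} f≗t (λ _ → R.refl) a) (leftInverse-⋆ s (leftInverse-∅ f) a)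
      where
      s = leftInverse f
      t = leftInverse s
      f≗t : f ≗ᴿ t
      f≗t b = begin
        f b                ≈⟨ ⋆-identityˡ f b ⟨
        (unit ⋆ f) b       ≈⟨ ⋆-cong {g = f} (leftInverse-⋆ s (leftInverse-∅ f)) (λ _ → R.refl) b ⟨
        ((t ⋆ s) ⋆ f) b    ≈⟨ ⋆-assoc t s f b ⟩
        (t ⋆ (s ⋆ f)) b    ≈⟨ ⋆-cong {f = t} (λ _ → R.refl) (leftInverse-⋆ f f1) b ⟩
        (t ⋆ unit) b       ≈⟨ ⋆-identityʳ t b ⟩
        t b                ∎

-- The list of all permutations

permutationsAmong : ∀ {n} → List (Vec ℕ n) → List (𝔖 n)
permutationsAmong = List.mapMaybe (λ w → Maybe.map (λ p → perm w p) (dec⇒maybe (isPermutation? w)))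

module _ {n : ℕ} where

  ∈-permutationsAmong⁻ : ∀ ws {τ : 𝔖 n} → τ ∈ permutationsAmong ws → word τ ∈ ws
  ∈-permutationsAmong⁻ (w ∷ ws) τ∈ with isPermutation? w
  ∈-permutationsAmong⁻ (w ∷ ws) (here ≡.refl) | yes _ = here ≡.refl
  ∈-permutationsAmong⁻ (w ∷ ws) (there τ∈)    | yes _ = there (∈-permutationsAmong⁻ ws τ∈)
  ∈-permutationsAmong⁻ (w ∷ ws) τ∈            | no _  = there (∈-permutationsAmong⁻ ws τ∈)

  ∈-permutationsAmong⁺ : ∀ ws (τ : 𝔖 n) → word τ ∈ ws → τ ∈ permutationsAmong ws
  ∈-permutationsAmong⁺ (w ∷ ws) τ w∈ with isPermutation? w
  ∈-permutationsAmong⁺ (w ∷ ws) τ          (here ≡.refl) | yes _ = here ≡.refl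
  ∈-permutationsAmong⁺ (w ∷ ws) τ          (there w∈)    | yes _ = there (∈-permutationsAmong⁺ ws τ w∈)
  ∈-permutationsAmong⁺ (w ∷ ws) (perm _ p) (here ≡.refl) | no ¬p = contradiction (recompute (isPermutation? w) p) ¬p
  ∈-permutationsAmong⁺ (w ∷ ws) τ          (there w∈)    | no _  = ∈-permutationsAmong⁺ ws τ w∈

  permutationsAmong-unique : ∀ {ws : List (Vec ℕ n)} → Unique ws → Unique (permutationsAmong ws)
  permutationsAmong-unique {[]}     _          = []
  permutationsAmong-unique {w ∷ ws} (w∉ ∷ ws!) with isPermutation? w
  ... | yes _ = All.tabulate (λ { τ∈ ≡.refl → All.lookup w∉ (∈-permutationsAmong⁻ ws τ∈) ≡.refl })
                ∷ permutationsAmong-unique ws!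
  ... | no _  = permutationsAmong-unique ws!

wordsOver-unique : ∀ {as} n → Unique as → Unique (wordsOver as n)
wordsOver-unique zero    _   = [] ∷ []
wordsOver-unique (suc n) as! = Unique.cartesianProductWith⁺ _∷_ Vec.∷-injective as! (wordsOver-unique n as!)

∈-wordsOver : ∀ {as n} {w : Vec ℕ n} → VecAll.All (_∈ as) w → w ∈ wordsOver as n
∈-wordsOver VecAll.[]         = here ≡.refl
∈-wordsOver (a∈ VecAll.∷ w∈) = Mem.∈-cartesianProductWith⁺ _∷_ a∈ (∈-wordsOver w∈)

allPermutations-unique : ∀ n → Unique (allPermutations n)
allPermutations-unique n =
  permutationsAmong-unique (wordsOver-unique n (Unique.map⁺ ℕ.suc-injective (Unique.upTo⁺ n)))

∈-allPermutations : ∀ {n} (σ : 𝔖 n) → σ ∈ allPermutations n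
∈-allPermutations {n} σ@(perm w p) = ∈-permutationsAmong⁺ _ σ
  (∈-wordsOver (VecAll.map (λ { {suc a} (_ , a<n) → Mem.∈-map⁺ suc (Mem.∈-upTo⁺ a<n) })
    (proj₁ (recompute (isPermutation? w) p))))

-- The module of colored permutations and its coefficients

module FQSymHopf {c ℓ : Level} (K : CommutativeRing c ℓ) {l : ℕ} {C : Set} (C↔Fin : C ↔ Fin l) where
  open HopfAlgebras K
  open ColoredFQSym K C↔Fin
  open LinearAlgebra K
  open K using (_≈_; _+_; _*_; -_; 0#; 1#)
  open ∑ᴷ
  open Words C

  abstract
    -- A copy of `_≟_` that does not unfold: the brackets are handled through the truth of the
    -- equality and not through how it is decided.
    _≡?_ : DecidableEquality ColoredPermutation
    _≡?_ = _≟_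

  open Free _≡?_
  open RawAlgebra FQSym using (_·_; 1ᴬ; _≈ᴹ_; _*ₗ_; 0ᴹ; -ᴹ_)
  open SetoidReasoning K.setoid
  open import Algebra.Properties.CommutativeSemigroup K.*-commutativeSemigroup using (x∙yz≈y∙xz)
    renaming (interchange to *-interchange)

  coeff-coefficient : ∀ x b → coeff x b ≈ coefficient x b
  coeff-coefficient []            b = K.refl
  coeff-coefficient ((k , a) ∷ x) b = K.trans (head (a ≟ b))
    (K.+-cong (K.*-congˡ (⟦⟧-cong (a ≟ b) (a ≡? b) id id)) (coeff-coefficient x b))
    where
    head : (d : Dec (a ≡ b)) → (if does d then k + coeff x b else coeff x b) ≈ k * ⟦ d ⟧ + coeff x b
    head (yes _) = K.+-congʳ (K.sym (K.*-identityʳ k))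
    head (no _)  = K.trans (K.sym (K.+-identityˡ _)) (K.+-congʳ (K.sym (K.zeroʳ k)))

  coeff-++ : ∀ x y b → coeff (x ++ y) b ≈ coeff x b + coeff y b
  coeff-++ x y b = K.trans (coeff-coefficient (x ++ y) b) (K.trans (∑-++ x y _)
    (K.sym (K.+-cong (coeff-coefficient x b) (coeff-coefficient y b))))

  coeff-scale : ∀ k x b → coeff (k *ₗ x) b ≈ k * coeff x b
  coeff-scale k x b = K.trans (coeff-coefficient (k *ₗ x) b)
    (K.trans (Module.extend-scale ground-isModule _ k x) (K.*-congˡ (K.sym (coeff-coefficient x b))))

  coeff-neg : ∀ x b → coeff (-ᴹ x) b ≈ - coeff x b
  coeff-neg x b = K.trans (coeff-coefficient (-ᴹ x) b)
    (K.trans (Module.extend-neg ground-isModule _ x) (K.-‿cong (K.sym (coeff-coefficient x b))))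

  coeff-∑ : ∀ (xs : List A) f b → coeff (sum fqsymModule (map f xs)) b ≈ ∑ xs (λ x → coeff (f x) b)
  coeff-∑ []       f b = K.refl
  coeff-∑ (x ∷ xs) f b = K.trans (coeff-++ (f x) _ b) (K.+-congˡ (coeff-∑ xs f b))

  coeff-linear : ∀ f x b → coeff (linear fqsymModule f x) b ≈ ∑ x (λ (k , a) → k * coeff (f a) b)
  coeff-linear f x b = K.trans (coeff-∑ x _ b) (∑-cong x (λ (k , a) → coeff-scale k (f a) b))

  coeff-G : ∀ a b → coeff (G a) b ≈ ⟦ a ≡? b ⟧
  coeff-G a b = K.trans (coeff-coefficient (G a) b) (K.trans (K.+-identityʳ _) (K.*-identityˡ _))

  fqsym-isModule : IsModule fqsymModule
  fqsym-isModule = record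
    { isLeftSemimodule = record
      { +ᴹ-isCommutativeMonoid = record
        { isMonoid = record
          { isSemigroup = record
            { isMagma = record
              { isEquivalence = record
                { refl  = λ _ → K.refl
                ; sym   = λ x≈y b → K.sym (x≈y b)
                ; trans = λ x≈y y≈z b → K.trans (x≈y b) (y≈z b)
                }
              ; ∙-cong = λ {x} {x′} {y} {y′} x≈ y≈ b →
                  K.trans (coeff-++ x y b) (K.trans (K.+-cong (x≈ b) (y≈ b)) (K.sym (coeff-++ x′ y′ b)))
              }
            ; assoc = λ x y z b → K.reflexive (cong (λ t → coeff t b) (List.++-assoc x y z))
            }
          ; identity = (λ x b → K.refl) , λ x b → K.reflexive (cong (λ t → coeff t b) (List.++-identityʳ x))
          }
        ; comm = λ x y b → K.trans (coeff-++ x y b) (K.trans (K.+-comm _ _) (K.sym (coeff-++ y x b)))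
        }
      ; isPreleftSemimodule = record
        { *ₗ-cong      = λ {k} {k′} {x} {x′} k≈ x≈ b →
            K.trans (coeff-scale k x b) (K.trans (K.*-cong k≈ (x≈ b)) (K.sym (coeff-scale k′ x′ b)))
        ; *ₗ-zeroˡ     = λ x b → K.trans (coeff-scale 0# x b) (K.zeroˡ _)
        ; *ₗ-distribʳ  = λ x k k′ b → K.trans (coeff-scale (k + k′) x b) (K.trans (K.distribʳ _ k k′)
            (K.trans (K.sym (K.+-cong (coeff-scale k x b) (coeff-scale k′ x b))) (K.sym (coeff-++ (k *ₗ x) (k′ *ₗ x) b))))
        ; *ₗ-identityˡ = λ x b → K.trans (coeff-scale 1# x b) (K.*-identityˡ _)
        ; *ₗ-assoc     = λ k k′ x b → K.trans (coeff-scale (k * k′) x b) (K.trans (K.*-assoc k k′ _)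
            (K.sym (K.trans (coeff-scale k (k′ *ₗ x) b) (K.*-congˡ (coeff-scale k′ x b)))))
        ; *ₗ-zeroʳ     = λ k b → K.refl
        ; *ₗ-distribˡ  = λ k x y b → K.reflexive (cong (λ t → coeff t b) (List.map-++ _ x y))
        }
      }
    ; -ᴹ‿cong    = λ {x} {y} x≈y b → K.trans (coeff-neg x b) (K.trans (K.-‿cong (x≈y b)) (K.sym (coeff-neg y b)))
    ; -ᴹ‿inverse =
        (λ x b → K.trans (coeff-++ (-ᴹ x) x b) (K.trans (K.+-congʳ (coeff-neg x b)) (K.-‿inverseˡ _))) ,
        (λ x b → K.trans (coeff-++ x (-ᴹ x) b) (K.trans (K.+-congˡ (coeff-neg x b)) (K.-‿inverseʳ _)))
    }

  linear-isLinear : {M : RawModule μ ℓμ} → IsModule M → (f : ColoredPermutation → RawLeftModule.Carrierᴹ M) →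
                    IsLinear fqsymModule M (linear M f)
  linear-isLinear isM f = record
    { +ᴹ-isGroupHomomorphism = record
      { isMonoidHomomorphism = record
        { isMagmaHomomorphism = record
          { isRelHomomorphism = record
            { cong = λ {x} {y} x≈y → extend-cong isM f x y
                λ b → K.trans (K.sym (coeff-coefficient x b)) (K.trans (x≈y b) (coeff-coefficient y b)) }
          ; homo = λ x y → Module.∑ᴹ-++ isM x y _
          }
        ; ε-homo = Module.≈ᴹ-refl isM
        }
      ; ⁻¹-homo = Module.extend-neg isM f
      }
    ; *ₗ-homo = Module.extend-scale isM f
    }

  -- Coefficients of products

  ∑-splits-length : ∀ u {v : List A} (f : List A → List A → K.Carrier) →
    (∀ {u′ v′} → u′ ++ v′ ≡ u ++ v → length u′ ≢ length u → f u′ v′ ≈ 0#) →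
    ∑ (splits (u ++ v)) (uncurry f) ≈ f u v
  ∑-splits-length [] {[]}    f f≈0 = K.+-identityʳ _
  ∑-splits-length [] {x ∷ v} f f≈0 = begin
    ∑ (splits (x ∷ v)) (uncurry f)
      ≡⟨ ∑-splits-∷ x v f ⟩
    f [] (x ∷ v) + ∑ (splits v) (λ (u′ , v′) → f (x ∷ u′) v′)
      ≈⟨ K.+-congˡ (∑-ε (splits v) λ {(u′ , v′)} uv∈ → f≈0 (cong (x ∷_) (splits-++ v uv∈)) λ ()) ⟩
    f [] (x ∷ v) + 0#
      ≈⟨ K.+-identityʳ _ ⟩
    f [] (x ∷ v) ∎
  ∑-splits-length (x ∷ u) {v} f f≈0 = begin
    ∑ (splits (x ∷ u ++ v)) (uncurry f)
      ≡⟨ ∑-splits-∷ x (u ++ v) f ⟩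
    f [] (x ∷ u ++ v) + ∑ (splits (u ++ v)) (λ (u′ , v′) → f (x ∷ u′) v′)
      ≈⟨ K.+-cong (f≈0 refl λ ()) (∑-splits-length u (λ u′ → f (x ∷ u′))
           (λ eq ne → f≈0 (cong (x ∷_) eq) (ne ∘ ℕ.suc-injective))) ⟩
    0# + f (x ∷ u) v
      ≈⟨ K.+-identityˡ _ ⟩
    f (x ∷ u) v ∎

  colored-injective : ∀ {n} {σ τ : 𝔖 n} {u v : Vec C n} →
    _≡_ {A = ColoredPermutation} (n , σ , u) (n , τ , v) → σ ≡ τ × u ≡ v
  colored-injective refl = refl , refl

  vectorOf : ∀ {n} (w : List A) → length w ≡ n → ∃ λ (v : Vec A n) → toList v ≡ w
  vectorOf w refl = fromList w , Vec.toList∘fromList w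

  take-++ : ∀ {m n} (xs : Vec A m) (ys : Vec A n) → Vec.take m (xs Vec.++ ys) ≡ xs
  take-++ []       ys = refl
  take-++ (x ∷ xs) ys = cong (x ∷_) (take-++ xs ys)

  drop-++ : ∀ {m n} (xs : Vec A m) (ys : Vec A n) → Vec.drop m (xs Vec.++ ys) ≡ ys
  drop-++ []       ys = refl
  drop-++ (x ∷ xs) ys = drop-++ xs ys

  -- A term of the product contributes only if its permutation is the standardization of the whole
  -- word. That permutation lies in the convolution set exactly when the two factors of the word
  -- standardize to the permutations of `a` and `b`; the colors are compared by cutting at the same
  -- place.
  coeff-productG-++ : ∀ a b (v₁ : Vec Letter (size a)) (v₂ : Vec Letter (size b)) →
    coeff (productG a b) (pack (toList v₁ ++ toList v₂)) ≈ ⟦ a ≡? pack (toList v₁) ⟧ * ⟦ b ≡? pack (toList v₂) ⟧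
  coeff-productG-++ a@(m , σ′ , u′) b@(n , σ″ , u″) v₁ v₂ = begin
    coeff (productG a b) (pack (toList v₁ ++ toList v₂))
      ≡⟨ cong (coeff (productG a b)) (trans (cong pack (sym (Vec.toList-++ v₁ v₂))) (pack-toList (v₁ Vec.++ v₂))) ⟩
    coeff (productG a b) target
      ≈⟨ coeff-∑ τs _ target ⟩
    ∑ τs (λ τ → coeff (G (term τ)) target)
      ≈⟨ ∑-cong τs (λ τ → coeff-G (term τ) target) ⟩
    ∑ τs (λ τ → ⟦ term τ ≡? target ⟧)
      ≈⟨ main ((a ≡? (m , vpack v₁)) ×-dec (b ≡? (n , vpack v₂))) ⟩
    ⟦ (a ≡? (m , vpack v₁)) ×-dec (b ≡? (n , vpack v₂)) ⟧
      ≈⟨ ⟦⟧-× (a ≡? (m , vpack v₁)) (b ≡? (n , vpack v₂)) ⟩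
    ⟦ a ≡? (m , vpack v₁) ⟧ * ⟦ b ≡? (n , vpack v₂) ⟧
      ≡⟨ cong₂ (λ x y → ⟦ a ≡? x ⟧ * ⟦ b ≡? y ⟧) (pack-toList v₁) (pack-toList v₂) ⟨
    ⟦ a ≡? pack (toList v₁) ⟧ * ⟦ b ≡? pack (toList v₂) ⟧ ∎
    where
    target : ColoredPermutation
    target = m ℕ.+ n , vpack (v₁ Vec.++ v₂)
    τs : List (𝔖 (m ℕ.+ n))
    τs = filter (inConvolution? σ′ σ″) (allPermutations (m ℕ.+ n))
    term : 𝔖 (m ℕ.+ n) → ColoredPermutation
    term τ = m ℕ.+ n , τ , u′ Vec.++ u″
    v : Vec ℕ (m ℕ.+ n)
    v = Vec.map proj₁ (v₁ Vec.++ v₂)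
    std-take-v : std (Vec.take m (stdWord v)) ≡ std (Vec.map proj₁ v₁)
    std-take-v = trans (std-take m v) (cong std (trans (cong (Vec.take m) (Vec.map-++ proj₁ v₁ v₂))
      (take-++ (Vec.map proj₁ v₁) (Vec.map proj₁ v₂))))
    std-drop-v : std (Vec.drop m (stdWord v)) ≡ std (Vec.map proj₁ v₂)
    std-drop-v = trans (std-drop m v) (cong std (trans (cong (Vec.drop m) (Vec.map-++ proj₁ v₁ v₂))
      (drop-++ (Vec.map proj₁ v₁) (Vec.map proj₁ v₂))))
    main : (d : Dec (a ≡ (m , vpack v₁) × b ≡ (n , vpack v₂))) → ∑ τs (λ τ → ⟦ term τ ≡? target ⟧) ≈ ⟦ d ⟧
    main (yes (refl , refl)) = begin
      ∑ τs (λ τ → ⟦ term τ ≡? target ⟧)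
        -- Only `τ = std v` can give `target`, and the list of permutations has no repetitions.
        ≈⟨ ∑-unique (Unique.filter⁺ (inConvolution? σ′ σ″) (allPermutations-unique (m ℕ.+ n)))
             (Mem.∈-filter⁺ (inConvolution? σ′ σ″) (∈-allPermutations (std v)) (std-take-v , std-drop-v))
             (λ {τ} _ τ≢ → ⟦⟧-false (term τ ≡? target) (τ≢ ∘ proj₁ ∘ colored-injective)) ⟩
      ⟦ term (std v) ≡? target ⟧
        ≈⟨ ⟦⟧-true (term (std v) ≡? target) (cong (λ u → m ℕ.+ n , std v , u) (sym (Vec.map-++ proj₂ v₁ v₂))) ⟩
      1# ∎
    main (no ¬eq) = ∑-ε τs λ {τ} τ∈ → ⟦⟧-false (term τ ≡? target) λ eq →
      ¬eq (equal τ (proj₂ (Mem.∈-filter⁻ (inConvolution? σ′ σ″) {xs = allPermutations (m ℕ.+ n)} τ∈)) eq)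
      where
      equal : ∀ τ → InConvolution σ′ σ″ τ → term τ ≡ target → a ≡ (m , vpack v₁) × b ≡ (n , vpack v₂)
      equal τ (eq₁ , eq₂) eq =
        cong₂ (λ σ u → m , σ , u) (trans (sym eq₁) (trans (cong (std ∘ Vec.take m) word≡) std-take-v)) (proj₁ colors) ,
        cong₂ (λ σ u → n , σ , u) (trans (sym eq₂) (trans (cong (std ∘ Vec.drop m) word≡) std-drop-v)) (proj₂ colors)
        where
        word≡ : word τ ≡ stdWord v
        word≡ = cong word (proj₁ (colored-injective eq))
        colors : u′ ≡ Vec.map proj₂ v₁ × u″ ≡ Vec.map proj₂ v₂
        colors = Vec.++-injective u′ (Vec.map proj₂ v₁)
          (trans (proj₂ (colored-injective eq)) (Vec.map-++ proj₂ v₁ v₂))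

  size-productG : ∀ a b c → size c ≢ size a ℕ.+ size b → coeff (productG a b) c ≈ 0#
  size-productG a@(m , σ′ , u′) b@(n , σ″ , u″) c ne = K.trans
    (coeff-∑ (filter (inConvolution? σ′ σ″) (allPermutations (m ℕ.+ n))) _ c)
    (∑-ε (filter (inConvolution? σ′ σ″) (allPermutations (m ℕ.+ n))) λ {τ} _ →
      K.trans (coeff-G _ c) (⟦⟧-false (_ ≡? c) λ eq → ne (sym (cong size eq))))

  -- Lengths decide: if `w` does not have length `size a + size b`, both sides vanish, and otherwise
  -- only the split after `size a` letters can satisfy the first bracket.
  coeff-productG : ∀ a b w → coeff (productG a b) (pack w) ≈
                   ∑ (splits w) (λ (u , v) → ⟦ a ≡? pack u ⟧ * ⟦ b ≡? pack v ⟧)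
  coeff-productG a b w with length w ℕ.≟ size a ℕ.+ size b
  ... | no ne = K.trans (size-productG a b (pack w) ne) (K.sym (∑-ε (splits w) λ {(u , v)} uv∈ →
      K.trans (K.sym (⟦⟧-× (a ≡? pack u) (b ≡? pack v))) (⟦⟧-false ((a ≡? pack u) ×-dec (b ≡? pack v))
        λ (eq₁ , eq₂) → ne (trans (cong length (sym (splits-++ w uv∈)))
          (trans (List.length-++ u) (cong₂ ℕ._+_ (sym (cong size eq₁)) (sym (cong size eq₂))))))))
  ... | yes len with vectorOf w len
  ...   | v , refl with Vec.splitAt (size a) v
  ...     | v₁ , v₂ , refl = begin
    coeff (productG a b) (pack (toList (v₁ Vec.++ v₂)))
      ≡⟨ cong (coeff (productG a b) ∘ pack) (Vec.toList-++ v₁ v₂) ⟩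
    coeff (productG a b) (pack (toList v₁ ++ toList v₂))
      ≈⟨ coeff-productG-++ a b v₁ v₂ ⟩
    ⟦ a ≡? pack (toList v₁) ⟧ * ⟦ b ≡? pack (toList v₂) ⟧
      ≈⟨ ∑-splits-length (toList v₁) (λ u v → ⟦ a ≡? pack u ⟧ * ⟦ b ≡? pack v ⟧) (λ {u} _ ne →
           K.trans (K.*-congʳ (⟦⟧-false (a ≡? pack u) λ eq →
             ne (trans (sym (cong size eq)) (sym (Vec.length-toList v₁))))) (K.zeroˡ _)) ⟨
    ∑ (splits (toList v₁ ++ toList v₂)) (λ (u , v) → ⟦ a ≡? pack u ⟧ * ⟦ b ≡? pack v ⟧)
      ≡⟨ cong (λ w → ∑ (splits w) _) (Vec.toList-++ v₁ v₂) ⟨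
    ∑ (splits (toList (v₁ Vec.++ v₂))) (λ (u , v) → ⟦ a ≡? pack u ⟧ * ⟦ b ≡? pack v ⟧) ∎

  coeff-· : ∀ x y w → coeff (x · y) (pack w) ≈ ∑ (splits w) (λ (u , v) → coeff x (pack u) * coeff y (pack v))
  coeff-· x y w = begin
    coeff (x · y) (pack w)
      ≈⟨ coeff-linear _ x (pack w) ⟩
    ∑ x (λ (k , a) → k * coeff (linear fqsymModule (productG a) y) (pack w))
      ≈⟨ ∑-cong x (λ (k , a) → begin
           k * coeff (linear fqsymModule (productG a) y) (pack w)
             ≈⟨ K.*-congˡ (coeff-linear (productG a) y (pack w)) ⟩
           k * ∑ y (λ (k′ , b) → k′ * coeff (productG a b) (pack w))
             ≈⟨ *-distribˡ-∑ k y _ ⟩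
           ∑ y (λ (k′ , b) → k * (k′ * coeff (productG a b) (pack w)))
             ≈⟨ ∑-cong y (λ (k′ , b) → begin
                  k * (k′ * coeff (productG a b) (pack w))
                    ≈⟨ K.*-assoc k k′ _ ⟨
                  (k * k′) * coeff (productG a b) (pack w)
                    ≈⟨ K.*-congˡ (coeff-productG a b w) ⟩
                  (k * k′) * ∑ (splits w) (λ (u , v) → ⟦ a ≡? pack u ⟧ * ⟦ b ≡? pack v ⟧)
                    ≈⟨ *-distribˡ-∑ (k * k′) (splits w) _ ⟩
                  ∑ (splits w) (λ (u , v) → (k * k′) * (⟦ a ≡? pack u ⟧ * ⟦ b ≡? pack v ⟧))
                    ≈⟨ ∑-cong (splits w) (λ (u , v) → *-interchange k k′ _ _) ⟩
                  ∑ (splits w) (λ (u , v) → (k * ⟦ a ≡? pack u ⟧) * (k′ * ⟦ b ≡? pack v ⟧)) ∎) ⟩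
           ∑ y (λ (k′ , b) → ∑ (splits w) (λ (u , v) → (k * ⟦ a ≡? pack u ⟧) * (k′ * ⟦ b ≡? pack v ⟧)))
             ≈⟨ ∑-swap y (splits w) _ ⟩
           ∑ (splits w) (λ (u , v) → ∑ y (λ (k′ , b) → (k * ⟦ a ≡? pack u ⟧) * (k′ * ⟦ b ≡? pack v ⟧))) ∎) ⟩
    ∑ x (λ (k , a) → ∑ (splits w) (λ (u , v) → ∑ y (λ (k′ , b) → (k * ⟦ a ≡? pack u ⟧) * (k′ * ⟦ b ≡? pack v ⟧))))
      ≈⟨ ∑-swap x (splits w) _ ⟩
    ∑ (splits w) (λ (u , v) → ∑ x (λ (k , a) → ∑ y (λ (k′ , b) → (k * ⟦ a ≡? pack u ⟧) * (k′ * ⟦ b ≡? pack v ⟧))))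
      ≈⟨ ∑-cong (splits w) (λ (u , v) → K.trans
           (K.sym (∑-*-∑ x y (λ (k , a) → k * ⟦ a ≡? pack u ⟧) (λ (k′ , b) → k′ * ⟦ b ≡? pack v ⟧)))
           (K.sym (K.*-cong (coeff-coefficient x (pack u)) (coeff-coefficient y (pack v))))) ⟩
    ∑ (splits w) (λ (u , v) → coeff x (pack u) * coeff y (pack v)) ∎

  -- Comparing nested restrictions by computation is too expensive, so they
  -- are kept folded.
  opaque
    slice : ℕ → ℕ → ColoredPermutation → ColoredPermutation
    slice = restrictᶜ

    slice≡restrict : ∀ a b c → slice a b c ≡ restrict a b c
    slice≡restrict a b c = refl

    size-slice : ∀ {i j} c → j ≤ size c → size (slice (suc i) j c) ≡ j ℕ.∸ i
    size-slice {i} {j} = size-restrict {i} {j}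

    slice-all : ∀ c → slice 1 (size c) c ≡ c
    slice-all = restrict-all

    slice-slice : ∀ i p {q j} c → i ℕ.+ q ≤ j → j ≤ size c →
      slice (suc p) q (slice (suc i) j c) ≡ slice (suc (i ℕ.+ p)) (i ℕ.+ q) c
    slice-slice = restrict-restrict

    ∈-shuffles⇒slice : ∀ c p q → letters c ∈ shuffles (letters p) (shift (size p) (letters q)) →
      size p ≤ size c × slice 1 (size p) c ≡ p × slice (suc (size p)) (size c) c ≡ q
    ∈-shuffles⇒slice = ∈-shuffles⇒restrict

    slice⇒∈-shuffles : ∀ {i} c → i ≤ size c →
      letters c ∈ shuffles (letters (slice 1 i c)) (shift i (letters (slice (suc i) (size c) c)))
    slice⇒∈-shuffles = restrict⇒∈-shuffles

  -- Tensors over the free module are determined by their coefficients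

  F⊗F : RawModule _ _
  F⊗F = fqsymModule ⊗ fqsymModule

  infix 4 _≈ᵀᵀ_
  _≈ᵀᵀ_ : Tensors fqsymModule fqsymModule → Tensors fqsymModule fqsymModule → Set _
  _≈ᵀᵀ_ = _≈⊗_ fqsymModule fqsymModule

  F⊗F-isModule : IsModule F⊗F
  F⊗F-isModule = ⊗-isModule fqsym-isModule fqsym-isModule

  module T = Module F⊗F-isModule

  coeff⊗ : Tensors fqsymModule fqsymModule → ColoredPermutation → ColoredPermutation → K.Carrier
  coeff⊗ t p q = ∑ t (λ (x , y) → coeff x p * coeff y q)

  linear-G : ∀ x b → coeff x b ≈ coeff (linear fqsymModule G x) b
  linear-G x b = K.trans (coeff-coefficient x b)
    (K.sym (K.trans (coeff-linear G x b) (∑-cong x (λ (k , a) → K.*-congˡ (coeff-G a b)))))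

  abstract
    _≡?₂_ : DecidableEquality (ColoredPermutation × ColoredPermutation)
    _≡?₂_ = Product.≡-dec _≡?_ _≡?_

  module Free₂ = Free _≡?₂_

  product₂ : K.Carrier × ColoredPermutation → K.Carrier × ColoredPermutation →
             K.Carrier × (ColoredPermutation × ColoredPermutation)
  product₂ (k , a) (k′ , b) = k * k′ , (a , b)

  -- On representatives, the isomorphism from the tensor square to the free module on pairs of
  -- colored permutations; its inverse is `T.extend G⊗G`.
  expand : Tensors fqsymModule fqsymModule → Free₂.Formal
  expand = concatMap (λ (x , y) → cartesianProductWith product₂ x y)

  coefficient-expand : ∀ t p q → Free₂.coefficient (expand t) (p , q) ≈ coeff⊗ t p q
  coefficient-expand t p q = begin
    Free₂.coefficient (expand t) (p , q)
      ≈⟨ ∑-concatMap (λ (x , y) → cartesianProductWith product₂ x y) t _ ⟩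
    ∑ t (λ (x , y) → ∑ (cartesianProductWith product₂ x y) (λ (k , ab) → k * ⟦ ab ≡?₂ (p , q) ⟧))
      ≈⟨ ∑-cong t (λ (x , y) → ∑-cartesianProductWith product₂ x y (λ (k , ab) → k * ⟦ ab ≡?₂ (p , q) ⟧)) ⟩
    ∑ t (λ (x , y) → ∑ x (λ (k , a) → ∑ y (λ (k′ , b) → (k * k′) * ⟦ (a , b) ≡?₂ (p , q) ⟧)))
      ≈⟨ ∑-cong t (λ (x , y) → begin
           ∑ x (λ (k , a) → ∑ y (λ (k′ , b) → (k * k′) * ⟦ (a , b) ≡?₂ (p , q) ⟧))
             ≈⟨ ∑-cong x (λ (k , a) → ∑-cong y (λ (k′ , b) → begin
                  (k * k′) * ⟦ (a , b) ≡?₂ (p , q) ⟧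
                    ≈⟨ K.*-congˡ (⟦⟧-cong ((a , b) ≡?₂ (p , q)) ((a ≡? p) ×-dec (b ≡? q))
                         (λ { refl → refl , refl }) (λ (eq₁ , eq₂) → cong₂ _,_ eq₁ eq₂)) ⟩
                  (k * k′) * ⟦ (a ≡? p) ×-dec (b ≡? q) ⟧
                    ≈⟨ K.*-congˡ (⟦⟧-× (a ≡? p) (b ≡? q)) ⟩
                  (k * k′) * (⟦ a ≡? p ⟧ * ⟦ b ≡? q ⟧)
                    ≈⟨ *-interchange k k′ _ _ ⟩
                  (k * ⟦ a ≡? p ⟧) * (k′ * ⟦ b ≡? q ⟧) ∎)) ⟩
           ∑ x (λ (k , a) → ∑ y (λ (k′ , b) → (k * ⟦ a ≡? p ⟧) * (k′ * ⟦ b ≡? q ⟧)))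
             ≈⟨ ∑-*-∑ x y _ _ ⟨
           coefficient x p * coefficient y q
             ≈⟨ K.*-cong (coeff-coefficient x p) (coeff-coefficient y q) ⟨
           coeff x p * coeff y q ∎) ⟩
    coeff⊗ t p q ∎

  G⊗G : ColoredPermutation × ColoredPermutation → Tensors fqsymModule fqsymModule
  G⊗G (a , b) = (G a , G b) ∷ []

  -- Both factors are written in the basis `G`, and `⊗-scale` gathers the two scalars on the left.
  ⊗-expand : ∀ x y → ((x , y) ∷ []) ≈ᵀᵀ T.∑ᴹ x (λ (k , a) → T.∑ᴹ y (λ (k′ , b) → (k * k′) T.*ₗ G⊗G (a , b)))
  ⊗-expand x y = ≈⊗-trans (⊗-cong {x = x} {x′ = linear fqsymModule G x} {y = y} {y′ = y} (linear-G x) (λ _ → K.refl))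
    (≈⊗-trans (⊗-∑ˡ fqsym-isModule fqsym-isModule x (λ (k , a) → k *ₗ G a) y)
    (T.∑ᴹ-cong x (λ (k , a) → ≈⊗-trans
      (⊗-cong {x = k *ₗ G a} {x′ = k *ₗ G a} {y = y} {y′ = linear fqsymModule G y} (λ _ → K.refl) (linear-G y))
      (≈⊗-trans (⊗-∑ʳ fqsym-isModule fqsym-isModule (k *ₗ G a) y (λ (k′ , b) → k′ *ₗ G b))
      (T.∑ᴹ-cong y (λ (k′ , b) → ≈⊗-trans (≈⊗-sym (⊗-scale k′ (k *ₗ G a) (G b)))
        (⊗-cong {x = k′ *ₗ k *ₗ G a} {x′ = (k * k′) *ₗ G a} {y = G b} {y′ = G b} (scalars k k′ (G a)) (λ _ → K.refl))))))))
    where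
    scalars : ∀ k k′ z b → coeff (k′ *ₗ k *ₗ z) b ≈ coeff ((k * k′) *ₗ z) b
    scalars k k′ z b = begin
      coeff (k′ *ₗ k *ₗ z) b     ≈⟨ coeff-scale k′ (k *ₗ z) b ⟩
      k′ * coeff (k *ₗ z) b      ≈⟨ K.*-congˡ (coeff-scale k z b) ⟩
      k′ * (k * coeff z b)       ≈⟨ x∙yz≈y∙xz k′ k _ ⟩
      k * (k′ * coeff z b)       ≈⟨ K.*-assoc k k′ _ ⟨
      (k * k′) * coeff z b       ≈⟨ coeff-scale (k * k′) z b ⟨
      coeff ((k * k′) *ₗ z) b    ∎

  extend-expand : ∀ t → T.extend G⊗G (expand t) ≈ᵀᵀ t
  extend-expand []            = ≈⊗-refl
  extend-expand ((x , y) ∷ t) = ≈⊗-trans (T.∑ᴹ-++ (cartesianProductWith product₂ x y) (expand t) _)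
    (++-cong (≈⊗-trans (Summation.∑-cartesianProductWith T.+ᴹ-commutativeMonoid product₂ x y _) (≈⊗-sym (⊗-expand x y)))
             (extend-expand t))

  -- A tensor is recovered from its expansion over pairs of basis elements, and in that free module
  -- `extend-cong` turns equal coefficients into equal values. Identities of tensors thus need no
  -- explicit derivation from the generating rules.
  tensor-ext : ∀ s t → (∀ p q → coeff⊗ s p q ≈ coeff⊗ t p q) → s ≈ᵀᵀ t
  tensor-ext s t s≈t = ≈⊗-trans (≈⊗-sym (extend-expand s))
    (≈⊗-trans (Free₂.extend-cong F⊗F-isModule G⊗G (expand s) (expand t)
      (λ (p , q) → K.trans (coefficient-expand s p q) (K.trans (s≈t p q) (K.sym (coefficient-expand t p q)))))
    (extend-expand t))

  -- Coefficients of coproducts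

  coeff⊗-∑ : ∀ (xs : List A) f p q → coeff⊗ (sum F⊗F (map f xs)) p q ≈ ∑ xs (λ x → coeff⊗ (f x) p q)
  coeff⊗-∑ []       f p q = K.refl
  coeff⊗-∑ (x ∷ xs) f p q = K.trans (∑-++ (f x) (sum F⊗F (map f xs)) _) (K.+-congˡ (coeff⊗-∑ xs f p q))

  coeff⊗-scale : ∀ k t p q → coeff⊗ (k T.*ₗ t) p q ≈ k * coeff⊗ t p q
  coeff⊗-scale k t p q = begin
    coeff⊗ (k T.*ₗ t) p q                                    ≡⟨ ∑-map _ t _ ⟩
    ∑ t (λ (x , y) → coeff (k *ₗ x) p * coeff y q)           ≈⟨ ∑-cong t (λ (x , y) → K.trans (K.*-congʳ (coeff-scale k x p)) (K.*-assoc k _ _)) ⟩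
    ∑ t (λ (x , y) → k * (coeff x p * coeff y q))            ≈⟨ *-distribˡ-∑ k t _ ⟨
    k * coeff⊗ t p q                                         ∎

  ΔG : ColoredPermutation → Tensors fqsymModule fqsymModule
  ΔG a = sum F⊗F (map (λ i → G⊗G (slice 1 i a , slice (suc i) (size a) a)) (upTo (suc (size a))))

  Δ≡ : ∀ x → Δ x ≡ linear F⊗F ΔG x
  Δ≡ x = cong (sum F⊗F) (List.map-cong (λ (k , a) → cong (λ t → k T.*ₗ sum F⊗F t)
    (List.map-cong (λ i → cong₂ (λ p q → G⊗G (p , q))
      (sym (slice≡restrict 1 i a)) (sym (slice≡restrict (suc i) (size a) a))) (upTo (suc (size a))))) x)

  -- Each side has at most one nonzero term: the cut at `size p` on the left, the word `letters a`
  -- on the right. Both occur under the same condition, by the correspondence between restrictions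
  -- and shuffles.
  coeff⊗-ΔG : ∀ a p q → coeff⊗ (ΔG a) p q ≈
    ∑ (shuffles (letters p) (shift (size p) (letters q))) (λ w → ⟦ a ≡? pack w ⟧)
  coeff⊗-ΔG a p q = begin
    coeff⊗ (ΔG a) p q
      ≈⟨ coeff⊗-∑ (upTo (suc (size a))) (λ i → G⊗G (slice 1 i a , slice (suc i) (size a) a)) p q ⟩
    ∑ (upTo (suc (size a))) (λ i → coeff⊗ (G⊗G (slice 1 i a , slice (suc i) (size a) a)) p q)
      ≈⟨ ∑-cong (upTo (suc (size a))) (λ i → begin
           coeff (G (slice 1 i a)) p * coeff (G (slice (suc i) (size a) a)) q + 0#
             ≈⟨ K.+-identityʳ _ ⟩
           coeff (G (slice 1 i a)) p * coeff (G (slice (suc i) (size a) a)) q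
             ≈⟨ K.*-cong (coeff-G (slice 1 i a) p) (coeff-G (slice (suc i) (size a) a) q) ⟩
           ⟦ slice 1 i a ≡? p ⟧ * ⟦ slice (suc i) (size a) a ≡? q ⟧
             ≈⟨ ⟦⟧-× (slice 1 i a ≡? p) (slice (suc i) (size a) a ≡? q) ⟨
           ⟦ (slice 1 i a ≡? p) ×-dec (slice (suc i) (size a) a ≡? q) ⟧ ∎) ⟩
    ∑ (upTo (suc (size a))) (λ i → ⟦ cut i ⟧)
      -- The bound belongs to the case distinction because the cut at `k` occurs in the sum only if
      -- `k ≤ size a`.
      ≈⟨ main ((k ℕ.≤? size a) ×-dec cut k) ⟩
    ∑ S (λ w → ⟦ a ≡? pack w ⟧) ∎
    where
    k = size p
    S = shuffles (letters p) (shift k (letters q))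
    cut : ∀ i → Dec (slice 1 i a ≡ p × slice (suc i) (size a) a ≡ q)
    cut i = (slice 1 i a ≡? p) ×-dec (slice (suc i) (size a) a ≡? q)
    size≡ : ∀ {i} → i ∈ upTo (suc (size a)) → slice 1 i a ≡ p → i ≡ k
    size≡ i∈ eq = trans (sym (size-slice {0} a (ℕ.≤-pred (Mem.∈-upTo⁻ i∈)))) (cong size eq)
    main : Dec (k ≤ size a × slice 1 k a ≡ p × slice (suc k) (size a) a ≡ q) →
           ∑ (upTo (suc (size a))) (λ i → ⟦ cut i ⟧) ≈ ∑ S (λ w → ⟦ a ≡? pack w ⟧)
    main (yes (k≤n , eq)) = begin
      ∑ (upTo (suc (size a))) (λ i → ⟦ cut i ⟧)
        ≈⟨ ∑-unique (Unique.upTo⁺ (suc (size a))) (Mem.∈-upTo⁺ (s≤s k≤n))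
             (λ {i} i∈ i≢k → ⟦⟧-false (cut i) (i≢k ∘ size≡ i∈ ∘ proj₁)) ⟩
      ⟦ cut k ⟧
        ≈⟨ ⟦⟧-true (cut k) eq ⟩
      1#
        ≈⟨ ⟦⟧-true (a ≡? pack (letters a)) (sym (pack-letters a)) ⟨
      ⟦ a ≡? pack (letters a) ⟧
        ≈⟨ ∑-unique (shuffles-letters-unique p q) a∈S
             (λ {w} w∈ w≢ → ⟦⟧-false (a ≡? pack w) λ a≡ →
               w≢ (trans (sym (shuffles-letters-pack p q w∈)) (cong letters (sym a≡)))) ⟨
      ∑ S (λ w → ⟦ a ≡? pack w ⟧) ∎
      where
      a∈S : letters a ∈ S
      a∈S = subst (λ r → letters a ∈ shuffles (letters p) (shift k (letters r))) (proj₂ eq)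
        (subst (λ r → letters a ∈ shuffles (letters r) (shift k (letters (slice (suc k) (size a) a)))) (proj₁ eq)
          (slice⇒∈-shuffles a k≤n))
    main (no ¬eq) = K.trans
      (∑-ε (upTo (suc (size a))) λ {i} i∈ → ⟦⟧-false (cut i) λ eq →
        ¬eq (subst (λ i → i ≤ size a × slice 1 i a ≡ p × slice (suc i) (size a) a ≡ q) (size≡ i∈ (proj₁ eq))
          (ℕ.≤-pred (Mem.∈-upTo⁻ i∈) , eq)))
      (K.sym (∑-ε S λ {w} w∈ → ⟦⟧-false (a ≡? pack w) λ a≡ →
        ¬eq (∈-shuffles⇒slice a p q (subst (_∈ S)
          (trans (sym (shuffles-letters-pack p q w∈)) (cong letters (sym a≡))) w∈))))

  -- `map-pack-shuffles` carries the formula from standardized words to all words with `u` below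
  -- `v`. This generality is what allows it to be applied to pieces of words.
  coeff⊗-Δ : ∀ x u v → (∀ {i j} → i ∈ u → j ∈ v → proj₁ i < proj₁ j) →
    coeff⊗ (Δ x) (pack u) (pack v) ≈ ∑ (shuffles u v) (λ w → coeff x (pack w))
  coeff⊗-Δ x u v u<v = begin
    coeff⊗ (Δ x) (pack u) (pack v)
      ≡⟨ cong (λ t → coeff⊗ t (pack u) (pack v)) (Δ≡ x) ⟩
    coeff⊗ (linear F⊗F ΔG x) (pack u) (pack v)
      ≈⟨ coeff⊗-∑ x (λ (k , a) → k T.*ₗ ΔG a) (pack u) (pack v) ⟩
    ∑ x (λ (k , a) → coeff⊗ (k T.*ₗ ΔG a) (pack u) (pack v))
      ≈⟨ ∑-cong x (λ (k , a) → begin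
           coeff⊗ (k T.*ₗ ΔG a) (pack u) (pack v)        ≈⟨ coeff⊗-scale k (ΔG a) _ _ ⟩
           k * coeff⊗ (ΔG a) (pack u) (pack v)           ≈⟨ K.*-congˡ (coeff⊗-ΔG a (pack u) (pack v)) ⟩
           k * ∑ S (λ w → ⟦ a ≡? pack w ⟧)               ≡⟨ cong (k *_) (∑-map pack S (λ b → ⟦ a ≡? b ⟧)) ⟨
           k * ∑ (map pack S) (λ b → ⟦ a ≡? b ⟧)         ≡⟨ cong (λ L → k * ∑ L (λ b → ⟦ a ≡? b ⟧)) (map-pack-shuffles u v u<v) ⟨
           k * ∑ (map pack S′) (λ b → ⟦ a ≡? b ⟧)        ≡⟨ cong (k *_) (∑-map pack S′ (λ b → ⟦ a ≡? b ⟧)) ⟩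
           k * ∑ S′ (λ w → ⟦ a ≡? pack w ⟧)              ≈⟨ *-distribˡ-∑ k S′ _ ⟩
           ∑ S′ (λ w → k * ⟦ a ≡? pack w ⟧)              ∎) ⟩
    ∑ x (λ (k , a) → ∑ S′ (λ w → k * ⟦ a ≡? pack w ⟧))
      ≈⟨ ∑-swap x S′ _ ⟩
    ∑ S′ (λ w → coefficient x (pack w))
      ≈⟨ ∑-cong S′ (λ w → coeff-coefficient x (pack w)) ⟨
    ∑ S′ (λ w → coeff x (pack w)) ∎
    where
    S = shuffles (letters (pack u)) (shift (length u) (letters (pack v)))
    S′ = shuffles u v

  coeff⊗-· : ∀ s t u v → coeff⊗ (RawAlgebra._·_ (FQSym ⊗ᴬ FQSym) s t) (pack u) (pack v) ≈
    ∑ (splits u) (λ (u₁ , u₂) → ∑ (splits v) (λ (v₁ , v₂) →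
      coeff⊗ s (pack u₁) (pack v₁) * coeff⊗ t (pack u₂) (pack v₂)))
  coeff⊗-· s t u v = begin
    coeff⊗ (RawAlgebra._·_ (FQSym ⊗ᴬ FQSym) s t) (pack u) (pack v)
      ≈⟨ ∑-cartesianProductWith _ s t _ ⟩
    ∑ s (λ (x , y) → ∑ t (λ (x′ , y′) → coeff (x · x′) (pack u) * coeff (y · y′) (pack v)))
      ≈⟨ ∑-cong s (λ (x , y) → ∑-cong t (λ (x′ , y′) → begin
           coeff (x · x′) (pack u) * coeff (y · y′) (pack v)
             ≈⟨ K.*-cong (coeff-· x x′ u) (coeff-· y y′ v) ⟩
           ∑ (splits u) (λ (u₁ , u₂) → coeff x (pack u₁) * coeff x′ (pack u₂)) *
           ∑ (splits v) (λ (v₁ , v₂) → coeff y (pack v₁) * coeff y′ (pack v₂))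
             ≈⟨ ∑-*-∑ (splits u) (splits v) _ _ ⟩
           ∑∑ (λ u₁ u₂ v₁ v₂ → (coeff x (pack u₁) * coeff x′ (pack u₂)) * (coeff y (pack v₁) * coeff y′ (pack v₂)))
             ≈⟨ ∑-cong (splits u) (λ (u₁ , u₂) → ∑-cong (splits v) (λ (v₁ , v₂) → *-interchange _ _ _ _)) ⟩
           ∑∑ (λ u₁ u₂ v₁ v₂ → (coeff x (pack u₁) * coeff y (pack v₁)) * (coeff x′ (pack u₂) * coeff y′ (pack v₂))) ∎)) ⟩
    ∑ s (λ (x , y) → ∑ t (λ (x′ , y′) → ∑∑ (λ u₁ u₂ v₁ v₂ →
      (coeff x (pack u₁) * coeff y (pack v₁)) * (coeff x′ (pack u₂) * coeff y′ (pack v₂)))))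
      ≈⟨ ∑-cong s (λ (x , y) → exchange t (λ (x′ , y′) u₁ u₂ v₁ v₂ →
           (coeff x (pack u₁) * coeff y (pack v₁)) * (coeff x′ (pack u₂) * coeff y′ (pack v₂)))) ⟩
    ∑ s (λ (x , y) → ∑∑ (λ u₁ u₂ v₁ v₂ → ∑ t (λ (x′ , y′) →
      (coeff x (pack u₁) * coeff y (pack v₁)) * (coeff x′ (pack u₂) * coeff y′ (pack v₂)))))
      ≈⟨ exchange s (λ (x , y) u₁ u₂ v₁ v₂ → ∑ t (λ (x′ , y′) →
           (coeff x (pack u₁) * coeff y (pack v₁)) * (coeff x′ (pack u₂) * coeff y′ (pack v₂)))) ⟩
    ∑∑ (λ u₁ u₂ v₁ v₂ → ∑ s (λ (x , y) → ∑ t (λ (x′ , y′) →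
      (coeff x (pack u₁) * coeff y (pack v₁)) * (coeff x′ (pack u₂) * coeff y′ (pack v₂)))))
      ≈⟨ ∑-cong (splits u) (λ (u₁ , u₂) → ∑-cong (splits v) (λ (v₁ , v₂) → K.sym (∑-*-∑ s t _ _))) ⟩
    ∑∑ (λ u₁ u₂ v₁ v₂ → coeff⊗ s (pack u₁) (pack v₁) * coeff⊗ t (pack u₂) (pack v₂)) ∎
    where
    ∑∑ : (List Letter → List Letter → List Letter → List Letter → K.Carrier) → K.Carrier
    ∑∑ f = ∑ (splits u) (λ (u₁ , u₂) → ∑ (splits v) (λ (v₁ , v₂) → f u₁ u₂ v₁ v₂))
    exchange : ∀ {a} {A : Set a} (xs : List A) (f : A → List Letter → List Letter → List Letter → List Letter → K.Carrier) →
      ∑ xs (λ x → ∑∑ (f x)) ≈ ∑∑ (λ u₁ u₂ v₁ v₂ → ∑ xs (λ x → f x u₁ u₂ v₁ v₂))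
    exchange xs f = K.trans (∑-swap xs (splits u) _) (∑-cong (splits u) (λ (u₁ , u₂) → ∑-swap xs (splits v) _))

  -- A pair `p`, `q` is represented by the word of `p` and the word of `q` raised by `size p`, so
  -- that the letters are separated. Separation passes to the pieces of the two words, and
  -- `coeff⊗-Δ` applies to both factors.
  Δ-·-homo : ∀ x y → Δ (x · y) ≈ᵀᵀ RawAlgebra._·_ (FQSym ⊗ᴬ FQSym) (Δ x) (Δ y)
  Δ-·-homo x y = tensor-ext _ _ λ p q →
    subst (λ r → coeff⊗ (Δ (x · y)) r q ≈ coeff⊗ (RawAlgebra._·_ (FQSym ⊗ᴬ FQSym) (Δ x) (Δ y)) r q) (pack-letters p)
      (subst (λ r → coeff⊗ (Δ (x · y)) (pack (letters p)) r ≈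
                    coeff⊗ (RawAlgebra._·_ (FQSym ⊗ᴬ FQSym) (Δ x) (Δ y)) (pack (letters p)) r)
        (trans (pack-shift (size p) (letters q)) (pack-letters q))
        (words (letters p) (shift (size p) (letters q)) λ i∈ j∈ → separated p q i∈ j∈))
    where
    separated : ∀ p q {i j} → i ∈ letters p → j ∈ shift (size p) (letters q) → proj₁ i < proj₁ j
    separated p q i∈ j∈ = ℕ.≤-<-trans (proj₂ (letters-bounds p i∈))
      (All.lookup {P = λ j → size p < proj₁ j} (All.map⁺ (All.tabulate λ j∈ → ℕ.m<m+n (size p) (proj₁ (letters-bounds q j∈)))) j∈)
    words : ∀ u v → (∀ {i j} → i ∈ u → j ∈ v → proj₁ i < proj₁ j) →
      coeff⊗ (Δ (x · y)) (pack u) (pack v) ≈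
      coeff⊗ (RawAlgebra._·_ (FQSym ⊗ᴬ FQSym) (Δ x) (Δ y)) (pack u) (pack v)
    words u v u<v = begin
      coeff⊗ (Δ (x · y)) (pack u) (pack v)
        ≈⟨ coeff⊗-Δ (x · y) u v u<v ⟩
      ∑ (shuffles u v) (λ w → coeff (x · y) (pack w))
        ≈⟨ ∑-cong (shuffles u v) (coeff-· x y) ⟩
      ∑ (shuffles u v) (λ w → ∑ (splits w) (λ (w₁ , w₂) → coeff x (pack w₁) * coeff y (pack w₂)))
        ≈⟨ ∑-shuffles-splits u v (λ w₁ w₂ → coeff x (pack w₁) * coeff y (pack w₂)) ⟩
      ∑ (splits u) (λ (u₁ , u₂) → ∑ (splits v) (λ (v₁ , v₂) →
        ∑ (shuffles u₁ v₁) (λ w₁ → ∑ (shuffles u₂ v₂) (λ w₂ → coeff x (pack w₁) * coeff y (pack w₂)))))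
        ≈⟨ ∑-cong-∈ (splits u) (λ {(u₁ , u₂)} u∈ → ∑-cong-∈ (splits v) (λ {(v₁ , v₂)} v∈ → begin
             ∑ (shuffles u₁ v₁) (λ w₁ → ∑ (shuffles u₂ v₂) (λ w₂ → coeff x (pack w₁) * coeff y (pack w₂)))
               ≈⟨ ∑-*-∑ (shuffles u₁ v₁) (shuffles u₂ v₂) _ _ ⟨
             ∑ (shuffles u₁ v₁) (λ w₁ → coeff x (pack w₁)) * ∑ (shuffles u₂ v₂) (λ w₂ → coeff y (pack w₂))
               ≈⟨ K.*-cong
                    (coeff⊗-Δ x u₁ v₁ (λ i∈ j∈ → u<v (left u₁ (splits-++ u u∈) i∈) (left v₁ (splits-++ v v∈) j∈)))
                    (coeff⊗-Δ y u₂ v₂ (λ i∈ j∈ → u<v (right u₁ (splits-++ u u∈) i∈) (right v₁ (splits-++ v v∈) j∈))) ⟨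
             coeff⊗ (Δ x) (pack u₁) (pack v₁) * coeff⊗ (Δ y) (pack u₂) (pack v₂) ∎)) ⟩
      ∑ (splits u) (λ (u₁ , u₂) → ∑ (splits v) (λ (v₁ , v₂) →
        coeff⊗ (Δ x) (pack u₁) (pack v₁) * coeff⊗ (Δ y) (pack u₂) (pack v₂)))
        ≈⟨ coeff⊗-· (Δ x) (Δ y) u v ⟨
      coeff⊗ (RawAlgebra._·_ (FQSym ⊗ᴬ FQSym) (Δ x) (Δ y)) (pack u) (pack v) ∎
      where
      left : ∀ (w₁ : List Letter) {w₂ w i} → w₁ ++ w₂ ≡ w → i ∈ w₁ → i ∈ w
      left w₁ refl i∈ = Mem.∈-++⁺ˡ i∈
      right : ∀ (w₁ : List Letter) {w₂ w i} → w₁ ++ w₂ ≡ w → i ∈ w₂ → i ∈ w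
      right w₁ refl i∈ = Mem.∈-++⁺ʳ w₁ i∈

  open IntervalConvolution size slice (pack []) size0 size-slice slice-all slice-slice

  -- The algebra

  -- Every colored permutation is the standardization of its own word, so the formula for products
  -- on words suffices to compare elements.
  ≈ᴹ-ext : ∀ x y → (∀ w → coeff x (pack w) ≈ coeff y (pack w)) → x ≈ᴹ y
  ≈ᴹ-ext x y x≈y b = subst (λ b → coeff x b ≈ coeff y b) (pack-letters b) (x≈y (letters b))

  coeff-1-∷ : ∀ i w → coeff 1ᴬ (pack (i ∷ w)) ≈ 0#
  coeff-1-∷ i w = K.trans (coeff-G (pack []) (pack (i ∷ w)))
    (⟦⟧-false (pack [] ≡? pack (i ∷ w)) λ eq → ℕ.1+n≢0 (sym (cong size eq)))

  coeff-1-[] : coeff 1ᴬ (pack []) ≈ 1#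
  coeff-1-[] = K.trans (coeff-G (pack []) (pack [])) (⟦⟧-true (pack [] ≡? pack []) refl)

  ·-cong : ∀ x x′ y y′ → x ≈ᴹ x′ → y ≈ᴹ y′ → (x · y) ≈ᴹ (x′ · y′)
  ·-cong x x′ y y′ x≈ y≈ = ≈ᴹ-ext (x · y) (x′ · y′) λ w → K.trans (coeff-· x y w)
    (K.trans (∑-cong (splits w) (λ (u , v) → K.*-cong (x≈ (pack u)) (y≈ (pack v)))) (K.sym (coeff-· x′ y′ w)))

  ·-assoc : ∀ x y z → ((x · y) · z) ≈ᴹ (x · (y · z))
  ·-assoc x y z = ≈ᴹ-ext ((x · y) · z) (x · (y · z)) λ w → begin
    coeff ((x · y) · z) (pack w)
      ≈⟨ coeff-· (x · y) z w ⟩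
    ∑ (splits w) (λ (u , v) → coeff (x · y) (pack u) * coeff z (pack v))
      ≈⟨ ∑-cong (splits w) (λ (u , v) → K.trans (K.*-congʳ (coeff-· x y u))
           (K.trans (*-distribʳ-∑ _ (splits u) _) (∑-cong (splits u) (λ (u₁ , u₂) → K.*-assoc _ _ _)))) ⟩
    ∑ (splits w) (λ (u , v) → ∑ (splits u) (λ (u₁ , u₂) →
      coeff x (pack u₁) * (coeff y (pack u₂) * coeff z (pack v))))
      ≈⟨ ∑-splits-assoc w (λ r s t → coeff x (pack r) * (coeff y (pack s) * coeff z (pack t))) ⟩
    ∑ (splits w) (λ (u , v) → ∑ (splits v) (λ (v₁ , v₂) →
      coeff x (pack u) * (coeff y (pack v₁) * coeff z (pack v₂))))
      ≈⟨ ∑-cong (splits w) (λ (u , v) → K.trans (K.*-congˡ (coeff-· y z v)) (*-distribˡ-∑ _ (splits v) _)) ⟨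
    ∑ (splits w) (λ (u , v) → coeff x (pack u) * coeff (y · z) (pack v))
      ≈⟨ coeff-· x (y · z) w ⟨
    coeff (x · (y · z)) (pack w) ∎

  ·-identityˡ : ∀ x → (1ᴬ · x) ≈ᴹ x
  ·-identityˡ x = ≈ᴹ-ext (1ᴬ · x) x λ w → begin
    coeff (1ᴬ · x) (pack w)
      ≈⟨ coeff-· 1ᴬ x w ⟩
    ∑ (splits w) (λ (u , v) → coeff 1ᴬ (pack u) * coeff x (pack v))
      ≈⟨ ∑-splits-length [] (λ u v → coeff 1ᴬ (pack u) * coeff x (pack v)) vanish ⟩
    coeff 1ᴬ (pack []) * coeff x (pack w)
      ≈⟨ K.trans (K.*-congʳ coeff-1-[]) (K.*-identityˡ _) ⟩
    coeff x (pack w) ∎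
    where
    vanish : ∀ {u v w : List Letter} → u ++ v ≡ w → length u ≢ 0 → coeff 1ᴬ (pack u) * coeff x (pack v) ≈ 0#
    vanish {[]}    _ ne = contradiction refl ne
    vanish {i ∷ u} _ _  = K.trans (K.*-congʳ (coeff-1-∷ i u)) (K.zeroˡ _)

  ·-identityʳ : ∀ x → (x · 1ᴬ) ≈ᴹ x
  ·-identityʳ x = ≈ᴹ-ext (x · 1ᴬ) x λ w → begin
    coeff (x · 1ᴬ) (pack w)
      ≈⟨ coeff-· x 1ᴬ w ⟩
    ∑ (splits w) (λ (u , v) → coeff x (pack u) * coeff 1ᴬ (pack v))
      ≡⟨ cong (λ w → ∑ (splits w) (λ (u , v) → coeff x (pack u) * coeff 1ᴬ (pack v))) (List.++-identityʳ w) ⟨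
    ∑ (splits (w ++ [])) (λ (u , v) → coeff x (pack u) * coeff 1ᴬ (pack v))
      ≈⟨ ∑-splits-length w (λ u v → coeff x (pack u) * coeff 1ᴬ (pack v)) vanish ⟩
    coeff x (pack w) * coeff 1ᴬ (pack [])
      ≈⟨ K.trans (K.*-congˡ coeff-1-[]) (K.*-identityʳ _) ⟩
    coeff x (pack w) ∎
    where
    vanish : ∀ {u v w : List Letter} → u ++ v ≡ w ++ [] → length u ≢ length w → coeff x (pack u) * coeff 1ᴬ (pack v) ≈ 0#
    vanish {u} {[]}    eq ne = contradiction (cong length (List.++-cancelʳ [] u _ eq)) ne
    vanish {u} {i ∷ v} _  _  = K.trans (K.*-congˡ (coeff-1-∷ i v)) (K.zeroʳ _)

  ·-distribˡ : ∀ x y z → (x · (y ++ z)) ≈ᴹ ((x · y) ++ (x · z))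
  ·-distribˡ x y z = ≈ᴹ-ext (x · (y ++ z)) ((x · y) ++ (x · z)) λ w → begin
    coeff (x · (y ++ z)) (pack w)
      ≈⟨ coeff-· x (y ++ z) w ⟩
    ∑ (splits w) (λ (u , v) → coeff x (pack u) * coeff (y ++ z) (pack v))
      ≈⟨ ∑-cong (splits w) (λ (u , v) → K.trans (K.*-congˡ (coeff-++ y z (pack v))) (K.distribˡ _ _ _)) ⟩
    ∑ (splits w) (λ (u , v) → coeff x (pack u) * coeff y (pack v) + coeff x (pack u) * coeff z (pack v))
      ≈⟨ ∑-∙ (splits w) _ _ ⟩
    ∑ (splits w) (λ (u , v) → coeff x (pack u) * coeff y (pack v)) +
    ∑ (splits w) (λ (u , v) → coeff x (pack u) * coeff z (pack v))
      ≈⟨ K.+-cong (coeff-· x y w) (coeff-· x z w) ⟨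
    coeff (x · y) (pack w) + coeff (x · z) (pack w)
      ≈⟨ coeff-++ (x · y) (x · z) (pack w) ⟨
    coeff ((x · y) ++ (x · z)) (pack w) ∎

  ·-distribʳ : ∀ x y z → ((y ++ z) · x) ≈ᴹ ((y · x) ++ (z · x))
  ·-distribʳ x y z = ≈ᴹ-ext ((y ++ z) · x) ((y · x) ++ (z · x)) λ w → begin
    coeff ((y ++ z) · x) (pack w)
      ≈⟨ coeff-· (y ++ z) x w ⟩
    ∑ (splits w) (λ (u , v) → coeff (y ++ z) (pack u) * coeff x (pack v))
      ≈⟨ ∑-cong (splits w) (λ (u , v) → K.trans (K.*-congʳ (coeff-++ y z (pack u))) (K.distribʳ _ _ _)) ⟩
    ∑ (splits w) (λ (u , v) → coeff y (pack u) * coeff x (pack v) + coeff z (pack u) * coeff x (pack v))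
      ≈⟨ ∑-∙ (splits w) _ _ ⟩
    ∑ (splits w) (λ (u , v) → coeff y (pack u) * coeff x (pack v)) +
    ∑ (splits w) (λ (u , v) → coeff z (pack u) * coeff x (pack v))
      ≈⟨ K.+-cong (coeff-· y x w) (coeff-· z x w) ⟨
    coeff (y · x) (pack w) + coeff (z · x) (pack w)
      ≈⟨ coeff-++ (y · x) (z · x) (pack w) ⟨
    coeff ((y · x) ++ (z · x)) (pack w) ∎

  ·-scaleˡ : ∀ k x y → ((k *ₗ x) · y) ≈ᴹ (k *ₗ (x · y))
  ·-scaleˡ k x y = ≈ᴹ-ext ((k *ₗ x) · y) (k *ₗ (x · y)) λ w → begin
    coeff ((k *ₗ x) · y) (pack w)
      ≈⟨ coeff-· (k *ₗ x) y w ⟩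
    ∑ (splits w) (λ (u , v) → coeff (k *ₗ x) (pack u) * coeff y (pack v))
      ≈⟨ ∑-cong (splits w) (λ (u , v) → K.trans (K.*-congʳ (coeff-scale k x (pack u))) (K.*-assoc k _ _)) ⟩
    ∑ (splits w) (λ (u , v) → k * (coeff x (pack u) * coeff y (pack v)))
      ≈⟨ *-distribˡ-∑ k (splits w) _ ⟨
    k * ∑ (splits w) (λ (u , v) → coeff x (pack u) * coeff y (pack v))
      ≈⟨ K.*-congˡ (coeff-· x y w) ⟨
    k * coeff (x · y) (pack w)
      ≈⟨ coeff-scale k (x · y) (pack w) ⟨
    coeff (k *ₗ (x · y)) (pack w) ∎

  ·-scaleʳ : ∀ k x y → (x · (k *ₗ y)) ≈ᴹ (k *ₗ (x · y))
  ·-scaleʳ k x y = ≈ᴹ-ext (x · (k *ₗ y)) (k *ₗ (x · y)) λ w → begin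
    coeff (x · (k *ₗ y)) (pack w)
      ≈⟨ coeff-· x (k *ₗ y) w ⟩
    ∑ (splits w) (λ (u , v) → coeff x (pack u) * coeff (k *ₗ y) (pack v))
      ≈⟨ ∑-cong (splits w) (λ (u , v) → K.trans (K.*-congˡ (coeff-scale k y (pack v))) (x∙yz≈y∙xz _ k _)) ⟩
    ∑ (splits w) (λ (u , v) → k * (coeff x (pack u) * coeff y (pack v)))
      ≈⟨ *-distribˡ-∑ k (splits w) _ ⟨
    k * ∑ (splits w) (λ (u , v) → coeff x (pack u) * coeff y (pack v))
      ≈⟨ K.*-congˡ (coeff-· x y w) ⟨
    k * coeff (x · y) (pack w)
      ≈⟨ coeff-scale k (x · y) (pack w) ⟨
    coeff (k *ₗ (x · y)) (pack w) ∎

  fqsym-isAlgebra : IsAlgebra FQSym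
  fqsym-isAlgebra = record
    { isLeftModule = fqsym-isModule
    ; isRing = record
      { +-isAbelianGroup = Module.+ᴹ-isAbelianGroup fqsym-isModule
      ; *-cong           = λ {x} {x′} {y} {y′} → ·-cong x x′ y y′
      ; *-assoc          = ·-assoc
      ; *-identity       = ·-identityˡ , ·-identityʳ
      ; distrib          = ·-distribˡ , ·-distribʳ
      }
    ; ·-scaleˡ = ·-scaleˡ
    ; ·-scaleʳ = ·-scaleʳ
    }

  fqsymRing : Ring _ _
  fqsymRing = record { isRing = IsAlgebra.isRing fqsym-isAlgebra }

  module Conv = Convolution fqsymRing
  module Convᴷ = Convolution K.ring

  -- The coalgebra

  module _ {μ ℓμ : Level} {P : RawModule μ ℓμ} (isP : IsModule P) where
    private
      module P = Module isP
      module ∑ᴾ = Summation P.+ᴹ-commutativeMonoid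

    -- The scalar of each term of `Δ x` is carried by its left factor, which is why the hypothesis
    -- on `f` concerns scalars there. The result is in the form of a sum over cuts, ready for
    -- convolution.
    lift-Δ : ∀ (f : Combination → Combination → P.Carrierᴹ) →
             (∀ k x y → f (k *ₗ x) y P.≈ᴹ k P.*ₗ f x y) → ∀ x →
             lift P f (Δ x) P.≈ᴹ
             linear P (λ a → P.∑ᴹ (upTo (suc (size a))) (λ i → f (G (head i a)) (G (tail i a)))) x
    -- A sum in the tensor product is a concatenation of lists, so summing over it is an iterated
    -- sum.
    lift-Δ f f-scale x = P.≈ᴹ-trans (P.≈ᴹ-reflexive (cong (lift P f) (Δ≡ x))) (P.≈ᴹ-trans (∑ᴾ.∑-concatMap (λ (k , a) → k T.*ₗ ΔG a) x (uncurry f))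
      (P.∑ᴹ-cong x λ (k , a) → P.≈ᴹ-trans (scale k (ΔG a)) (P.*ₗ-congˡ (terms a))))
      where
      scale : ∀ k t → P.∑ᴹ (k T.*ₗ t) (uncurry f) P.≈ᴹ k P.*ₗ P.∑ᴹ t (uncurry f)
      scale k t = P.≈ᴹ-trans (P.≈ᴹ-reflexive (P.∑ᴹ-map _ t (uncurry f)))
        (P.≈ᴹ-trans (P.∑ᴹ-cong t (λ (x , y) → f-scale k x y)) (P.≈ᴹ-sym (P.*ₗ-distrib-∑ᴹ k t (uncurry f))))
      terms : ∀ a → P.∑ᴹ (ΔG a) (uncurry f) P.≈ᴹ
                    P.∑ᴹ (upTo (suc (size a))) (λ i → f (G (head i a)) (G (tail i a)))
      terms a = P.≈ᴹ-trans (∑ᴾ.∑-concatMap (λ i → G⊗G (head i a , tail i a)) (upTo (suc (size a))) (uncurry f))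
        (P.∑ᴹ-cong (upTo (suc (size a))) (λ i → P.+ᴹ-identityʳ _))

    linear-cong : ∀ {f g : ColoredPermutation → P.Carrierᴹ} → (∀ a → f a P.≈ᴹ g a) → ∀ x →
                  linear P f x P.≈ᴹ linear P g x
    linear-cong f≈g x = P.∑ᴹ-cong x (λ (k , a) → P.*ₗ-congˡ (f≈g a))

    linear-basis : ∀ (f : ColoredPermutation → P.Carrierᴹ) a → linear P f (G a) P.≈ᴹ f a
    linear-basis f a = P.≈ᴹ-trans (P.+ᴹ-identityʳ _) (P.*ₗ-identityˡ (f a))

  εG : ColoredPermutation → K.Carrier
  εG a = if does (size a ℕ.≟ 0) then 1# else 0#

  ε-linear : IsLinear fqsymModule ground ε
  ε-linear = linear-isLinear ground-isModule εG

  ε-G : ∀ a → ε (G a) ≈ Convᴷ.unit a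
  ε-G = linear-basis ground-isModule εG

  ε-scale : ∀ k x → ε (k *ₗ x) ≈ k * ε x
  ε-scale = Module.extend-scale ground-isModule εG

  counitˡ : ∀ x → lift fqsymModule (λ y z → ε y *ₗ z) (Δ x) ≈ᴹ x
  counitˡ x b = begin
    coeff (lift fqsymModule (λ y z → ε y *ₗ z) (Δ x)) b
      ≈⟨ lift-Δ fqsym-isModule (λ y z → ε y *ₗ z) scale x b ⟩
    coeff (linear fqsymModule f x) b
      ≈⟨ coeff-linear f x b ⟩
    ∑ x (λ (k , a) → k * coeff (f a) b)
      ≈⟨ ∑-cong x (λ (k , a) → K.*-congˡ (begin
           coeff (f a) b
             ≈⟨ coeff-∑ (upTo (suc (size a))) (λ i → ε (G (head i a)) *ₗ G (tail i a)) b ⟩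
           ∑ (upTo (suc (size a))) (λ i → coeff (ε (G (head i a)) *ₗ G (tail i a)) b)
             ≈⟨ ∑-cong (upTo (suc (size a))) (λ i → K.trans
                  (coeff-scale (ε (G (head i a))) (G (tail i a)) b) (K.*-congʳ (ε-G (head i a)))) ⟩
           -- For fixed `b` this is a convolution of linear forms, of the counit with the
           -- coefficient at `b`, and the unit law of convolution applies.
           (Convᴷ.unit Convᴷ.⋆ (λ a → coeff (G a) b)) a
             ≈⟨ Convᴷ.⋆-identityˡ (λ a → coeff (G a) b) a ⟩
           coeff (G a) b ∎)) ⟩
    ∑ x (λ (k , a) → k * coeff (G a) b)
      ≈⟨ coeff-linear G x b ⟨
    coeff (linear fqsymModule G x) b
      ≈⟨ linear-G x b ⟨
    coeff x b ∎
    where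
    f : ColoredPermutation → Combination
    f a = sum fqsymModule (map (λ i → ε (G (head i a)) *ₗ G (tail i a)) (upTo (suc (size a))))
    scale : ∀ k y z → (ε (k *ₗ y) *ₗ z) ≈ᴹ (k *ₗ (ε y *ₗ z))
    scale k y z b = begin
      coeff (ε (k *ₗ y) *ₗ z) b      ≈⟨ coeff-scale (ε (k *ₗ y)) z b ⟩
      ε (k *ₗ y) * coeff z b         ≈⟨ K.*-congʳ (ε-scale k y) ⟩
      (k * ε y) * coeff z b          ≈⟨ K.*-assoc k (ε y) _ ⟩
      k * (ε y * coeff z b)          ≈⟨ K.*-congˡ (coeff-scale (ε y) z b) ⟨
      k * coeff (ε y *ₗ z) b         ≈⟨ coeff-scale k (ε y *ₗ z) b ⟨
      coeff (k *ₗ (ε y *ₗ z)) b      ∎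

  counitʳ : ∀ x → lift fqsymModule (λ y z → ε z *ₗ y) (Δ x) ≈ᴹ x
  counitʳ x b = begin
    coeff (lift fqsymModule (λ y z → ε z *ₗ y) (Δ x)) b
      ≈⟨ lift-Δ fqsym-isModule (λ y z → ε z *ₗ y) scale x b ⟩
    coeff (linear fqsymModule f x) b
      ≈⟨ coeff-linear f x b ⟩
    ∑ x (λ (k , a) → k * coeff (f a) b)
      ≈⟨ ∑-cong x (λ (k , a) → K.*-congˡ (begin
           coeff (f a) b
             ≈⟨ coeff-∑ (upTo (suc (size a))) (λ i → ε (G (tail i a)) *ₗ G (head i a)) b ⟩
           ∑ (upTo (suc (size a))) (λ i → coeff (ε (G (tail i a)) *ₗ G (head i a)) b)
             ≈⟨ ∑-cong (upTo (suc (size a))) (λ i → K.trans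
                  (coeff-scale (ε (G (tail i a))) (G (head i a)) b)
                  -- The counit belongs to the right interval and has to become the second factor;
                  -- `K` is commutative.
                  (K.trans (K.*-congʳ (ε-G (tail i a))) (K.*-comm _ _))) ⟩
           ((λ a → coeff (G a) b) Convᴷ.⋆ Convᴷ.unit) a
             ≈⟨ Convᴷ.⋆-identityʳ (λ a → coeff (G a) b) a ⟩
           coeff (G a) b ∎)) ⟩
    ∑ x (λ (k , a) → k * coeff (G a) b)
      ≈⟨ coeff-linear G x b ⟨
    coeff (linear fqsymModule G x) b
      ≈⟨ linear-G x b ⟨
    coeff x b ∎
    where
    f : ColoredPermutation → Combination
    f a = sum fqsymModule (map (λ i → ε (G (tail i a)) *ₗ G (head i a)) (upTo (suc (size a))))
    scale : ∀ k y z → (ε z *ₗ (k *ₗ y)) ≈ᴹ (k *ₗ (ε z *ₗ y))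
    scale k y z b = begin
      coeff (ε z *ₗ (k *ₗ y)) b      ≈⟨ coeff-scale (ε z) (k *ₗ y) b ⟩
      ε z * coeff (k *ₗ y) b         ≈⟨ K.*-congˡ (coeff-scale k y b) ⟩
      ε z * (k * coeff y b)          ≈⟨ x∙yz≈y∙xz (ε z) k _ ⟩
      k * (ε z * coeff y b)          ≈⟨ K.*-congˡ (coeff-scale (ε z) y b) ⟨
      k * coeff (ε z *ₗ y) b         ≈⟨ coeff-scale k (ε z *ₗ y) b ⟨
      coeff (k *ₗ (ε z *ₗ y)) b      ∎

  Δ-linear : IsLinear fqsymModule F⊗F Δ
  Δ-linear = isLinear-cong F⊗F-isModule (λ x → T.≈ᴹ-reflexive (sym (Δ≡ x))) (linear-isLinear F⊗F-isModule ΔG)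

  private
    F⊗[F⊗F] : RawModule _ _
    F⊗[F⊗F] = fqsymModule ⊗ F⊗F

    F⊗[F⊗F]-isModule : IsModule F⊗[F⊗F]
    F⊗[F⊗F]-isModule = ⊗-isModule fqsym-isModule F⊗F-isModule

    module TT = Module F⊗[F⊗F]-isModule

    triple : Combination → Combination → Combination → Tensors fqsymModule F⊗F
    triple x y z = (x , (y , z) ∷ []) ∷ []

    GGG : ColoredPermutation → ColoredPermutation → ColoredPermutation → Tensors fqsymModule F⊗F
    GGG a b c = triple (G a) (G b) (G c)

    Δ⊗id : Combination → Combination → Tensors fqsymModule F⊗F
    Δ⊗id y z = lift F⊗[F⊗F] (λ y₁ y₂ → triple y₁ y₂ z) (Δ y)

    id⊗Δ : Combination → Combination → Tensors fqsymModule F⊗F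
    id⊗Δ y z = (y , Δ z) ∷ []

    Δ⊗id-basis : Combination → ColoredPermutation → Tensors fqsymModule F⊗F
    Δ⊗id-basis z a = TT.∑ᴹ (upTo (suc (size a))) (λ j → triple (G (head j a)) (G (tail j a)) z)

    id⊗Δ-basis : Combination → ColoredPermutation → Tensors fqsymModule F⊗F
    id⊗Δ-basis y b = TT.∑ᴹ (upTo (suc (size b))) (λ j → triple y (G (head j b)) (G (tail j b)))

    Δ⊗id-linear : ∀ y z → TT._≈ᴹ_ (Δ⊗id y z) (linear F⊗[F⊗F] (Δ⊗id-basis z) y)
    Δ⊗id-linear y z = lift-Δ F⊗[F⊗F]-isModule (λ y₁ y₂ → triple y₁ y₂ z) (λ _ _ _ → ≈⊗-refl) y

    Δ⊗id-scale : ∀ k y z → TT._≈ᴹ_ (Δ⊗id (k *ₗ y) z) (k TT.*ₗ Δ⊗id y z)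
    Δ⊗id-scale k y z = ≈⊗-trans (Δ⊗id-linear (k *ₗ y) z)
      (≈⊗-trans (TT.extend-scale (Δ⊗id-basis z) k y)
        (TT.*ₗ-congˡ {k} {linear F⊗[F⊗F] (Δ⊗id-basis z) y} {Δ⊗id y z} (≈⊗-sym (Δ⊗id-linear y z))))

    Δ⊗id-G : ∀ a z → TT._≈ᴹ_ (Δ⊗id (G a) z) (Δ⊗id-basis z a)
    Δ⊗id-G a z = ≈⊗-trans (Δ⊗id-linear (G a) z) (linear-basis F⊗[F⊗F]-isModule (Δ⊗id-basis z) a)

    Δ-G : ∀ a → Δ (G a) ≈ᵀᵀ ΔG a
    Δ-G a = ≈⊗-trans (T.≈ᴹ-reflexive (Δ≡ (G a))) (linear-basis F⊗F-isModule ΔG a)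

    id⊗Δ-G : ∀ y b → TT._≈ᴹ_ (id⊗Δ y (G b)) (id⊗Δ-basis y b)
    id⊗Δ-G y b = ≈⊗-trans (⊗-cong {x = y} {x′ = y} {y = Δ (G b)} {y′ = ΔG b} (λ _ → K.refl) (Δ-G b))
      (⊗-∑ʳ fqsym-isModule F⊗F-isModule y (upTo (suc (size b))) (λ j → G⊗G (head j b , tail j b)))

    -- Coassociativity on the basis: both sides are sums of `GGG` over double cuts, compared inside
    -- the tensor product without passing to coefficients.
    reassociate : ∀ a → TT._≈ᴹ_
      (TT.∑ᴹ (upTo (suc (size a))) (λ i → Δ⊗id (G (head i a)) (G (tail i a))))
      (TT.∑ᴹ (upTo (suc (size a))) (λ i → id⊗Δ (G (head i a)) (G (tail i a))))
    reassociate a = ≈⊗-trans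
      (TT.∑ᴹ-cong (upTo (suc (size a))) {λ i → Δ⊗id (G (head i a)) (G (tail i a))} {λ i → Δ⊗id-basis (G (tail i a)) (head i a)}
        (λ i → Δ⊗id-G (head i a) (G (tail i a))))
      (≈⊗-trans (∑-restrict-assoc TT.+ᴹ-commutativeMonoid a GGG)
      (TT.∑ᴹ-cong (upTo (suc (size a))) {λ i → id⊗Δ-basis (G (head i a)) (tail i a)} {λ i → id⊗Δ (G (head i a)) (G (tail i a))}
        (λ i → ≈⊗-sym (id⊗Δ-G (G (head i a)) (tail i a)))))

  coassoc : ∀ x → TT._≈ᴹ_ (lift F⊗[F⊗F] Δ⊗id (Δ x)) (lift F⊗[F⊗F] id⊗Δ (Δ x))
  coassoc x = ≈⊗-trans (lift-Δ F⊗[F⊗F]-isModule Δ⊗id Δ⊗id-scale x)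
    (≈⊗-trans (linear-cong F⊗[F⊗F]-isModule reassociate x)
    (≈⊗-sym (lift-Δ F⊗[F⊗F]-isModule id⊗Δ (λ _ _ _ → ≈⊗-refl) x)))

  fqsym-isCoalgebra : IsCoalgebra fqsymModule Δ ε
  fqsym-isCoalgebra = record
    { Δ-linear = Δ-linear
    ; ε-linear = ε-linear
    ; coassoc  = coassoc
    ; counitˡ  = counitˡ
    ; counitʳ  = counitʳ
    }

  Δ-isAlgebraHomomorphism : IsAlgebraHomomorphism FQSym (FQSym ⊗ᴬ FQSym) Δ
  Δ-isAlgebraHomomorphism = record
    { isLinear = Δ-linear
    ; ·-homo   = Δ-·-homo
    -- The empty permutation has the single cut 0, and both of its intervals are empty.
    ; 1-homo   = ≈⊗-trans (Δ-G (pack [])) (T.≈ᴹ-reflexive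
        (cong₂ (λ p q → (G p , G q) ∷ []) (head-zero (pack [])) (tail-all (pack []))))
    }

  -- The empty permutation is the only one of size 0, so testing the size is testing equality with
  -- it. The word formula for products then applies to the counit.
  ε-coeff : ∀ x → ε x ≈ coeff x (pack [])
  ε-coeff x = K.trans
    (∑-cong x (λ (k , a) → K.*-congˡ (⟦⟧-cong (size a ℕ.≟ 0) (a ≡? pack []) size0 (cong size))))
    (K.sym (coeff-coefficient x (pack [])))

  ε-isAlgebraHomomorphism : IsAlgebraHomomorphism FQSym groundAlgebra ε
  ε-isAlgebraHomomorphism = record
    { isLinear = ε-linear
    ; ·-homo   = λ x y → begin
        ε (x · y)                                        ≈⟨ ε-coeff (x · y) ⟩
        -- The empty word has a single split, into two empty words.
        coeff (x · y) (pack [])                          ≈⟨ coeff-· x y [] ⟩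
        coeff x (pack []) * coeff y (pack []) + 0#       ≈⟨ K.+-identityʳ _ ⟩
        coeff x (pack []) * coeff y (pack [])            ≈⟨ K.*-cong (ε-coeff x) (ε-coeff y) ⟨
        ε x * ε y                                        ∎
    ; 1-homo   = ε-G (pack [])
    }

  fqsym-isBialgebra : IsBialgebra FQSym Δ ε
  fqsym-isBialgebra = record
    { isAlgebra      = fqsym-isAlgebra
    ; isCoalgebra    = fqsym-isCoalgebra
    ; Δ-homomorphism = Δ-isAlgebraHomomorphism
    ; ε-homomorphism = ε-isAlgebraHomomorphism
    }

  -- The grading

  component : ℕ → Combination → Combination
  component n = filter (λ (_ , a) → size a ℕ.≟ n)

  coeff-component : ∀ n x b → coeff (component n x) b ≈ ⟦ size b ℕ.≟ n ⟧ * coeff x b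
  coeff-component n x b = begin
    coeff (component n x) b             ≈⟨ coeff-coefficient (component n x) b ⟩
    coefficient (component n x) b       ≈⟨ go x ⟩
    ⟦ size b ℕ.≟ n ⟧ * coefficient x b  ≈⟨ K.*-congˡ (coeff-coefficient x b) ⟨
    ⟦ size b ℕ.≟ n ⟧ * coeff x b        ∎
    where
    go : ∀ x → coefficient (component n x) b ≈ ⟦ size b ℕ.≟ n ⟧ * coefficient x b
    go []            = K.sym (K.zeroʳ _)
    go ((k , a) ∷ x) = case (size a ℕ.≟ n) (a ≡? b)
      where
      case : Dec (size a ≡ n) → (d : Dec (a ≡ b)) →
             coefficient (component n ((k , a) ∷ x)) b ≈
             ⟦ size b ℕ.≟ n ⟧ * coefficient ((k , a) ∷ x) b
      case (yes eq) d = begin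
        coefficient (component n ((k , a) ∷ x)) b
          ≡⟨ cong (λ y → coefficient y b) (List.filter-accept (λ (_ , a) → size a ℕ.≟ n) eq) ⟩
        k * ⟦ a ≡? b ⟧ + coefficient (component n x) b
          ≈⟨ K.+-cong (scaled d) (go x) ⟩
        ⟦ size b ℕ.≟ n ⟧ * (k * ⟦ a ≡? b ⟧) + ⟦ size b ℕ.≟ n ⟧ * coefficient x b
          ≈⟨ K.distribˡ _ _ _ ⟨
        ⟦ size b ℕ.≟ n ⟧ * (k * ⟦ a ≡? b ⟧ + coefficient x b) ∎
        where
        scaled : Dec (a ≡ b) → k * ⟦ a ≡? b ⟧ ≈ ⟦ size b ℕ.≟ n ⟧ * (k * ⟦ a ≡? b ⟧)
        scaled (yes refl) = K.sym (K.trans (K.*-congʳ (⟦⟧-true (size b ℕ.≟ n) eq)) (K.*-identityˡ _))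
        scaled (no ne) = K.trans zero′ (K.sym (K.trans (K.*-congˡ zero′) (K.zeroʳ _)))
          where
          zero′ : k * ⟦ a ≡? b ⟧ ≈ 0#
          zero′ = K.trans (K.*-congˡ (⟦⟧-false (a ≡? b) ne)) (K.zeroʳ k)
      case (no ne) d = begin
        coefficient (component n ((k , a) ∷ x)) b
          ≡⟨ cong (λ y → coefficient y b) (List.filter-reject (λ (_ , a) → size a ℕ.≟ n) ne) ⟩
        coefficient (component n x) b
          ≈⟨ go x ⟩
        ⟦ size b ℕ.≟ n ⟧ * coefficient x b
          ≈⟨ K.+-identityˡ _ ⟨
        0# + ⟦ size b ℕ.≟ n ⟧ * coefficient x b
          ≈⟨ K.+-congʳ (zeroᵇ d) ⟨
        ⟦ size b ℕ.≟ n ⟧ * (k * ⟦ a ≡? b ⟧) + ⟦ size b ℕ.≟ n ⟧ * coefficient x b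
          ≈⟨ K.distribˡ _ _ _ ⟨
        ⟦ size b ℕ.≟ n ⟧ * (k * ⟦ a ≡? b ⟧ + coefficient x b) ∎
        where
        zeroᵇ : Dec (a ≡ b) → ⟦ size b ℕ.≟ n ⟧ * (k * ⟦ a ≡? b ⟧) ≈ 0#
        zeroᵇ (yes refl) = K.trans (K.*-congʳ (⟦⟧-false (size b ℕ.≟ n) ne)) (K.zeroˡ _)
        zeroᵇ (no a≢b) = K.trans (K.*-congˡ (K.trans (K.*-congˡ (⟦⟧-false (a ≡? b) a≢b)) (K.zeroʳ k))) (K.zeroʳ _)

  component-degree : ∀ n x → Degree n (component n x)
  component-degree n x a ne = K.trans (coeff-component n x a)
    (K.trans (K.*-congʳ (⟦⟧-false (size a ℕ.≟ n) ne)) (K.zeroˡ _))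

  degree-component : ∀ {n x} → Degree n x → x ≈ᴹ component n x
  degree-component {n} {x} x-deg b = K.trans (lemma (size b ℕ.≟ n)) (K.sym (coeff-component n x b))
    where
    lemma : (d : Dec (size b ≡ n)) → coeff x b ≈ ⟦ d ⟧ * coeff x b
    lemma (yes _) = K.sym (K.*-identityˡ _)
    lemma (no ne) = K.trans (x-deg b ne) (K.sym (K.zeroˡ _))

  -- A strict bound on the sizes of the terms, since `upTo` excludes its end.
  sizeBound : Combination → ℕ
  sizeBound []            = 0
  sizeBound ((_ , a) ∷ x) = suc (size a) ℕ.⊔ sizeBound x

  size<sizeBound : ∀ x {k a} → (k , a) ∈ x → size a < sizeBound x
  size<sizeBound ((_ , a) ∷ x) (here refl) = ℕ.m≤m⊔n (suc (size a)) (sizeBound x)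
  size<sizeBound ((_ , a) ∷ x) (there ka∈)   = ℕ.≤-trans (size<sizeBound x ka∈) (ℕ.m≤n⊔m (suc (size a)) (sizeBound x))

  coeff-sizeBound : ∀ x b → sizeBound x ≤ size b → coeff x b ≈ 0#
  coeff-sizeBound x b x≤b = K.trans (coeff-coefficient x b) (∑-ε x λ {(k , a)} ka∈ →
    K.trans (K.*-congˡ (⟦⟧-false (a ≡? b) λ eq →
      ℕ.<⇒≱ (size<sizeBound x ka∈) (subst (sizeBound x ≤_) (cong size (sym eq)) x≤b))) (K.zeroʳ k))

  ∑-components : ∀ x → x ≈ᴹ sum fqsymModule (map (λ n → component n x) (upTo (sizeBound x)))
  ∑-components x b = K.sym (begin
    coeff (sum fqsymModule (map (λ n → component n x) (upTo (sizeBound x)))) b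
      ≈⟨ coeff-∑ (upTo (sizeBound x)) (λ n → component n x) b ⟩
    ∑ (upTo (sizeBound x)) (λ n → coeff (component n x) b)
      ≈⟨ ∑-cong (upTo (sizeBound x)) (λ n → coeff-component n x b) ⟩
    ∑ (upTo (sizeBound x)) (λ n → ⟦ size b ℕ.≟ n ⟧ * coeff x b)
      ≈⟨ select (size b ℕ.<? sizeBound x) ⟩
    coeff x b ∎)
    where
    select : Dec (size b < sizeBound x) → ∑ (upTo (sizeBound x)) (λ n → ⟦ size b ℕ.≟ n ⟧ * coeff x b) ≈ coeff x b
    select (yes b<) = K.trans
      (∑-unique (Unique.upTo⁺ (sizeBound x)) (Mem.∈-upTo⁺ b<)
        (λ {n} _ ne → K.trans (K.*-congʳ (⟦⟧-false (size b ℕ.≟ n) (ne ∘ sym))) (K.zeroˡ _)))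
      (K.trans (K.*-congʳ (⟦⟧-true (size b ℕ.≟ size b) refl)) (K.*-identityˡ _))
    select (no b≮) = K.trans
      (∑-ε (upTo (sizeBound x)) (λ _ → K.trans (K.*-congˡ x≈0) (K.zeroʳ _)))
      (K.sym x≈0)
      where
      x≈0 : coeff x b ≈ 0#
      x≈0 = coeff-sizeBound x b (ℕ.≮⇒≥ b≮)

  degree-isGrading : IsGrading fqsymModule Degree
  degree-isGrading = record
    { resp        = λ x≈y x-deg a ne → K.trans (K.sym (x≈y a)) (x-deg a ne)
    ; 0-closed    = λ _ _ → K.refl
    ; +-closed    = λ {_} {x} {y} x-deg y-deg a ne →
        K.trans (coeff-++ x y a) (K.trans (K.+-cong (x-deg a ne) (y-deg a ne)) (K.+-identityˡ 0#))
    ; *ₗ-closed   = λ k {x} x-deg a ne →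
        K.trans (coeff-scale k x a) (K.trans (K.*-congˡ (x-deg a ne)) (K.zeroʳ k))
    ; spanning    = λ x → sizeBound x , (λ n → component n x) , (λ n → component-degree n x) , ∑-components x
    ; independent = independent
    }
    where
    independent : ∀ N (f : ℕ → Combination) → (∀ n → Degree n (f n)) →
                  sum fqsymModule (map f (upTo N)) ≈ᴹ 0ᴹ → ∀ n → n < N → f n ≈ᴹ 0ᴹ
    independent N f f-deg f≈0 n n<N b = case (size b ℕ.≟ n)
      where
      case : Dec (size b ≡ n) → coeff (f n) b ≈ 0#
      -- At `b` only the summand of degree `size b` has a possibly nonzero coefficient, so the
      -- coefficient of the whole sum is that of `f n`.
      case (yes eq) = K.trans
        (K.sym (∑-unique (Unique.upTo⁺ N) (Mem.∈-upTo⁺ n<N)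
          (λ {k} _ k≢n → f-deg k b (λ eq′ → k≢n (trans (sym eq′) eq)))))
        (K.trans (K.sym (coeff-∑ (upTo N) f b)) (f≈0 b))
      case (no ne) = f-deg n b ne

  ·-degree : ∀ {m n x y} → Degree m x → Degree n y → Degree (m ℕ.+ n) (x · y)
  ·-degree {m} {n} {x} {y} x-deg y-deg c ne = subst (λ c → coeff (x · y) c ≈ 0#) (pack-letters c)
    (K.trans (coeff-· x y (letters c)) (∑-ε (splits (letters c)) λ {(u , v)} uv∈ →
      case u v (trans (cong length (sym (splits-++ (letters c) uv∈))) (List.length-++ u)) (length u ℕ.≟ m)))
    where
    case : ∀ u v → length (letters c) ≡ length u ℕ.+ length v → Dec (length u ≡ m) →
           coeff x (pack u) * coeff y (pack v) ≈ 0#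
    case u v len (yes eq) = K.trans (K.*-congˡ (y-deg (pack v) λ eq′ →
      ne (trans (sym (length-letters c)) (trans len (cong₂ ℕ._+_ eq eq′))))) (K.zeroʳ _)
    case u v len (no ne′) = K.trans (K.*-congʳ (x-deg (pack u) ne′)) (K.zeroˡ _)

  G-degree : ∀ {n a} → size a ≡ n → Degree n (G a)
  G-degree {n} {a} eq b ne = K.trans (coeff-G a b) (⟦⟧-false (a ≡? b) λ a≡b → ne (trans (cong size (sym a≡b)) eq))

  -- Homogeneity is a property of coefficients, so the list `x` may contain terms of other sizes
  -- that cancel. Filtering yields an equal element all of whose terms have size `n`, and the
  -- coproduct of each of these is visibly a sum of tensors of total degree `n`.
  Δ-degree : ∀ {n x} → Degree n x → TensorDegree fqsymModule Degree n (Δ x)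
  Δ-degree {n} {x} x-deg = linear F⊗F ΔG y ,
    ≈⊗-trans (T.≈ᴹ-reflexive (Δ≡ x))
      (extend-cong F⊗F-isModule ΔG x y (λ b → K.trans (K.sym (coeff-coefficient x b))
        (K.trans (degree-component {n} {x} x-deg b) (coeff-coefficient y b)))) ,
    All.concat⁺ (All.map⁺ {f = λ (k , a) → k T.*ₗ ΔG a} (All.tabulate {xs = y} λ {(k , a)} ka∈ →
      let a-size = proj₂ (Mem.∈-filter⁻ (λ (_ , a) → size a ℕ.≟ n) {xs = x} ka∈) in
      All.map⁺ (All.concat⁺ (All.map⁺ (All.tabulate λ {i} i∈ →
        homogeneous k a a-size i (ℕ.≤-pred (Mem.∈-upTo⁻ i∈)) ∷ [])))))
    where
    y : Combination
    y = component n x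
    homogeneous : ∀ k a → size a ≡ n → ∀ i → i ≤ size a →
      ∃ λ i′ → ∃ λ j′ → (i′ ℕ.+ j′ ≡ n) × Degree i′ (k *ₗ G (head i a)) × Degree j′ (G (tail i a))
    homogeneous k a a-size i i≤ = i , size a ℕ.∸ i , trans (ℕ.m+[n∸m]≡n i≤) a-size ,
      IsGrading.*ₗ-closed degree-isGrading {i} k {G (head i a)} (G-degree {a = head i a} (size-slice {0} a i≤)) ,
      G-degree {a = tail i a} (size-slice {i} a ℕ.≤-refl)

  fqsym-isGradedBialgebra : IsGradedBialgebra FQSym Δ ε Degree
  fqsym-isGradedBialgebra = record
    { isBialgebra = fqsym-isBialgebra
    ; isGrading   = degree-isGrading
    ; 1-degree    = G-degree {a = pack []} refl
    ; ·-degree    = λ {m} {n} {x} {y} → ·-degree {m} {n} {x} {y}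
    ; Δ-degree    = λ {n} {x} → Δ-degree {n} {x}
    ; ε-degree    = λ {n} {x} n≢0 x-deg → K.trans (ε-coeff x) (x-deg (pack []) (n≢0 ∘ sym))
    }

  -- The antipode

  -- `G` is the identity of the algebra restricted to the basis, and the antipode is the convolution
  -- inverse of the identity.
  SG : ColoredPermutation → Combination
  SG = Conv.leftInverse G

  S : Combination → Combination
  S = linear fqsymModule SG

  private
    -- Both antipode laws reduce to the basis, where `Conv.unit a` is the counit of `a` times the
    -- unit.
    antipode-∑ : ∀ (f : ColoredPermutation → Combination) → (∀ a → f a ≈ᴹ Conv.unit a) → ∀ x →
                 linear fqsymModule f x ≈ᴹ (ε x *ₗ 1ᴬ)
    antipode-∑ f f≈ x b = begin
      coeff (linear fqsymModule f x) b
        ≈⟨ coeff-linear f x b ⟩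
      ∑ x (λ (k , a) → k * coeff (f a) b)
        ≈⟨ ∑-cong x (λ (k , a) → K.trans (K.*-congˡ (K.trans (f≈ a b) (unit-coeff (size a ℕ.≟ 0)))) (K.sym (K.*-assoc k _ _))) ⟩
      ∑ x (λ (k , a) → (k * εG a) * coeff 1ᴬ b)
        ≈⟨ *-distribʳ-∑ (coeff 1ᴬ b) x (λ (k , a) → k * εG a) ⟨
      ε x * coeff 1ᴬ b
        ≈⟨ coeff-scale (ε x) 1ᴬ b ⟨
      coeff (ε x *ₗ 1ᴬ) b ∎
      where
      unit-coeff : ∀ {P : Set} (d : Dec P) → coeff (if does d then 1ᴬ else 0ᴹ) b ≈ ⟦ d ⟧ * coeff 1ᴬ b
      unit-coeff (yes _) = K.sym (K.*-identityˡ _)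
      unit-coeff (no _)  = K.sym (K.zeroˡ _)

  antipodeˡ : ∀ x → lift fqsymModule (λ y z → S y · z) (Δ x) ≈ᴹ (ε x *ₗ 1ᴬ)
  antipodeˡ x b = K.trans (lift-Δ fqsym-isModule (λ y z → S y · z) scale x b) (antipode-∑ _ sums x b)
    where
    scale : ∀ k y z → (S (k *ₗ y) · z) ≈ᴹ (k *ₗ (S y · z))
    scale k y z b = K.trans
      (·-cong (S (k *ₗ y)) (k *ₗ S y) z z (Module.extend-scale fqsym-isModule SG k y) (λ _ → K.refl) b)
      (·-scaleˡ k (S y) z b)
    sums : ∀ a → sum fqsymModule (map (λ i → S (G (head i a)) · G (tail i a)) (upTo (suc (size a)))) ≈ᴹ Conv.unit a
    sums a b = begin
      coeff (sum fqsymModule (map (λ i → S (G (head i a)) · G (tail i a)) (upTo (suc (size a))))) b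
        ≈⟨ coeff-∑ (upTo (suc (size a))) (λ i → S (G (head i a)) · G (tail i a)) b ⟩
      ∑ (upTo (suc (size a))) (λ i → coeff (S (G (head i a)) · G (tail i a)) b)
        ≈⟨ ∑-cong (upTo (suc (size a))) (λ i → ·-cong (S (G (head i a))) (SG (head i a)) (G (tail i a)) (G (tail i a))
             (linear-basis fqsym-isModule SG (head i a)) (λ _ → K.refl) b) ⟩
      ∑ (upTo (suc (size a))) (λ i → coeff (SG (head i a) · G (tail i a)) b)
        ≈⟨ coeff-∑ (upTo (suc (size a))) (λ i → SG (head i a) · G (tail i a)) b ⟨
      coeff ((SG Conv.⋆ G) a) b
        -- The normalization of `G` at the empty permutation holds by computation: `G (pack [])` is
        -- `1ᴬ`.
        ≈⟨ Conv.leftInverse-⋆ G (λ _ → K.refl) a b ⟩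
      coeff (Conv.unit a) b ∎

  antipodeʳ : ∀ x → lift fqsymModule (λ y z → y · S z) (Δ x) ≈ᴹ (ε x *ₗ 1ᴬ)
  antipodeʳ x b = K.trans (lift-Δ fqsym-isModule (λ y z → y · S z) (λ k y z → ·-scaleˡ k y (S z)) x b) (antipode-∑ _ sums x b)
    where
    sums : ∀ a → sum fqsymModule (map (λ i → G (head i a) · S (G (tail i a))) (upTo (suc (size a)))) ≈ᴹ Conv.unit a
    sums a b = begin
      coeff (sum fqsymModule (map (λ i → G (head i a) · S (G (tail i a))) (upTo (suc (size a))))) b
        ≈⟨ coeff-∑ (upTo (suc (size a))) (λ i → G (head i a) · S (G (tail i a))) b ⟩
      ∑ (upTo (suc (size a))) (λ i → coeff (G (head i a) · S (G (tail i a))) b)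
        ≈⟨ ∑-cong (upTo (suc (size a))) (λ i → ·-cong (G (head i a)) (G (head i a)) (S (G (tail i a))) (SG (tail i a))
             (λ _ → K.refl) (linear-basis fqsym-isModule SG (tail i a)) b) ⟩
      ∑ (upTo (suc (size a))) (λ i → coeff (G (head i a) · SG (tail i a)) b)
        ≈⟨ coeff-∑ (upTo (suc (size a))) (λ i → G (head i a) · SG (tail i a)) b ⟨
      coeff ((G Conv.⋆ SG) a) b
        ≈⟨ Conv.⋆-leftInverse G (λ _ → K.refl) a b ⟩
      coeff (Conv.unit a) b ∎

  fqsym-isHopfAlgebra : IsHopfAlgebra FQSym Δ ε
  fqsym-isHopfAlgebra = record
    { isBialgebra = fqsym-isBialgebra
    ; antipode    = S
    ; isAntipode  = record
      { S-linear  = linear-isLinear fqsym-isModule SG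
      ; antipodeˡ = antipodeˡ
      ; antipodeʳ = antipodeʳ
      }
    }

theorem2p3 : ∀ {c ℓ : Level} (K : CommutativeRing c ℓ) →
    (l : ℕ) → 1 ≤ l → (C : Set) (C↔Fin : C ↔ Fin l) →
    let open HopfAlgebras K
        open ColoredFQSym K C↔Fin
    in IsAlgebraHomomorphism FQSym (FQSym ⊗ᴬ FQSym) Δ
       × IsGradedBialgebra FQSym Δ ε Degree
       × IsHopfAlgebra FQSym Δ ε
theorem2p3 K l 1≤l C C↔Fin = Δ-isAlgebraHomomorphism , fqsym-isGradedBialgebra , fqsym-isHopfAlgebra
  where open FQSymHopf K C↔Fin
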